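{- Suppose $n=p^k$ with $p$ prime and $k\ge1$, or $n=pq$ with $p,q$ distinct primes, or $n=12$. Then for every realizable flag type $T$ of degree $n$ there exists a prime tower type $(p_1,\dots,p_t)$ of degree $n$ with $T\ge T(p_1,\dots,p_t)$.
   Context: Let $[n]=\{0,\dots,n-1\}$. A flag type of degree $n$ is a function $T:[n]\times[n]\to[n]$ such that $T(i,j)=T(j,i)$, $T(i,0)=i$, and $T(i,j)\le T(i+1,j)$ for $i<n-1$. A flag of a finite abelian group $G$ of order $n$ (written multiplicatively) is a chain of subsets $\{1\}=F_0\subset\cdots\subset F_{n-1}=G$ with $|F_i|=i+1$; a flag of a degree $n$ field extension $L/K$ is a chain of $K$-subspaces $K=F_0\subset\cdots\subset F_{n-1}=L$ with $\dim_KF_i=i+1$. The flag type of a flag is $T_{\mathcal F}(i,j)=\min\{k: F_iF_j\subseteq F_k\}$, where $F_iF_j$ is the set of products (groups) or the $K$-span of products (fields). A flag type is realizable if it equals $T_{\mathcal F}$ for some flag of a finite abelian group or finite field extension. $T\le T'$ iff $T(i,j)\le T'(i,j)$ for all $i,j$. A prime tower type of degree $n$ is a tuple $(p_1,\dots,p_t)$ of primes with product $n$. Writing $m\in[n]$ as $m=m_1+m_2p_1+\cdots+m_tp_1\cdots p_{t-1}$ ($0\le m_s<p_s$), let $H=C_{p_1}\times\cdots\times C_{p_t}$, $e_s$ a generator of the $s$-th factor, $v_m=e_1^{m_1}\cdots e_t^{m_t}$, $F_m=\{v_0,\dots,v_m\}$; $T(p_1,\dots,p_t)$ is the flag type of this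 flag of $H$. -}

module Defs where

open import Level using (Level; _⊔_) renaming (suc to lsuc)
import Data.Nat as N
open N using (ℕ; zero; suc; _≤_; _≥_)
open import Data.Fin using (Fin; toℕ)
open import Data.List using (List; []; _∷_)
open import Data.Nat.ListAction using (product)
open import Data.List.Relation.Unary.All using (All)
open import Data.Nat.Primality using (Prime)
open import Data.Product using (Σ; ∃; _×_; _,_)
open import Data.Sum using (_⊎_)
open import Data.Unit.Polymorphic using (⊤)
open import Relation.Nullary using (¬_)
open import Relation.Binary.PropositionalEquality using (_≡_; _≢_)
open import Algebra.Bundles using (AbelianGroup; CommutativeRing)

IsFlagType : (n : ℕ) → (Fin n → Fin n → Fin n) → Set
IsFlagType n T =
  (∀ i j → T i j ≡ T j i) ×
  (∀ i (z : Fin n) → toℕ z ≡ 0 → T i z ≡ i) ×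
  (∀ i i' j → toℕ i' ≡ suc (toℕ i) → toℕ (T i j) ≤ toℕ (T i' j))

module _ {c ℓ : Level} {A : Set c} (_≈_ : A → A → Set ℓ) where

  Respects≈ : ∀ {p} → (A → Set p) → Set (c ⊔ ℓ ⊔ p)
  Respects≈ P = ∀ {x y} → x ≈ y → P x → P y

  HasSize : ∀ {p} → (A → Set p) → ℕ → Set (c ⊔ ℓ ⊔ p)
  HasSize P m = Σ (Fin m → A) λ f →
    (∀ a → P (f a)) ×
    (∀ a b → f a ≈ f b → a ≡ b) ×
    (∀ x → P x → ∃ λ a → x ≈ f a)

module _ {c ℓ : Level} (G : AbelianGroup c ℓ) where
  open AbelianGroup G

  GProdIn : ∀ {p} → (Carrier → Set p) → (Carrier → Set p) → (Carrier → Set p) → Set (c ⊔ p)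
  GProdIn A B C = ∀ x y → A x → B y → C (x ∙ y)

  IsGroupFlag : ∀ {p} (n : ℕ) → (Fin n → Carrier → Set p) → Set (c ⊔ ℓ ⊔ p)
  IsGroupFlag {p} n F =
    HasSize _≈_ {p} (λ _ → ⊤) n ×
    (∀ i → Respects≈ _≈_ (F i)) ×
    (∀ i → HasSize _≈_ (F i) (suc (toℕ i))) ×
    (∀ i i' → toℕ i' ≡ suc (toℕ i) → ∀ x → F i x → F i' x) ×
    (∀ i → toℕ i ≡ 0 → ∀ x → (F i x → x ≈ ε) × (x ≈ ε → F i x)) ×
    (∀ i → toℕ i ≡ n N.∸ 1 → ∀ x → F i x)

  IsGroupFlagTypeOf : ∀ {p} (n : ℕ) → (Fin n → Carrier → Set p) → (Fin n → Fin n → Fin n) → Set (c ⊔ p)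
  IsGroupFlagTypeOf n F T =
    ∀ i j → GProdIn (F i) (F j) (F (T i j)) ×
            (∀ k → GProdIn (F i) (F j) (F k) → toℕ (T i j) ≤ toℕ k)

record Field (c ℓ : Level) : Set (lsuc (c ⊔ ℓ)) where
  field
    commutativeRing : CommutativeRing c ℓ
  open CommutativeRing commutativeRing public
  field
    0≉1 : ¬ (0# ≈ 1#)
    inverse : ∀ x → ¬ (x ≈ 0#) → ∃ λ y → (x * y) ≈ 1#

module _ {c ℓ : Level} (L : Field c ℓ) where
  open Field L

  sumL : (m : ℕ) → (Fin m → Carrier) → Carrier
  sumL zero f = 0#
  sumL (suc m) f = f Fin.zero + sumL m (λ a → f (Fin.suc a))
    where import Data.Fin as Fin

  IsSubfield : ∀ {p} → (Carrier → Set p) → Set (c ⊔ ℓ ⊔ p)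
  IsSubfield K =
    Respects≈ _≈_ K × K 0# × K 1# ×
    (∀ x y → K x → K y → K (x + y)) ×
    (∀ x → K x → K (- x)) ×
    (∀ x y → K x → K y → K (x * y)) ×
    (∀ x → K x → ¬ (x ≈ 0#) → ∃ λ y → K y × (x * y) ≈ 1#)

  module _ {p : Level} (K : Carrier → Set p) where

    IsSubspace : (Carrier → Set p) → Set (c ⊔ ℓ ⊔ p)
    IsSubspace V =
      Respects≈ _≈_ V × V 0# ×
      (∀ x y → V x → V y → V (x + y)) ×
      (∀ a x → K a → V x → V (a * x))

    HasDim : (Carrier → Set p) → ℕ → Set (c ⊔ ℓ ⊔ p)
    HasDim V d = Σ (Fin d → Carrier) λ b →
      (∀ a → V (b a)) ×
      (∀ (co : Fin d → Carrier) → (∀ a → K (co a)) →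
         sumL d (λ a → co a * b a) ≈ 0# → ∀ a → co a ≈ 0#) ×
      (∀ x → V x → Σ (Fin d → Carrier) λ co →
         (∀ a → K (co a)) × x ≈ sumL d (λ a → co a * b a))

    FSpanProdIn : (Carrier → Set p) → (Carrier → Set p) → (Carrier → Set p) → Set (c ⊔ p)
    FSpanProdIn A B C = ∀ (m : ℕ) (co x y : Fin m → Carrier) →
      (∀ a → K (co a)) → (∀ a → A (x a)) → (∀ a → B (y a)) →
      C (sumL m (λ a → co a * (x a * y a)))

    IsFieldFlag : (n : ℕ) → (Fin n → Carrier → Set p) → Set (c ⊔ ℓ ⊔ p)
    IsFieldFlag n F =
      IsSubfield K ×
      HasDim (λ _ → ⊤) n ×
      (∀ i → IsSubspace (F i)) ×
      (∀ i → HasDim (F i) (suc (toℕ i))) ×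
      (∀ i i' → toℕ i' ≡ suc (toℕ i) → ∀ x → F i x → F i' x) ×
      (∀ i → toℕ i ≡ 0 → ∀ x → (F i x → K x) × (K x → F i x)) ×
      (∀ i → toℕ i ≡ n N.∸ 1 → ∀ x → F i x)

    IsFieldFlagTypeOf : (n : ℕ) → (Fin n → Carrier → Set p) → (Fin n → Fin n → Fin n) → Set (c ⊔ p)
    IsFieldFlagTypeOf n F T =
      ∀ i j → FSpanProdIn (F i) (F j) (F (T i j)) ×
              (∀ k → FSpanProdIn (F i) (F j) (F k) → toℕ (T i j) ≤ toℕ k)

Realizable : (c ℓ p : Level) (n : ℕ) → (Fin n → Fin n → Fin n) → Set (lsuc (c ⊔ ℓ ⊔ p))
Realizable c ℓ p n T =
  (Σ (AbelianGroup c ℓ) λ G → Σ (Fin n → AbelianGroup.Carrier G → Set p) λ F →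
     IsGroupFlag G n F × IsGroupFlagTypeOf G n F T)
  ⊎
  (Σ (Field c ℓ) λ L → Σ (Field.Carrier L → Set p) λ K →
   Σ (Fin n → Field.Carrier L → Set p) λ F →
     IsFieldFlag L K n F × IsFieldFlagTypeOf L K n F T)

IsPrimeTowerType : ℕ → List ℕ → Set
IsPrimeTowerType n ps = All Prime ps × product ps ≡ n

-- index of v_a · v_b in H = C_{p_1} × ⋯ × C_{p_t}, where v_m has
-- mixed-radix digits m_s of m (multiplication = digitwise addition mod p_s)
towerMul : List ℕ → ℕ → ℕ → ℕ
towerMul [] a b = 0
towerMul (zero ∷ ps) a b = 0
towerMul (suc q ∷ ps) a b =
  ((a N.% suc q N.+ b N.% suc q) N.% suc q) N.+ suc q N.* towerMul ps (a N./ suc q) (b N./ suc q)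

maxUpTo : (ℕ → ℕ) → ℕ → ℕ
maxUpTo f zero = f zero
maxUpTo f (suc i) = f (suc i) N.⊔ maxUpTo f i

-- T(p_1,…,p_t)(i,j) = min{k : F_i F_j ⊆ F_k} = max{ index(v_a v_b) : a ≤ i, b ≤ j }
towerType : List ℕ → ℕ → ℕ → ℕ
towerType ps i j = maxUpTo (λ a → maxUpTo (λ b → towerMul ps a b) j) i

GoodDegree : ℕ → Set
GoodDegree n =
  (∃ λ p → ∃ λ k → Prime p × k ≥ 1 × n ≡ p N.^ k) ⊎
  (∃ λ p → ∃ λ q → Prime p × Prime q × p ≢ q × n ≡ p N.* q) ⊎
  n ≡ 12

{-# OPTIONS --safe #-}
-- Groups and field extensions are treated at once as modular lattices of subspaces on which the points act
-- by multiplication.  For such a lattice we prove Kneser's theorem: if H is the stabilizer of AB then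
-- |AB| ≥ |AH| + |BH| − |H|.  The proof is the isoperimetric one of Balandraud and Bachoc–Serra–Zémor, which
-- also covers inseparable extensions: for fixed S the boundary |XS| − |X| is submodular, and as the
-- permitted boundary grows, the saturated X within it are stable under a decreasing chain of subfields.
--
-- Let H, of order h, be the stabilizer of F i · F j.  Kneser's theorem gives
-- T(i,j) + 1 ≥ h (⌈(i+1)/h⌉ + ⌈(j+1)/h⌉ − 1), and T(p₁,…,pₜ)(i,j) + 1 is at most the right-hand side when h
-- is one of the partial products 1, p₁, p₁p₂, ….  So T fails to dominate a tower only at a pair whose
-- stabilizer has an order that is not a partial product.  For n = pᵏ there is no such order.  For n = pq and
-- n = 12 it remains to show that certain orders do not occur together: p and q, and 3 and 4 (where H and H′
-- span everything and a semistability argument bounds F i by the product of its ranks over H and H′), 6 and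
-- 4, and 3 and 2.
module Submission where

open import Defs
open import Level using (Level; _⊔_; Lift; lift; lower) renaming (suc to lsuc)
open import Algebra.Bundles using (AbelianGroup)
open import Data.Empty using (⊥; ⊥-elim)
open import Data.Fin using (Fin; toℕ; fromℕ<) renaming (zero to fzero; suc to fsuc)
open import Data.Fin.Properties using (any?; toℕ<n; toℕ-injective; toℕ-fromℕ<)
open import Data.List using (List; []; _∷_; _++_; replicate)
open import Data.List.Properties using (++-identityʳ)
open import Data.List.Relation.Unary.All as All using (All)
open import Data.Nat using (ℕ; zero; suc; _+_; _*_; _∸_; _^_; _≤_; _<_; z≤n; s≤s; NonZero; >-nonZero)
open import Data.Nat.DivMod using (_/_; _%_; m≡m%n+[m/n]*n; m%n<n; m%n≤m; m<n*o⇒m/o<n)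
open import Data.Nat.Divisibility using (_∣_; _∣?_; divides; ∣m∣n⇒∣m+n; ∣m+n∣m⇒∣n; ∣-refl; _∣0; ∣⇒≤; ∣1⇒≡1; m∣m*n)
open import Data.Nat.LCM using (lcm; lcm-least)
open import Data.Nat.ListAction using (product)
open import Data.Nat.Primality using (Prime; euclidsLemma; prime⇒irreducible; prime⇒nonZero; ¬prime[1]; prime?)
open import Data.Nat.Properties
open import Data.Nat.Tactic.RingSolver using (solve)
open import Data.Product using (Σ; ∃; ∃₂; _×_; _,_; proj₁; proj₂)
open import Data.Sum using (_⊎_; inj₁; inj₂)
open import Data.Unit.Polymorphic using (⊤; tt)
open import Function using (_∘_; id)
open import Relation.Binary.PropositionalEquality using (_≡_; _≢_; refl; sym; trans; cong; cong₂; subst; subst₂)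
open import Relation.Nullary using (¬_; Dec; yes; no; ¬¬-excluded-middle)
open import Relation.Nullary.Decidable using (decidable-stable; from-no; from-yes)

-- Subspaces and dimension

-- Membership in K is undecidable, so everything runs under double negation. Nothing is lost: the
-- conclusion is a decidable inequality of numbers, and the finitely many pairs (i, j) can be
-- searched. The form (x, s, z) ↦ λ(xsz) is symmetric, so X ↦ (XS)^⊥ is an antitone Galois
-- connection of the lattice with itself. It preserves the boundary of a saturated X, so each
-- minimality argument can also be run on the dual, and this is what controls X whose product with S
-- is nearly everything. In a group with subgroups H, H′ of coprime orders and |H||H′| = n, a coset
-- of H meets one of H′ in a single point, which bounds F i by a product of two coset counts. A
-- subspace of a field has no such points to count; a slope inequality replaces the count. For n =
-- 12 the towers (2,2,3), (2,3,2), (3,2,2) can fail only at orders 3 or 6, 3 or 4, 2 or 4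
-- respectively. Any choice of one order from each list contains one of the pairs {3,2}, {3,4},
-- {6,4}.

≤-stable : ∀ {m n} → ¬ ¬ (m ≤ n) → m ≤ n
≤-stable {m} {n} = decidable-stable (m ≤? n)

decide : ∀ {a} (A : Set a) → ¬ ¬ Dec A
decide A = ¬¬-excluded-middle

≡-stable : ∀ {m n : ℕ} → ¬ ¬ (m ≡ n) → m ≡ n
≡-stable {m} {n} = decidable-stable (m ≟ n)

-- For a group the line through x and y is {x, y}; for a field extension L/K the points are the nonzero
-- elements of L and the line through x and y is (Kx + Ky) ∖ {0}.
record Geometry (c ℓ p : Level) : Set (lsuc (c ⊔ ℓ ⊔ p)) where
  field
    points : AbelianGroup c ℓ
  open AbelianGroup points public
    using (_≈_; _∙_; ε; _⁻¹; comm; assoc; identityˡ; inverseˡ; inverseʳ; ∙-congˡ; ∙-congʳ)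
    renaming (Carrier to Pt; refl to ≈-refl; sym to ≈-sym; trans to ≈-trans)
  field
    Line : Pt → Pt → Pt → Set (c ⊔ ℓ ⊔ p)
    line-≈ : ∀ {x y z} → z ≈ x → Line x y z
    line-sym : ∀ {x y z} → Line x y z → Line y x z
    -- In a field extension the multiples of x are distinct points, and `Line x x z` says that z is
    -- one of them. The first alternative is the case in which y has coefficient zero.
    line-exchange : ∀ {x y z} → Line x y z → ¬ ¬ (Line x x z ⊎ Line x z y)
    line-point-sym : ∀ {x z} → Line x x z → Line z z x
    line-point-closed : ∀ {x y z w} → Line x x y → Line x x z → Line y z w → Line x x w
    -- In a field, z is the sum of a combination of x₁, x₂ and one of y₁, y₂. Since 0 is not a
    -- point, the vanishing of either summand needs its own alternative.
    line-veblen : ∀ {x₁ y₁ z₁ x₂ y₂ z₂ z} → Line x₁ y₁ z₁ → Line x₂ y₂ z₂ → Line z₁ z₂ z →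
      ¬ ¬ (Line x₁ x₂ z ⊎ Line y₁ y₂ z ⊎
           ∃₂ λ x y → Line x₁ x₂ x × Line y₁ y₂ y × Line x y z)
    line-∙ : ∀ w {x y z} → Line x y z → Line (w ∙ x) (w ∙ y) (w ∙ z)

module Subspaces {c ℓ p : Level} (geometry : Geometry c ℓ p) where
  open Geometry geometry

  -- Membership is ¬¬-stable because K need not have decidable equality; correspondingly all
  -- existence statements about subspaces are doubly negated.
  record Sub : Set (lsuc (c ⊔ ℓ ⊔ p)) where
    field
      mem    : Pt → Set (c ⊔ ℓ ⊔ p)
      stable : ∀ {x} → ¬ ¬ mem x → mem x
      closed : ∀ {x y z} → mem x → mem y → Line x y z → mem z
  open Sub public

  infix 4 _∈_ _∉_ _⊆_ _≐_
  infixl 6 _∨_ _⊕_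
  infixl 7 _∧_

  _∈_ _∉_ : Pt → Sub → Set (c ⊔ ℓ ⊔ p)
  x ∈ X = mem X x
  x ∉ X = ¬ (x ∈ X)

  _⊆_ _≐_ : Sub → Sub → Set (c ⊔ ℓ ⊔ p)
  X ⊆ Y = ∀ {x} → x ∈ X → x ∈ Y
  X ≐ Y = X ⊆ Y × Y ⊆ X

  ∈-resp : ∀ X {x y} → x ≈ y → x ∈ X → y ∈ X
  ∈-resp X x≈y x∈X = closed X x∈X x∈X (line-≈ (≈-sym x≈y))

  data Span (P : Pt → Set (c ⊔ ℓ ⊔ p)) : Pt → Set (c ⊔ ℓ ⊔ p) where
    base : ∀ {x} → P x → Span P x
    line : ∀ {x y z} → Span P x → Span P y → Line x y z → Span P z

  ⟪_⟫ : (Pt → Set (c ⊔ ℓ ⊔ p)) → Sub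
  ⟪ P ⟫ = record
    { mem    = λ x → ¬ ¬ Span P x
    ; stable = λ h k → h λ h′ → h′ k
    ; closed = λ hx hy l k → hx λ sx → hy λ sy → k (line sx sy l)
    }

  ⟪⟫-⊆ : ∀ {P} X → (∀ {x} → P x → x ∈ X) → ⟪ P ⟫ ⊆ X
  ⟪⟫-⊆ {P} X P⊆X h = stable X λ k → h λ s → k (go s)
    where
    go : ∀ {x} → Span P x → x ∈ X
    go (base q)     = P⊆X q
    go (line s t l) = closed X (go s) (go t) l

  _∧_ _∨_ : Sub → Sub → Sub
  X ∧ Y = record
    { mem    = λ x → x ∈ X × x ∈ Y
    ; stable = λ h → stable X (λ k → h (k ∘ proj₁)) , stable Y (λ k → h (k ∘ proj₂))
    ; closed = λ (a , b) (a′ , b′) l → closed X a a′ l , closed Y b b′ l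
    }
  X ∨ Y = ⟪ (λ x → x ∈ X ⊎ x ∈ Y) ⟫

  pt : Pt → Sub
  pt y = record
    { mem    = λ z → ¬ ¬ Line y y z
    ; stable = λ h k → h λ h′ → h′ k
    ; closed = λ h h′ l k → h λ m → h′ λ m′ → k (line-point-closed m m′ l)
    }

  _⊕_ : Sub → Pt → Sub
  X ⊕ y = X ∨ pt y

  ∅ₛ ⊤ₛ : Sub
  ∅ₛ = record { mem = λ _ → Lift _ ⊥ ; stable = λ h → lift (h lower) ; closed = λ h _ _ → h }
  ⊤ₛ = record { mem = λ _ → ⊤ ; stable = λ _ → tt ; closed = λ _ _ _ → tt }

  ≐-refl : ∀ X → X ≐ X
  ≐-refl X = (λ m → m) , (λ m → m)

  ≐-sym : ∀ X Y → X ≐ Y → Y ≐ X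
  ≐-sym X Y (f , g) = (λ m → g m) , (λ m → f m)

  ∨-inˡ : ∀ X Y → X ⊆ X ∨ Y
  ∨-inˡ X Y x∈X k = k (base (inj₁ x∈X))

  ∨-inʳ : ∀ X Y → Y ⊆ X ∨ Y
  ∨-inʳ X Y y∈Y k = k (base (inj₂ y∈Y))

  ∨-⊆ : ∀ X Y Z → X ⊆ Z → Y ⊆ Z → X ∨ Y ⊆ Z
  ∨-⊆ X Y Z X⊆Z Y⊆Z = ⟪⟫-⊆ Z λ { (inj₁ m) → X⊆Z m ; (inj₂ m) → Y⊆Z m }

  pt-self : ∀ y → y ∈ pt y
  pt-self y k = k (line-≈ ≈-refl)

  pt-⊆ : ∀ {y} X → y ∈ X → pt y ⊆ X
  pt-⊆ X y∈X h = stable X λ k → h λ m → k (closed X y∈X y∈X m)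

  pt-sym : ∀ {y z} → z ∈ pt y → y ∈ pt z
  pt-sym h k = h (k ∘ line-point-sym)

  ⊕-inˡ : ∀ X y → X ⊆ X ⊕ y
  ⊕-inˡ X y = ∨-inˡ X (pt y)

  ⊕-inʳ : ∀ X y → y ∈ X ⊕ y
  ⊕-inʳ X y = ∨-inʳ X (pt y) (pt-self y)

  ⊕-⊆ : ∀ X y Z → X ⊆ Z → y ∈ Z → X ⊕ y ⊆ Z
  ⊕-⊆ X y Z X⊆Z y∈Z = ∨-⊆ X (pt y) Z X⊆Z (pt-⊆ Z y∈Z)

  private
    data Joined (X Y : Sub) (z : Pt) : Set (c ⊔ ℓ ⊔ p) where
      left  : z ∈ X → Joined X Y z
      right : z ∈ Y → Joined X Y z
      both  : ∀ {x y} → x ∈ X → y ∈ Y → Line x y z → Joined X Y z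

    joined-line : ∀ X Y {x₁ y₁ z₁ x₂ y₂ z₂ z} → x₁ ∈ X → y₁ ∈ Y → Line x₁ y₁ z₁ →
      x₂ ∈ X → y₂ ∈ Y → Line x₂ y₂ z₂ → Line z₁ z₂ z → ¬ ¬ Joined X Y z
    joined-line X Y x₁ y₁ l₁ x₂ y₂ l₂ l k = line-veblen l₁ l₂ l λ where
      (inj₁ m)                             → k (left (closed X x₁ x₂ m))
      (inj₂ (inj₁ m))                      → k (right (closed Y y₁ y₂ m))
      (inj₂ (inj₂ (x , y , mx , my , m))) → k (both (closed X x₁ x₂ mx) (closed Y y₁ y₂ my) m)

    joined-closed : ∀ X Y {z₁ z₂ z} → Joined X Y z₁ → Joined X Y z₂ → Line z₁ z₂ z → ¬ ¬ Joined X Y z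
    joined-closed X Y (left a)     (left b)     l k = k (left (closed X a b l))
    joined-closed X Y (left a)     (right b)    l k = k (both a b l)
    joined-closed X Y (right a)    (left b)     l k = k (both b a (line-sym l))
    joined-closed X Y (right a)    (right b)    l k = k (right (closed Y a b l))
    joined-closed X Y (both a b m) (both a′ b′ m′) l =
      joined-line X Y a b m a′ b′ m′ l
    joined-closed X Y (left a)     (both a′ b′ m′) l =
      joined-line X Y a b′ (line-≈ ≈-refl) a′ b′ m′ l
    joined-closed X Y (right b)    (both a′ b′ m′) l =
      joined-line X Y a′ b (line-sym (line-≈ ≈-refl)) a′ b′ m′ l
    joined-closed X Y (both a b m) (left a′)    l =
      joined-line X Y a b m a′ b (line-≈ ≈-refl) l
    joined-closed X Y (both a b m) (right b′)   l =
      joined-line X Y a b m a b′ (line-sym (line-≈ ≈-refl)) l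

  -- By `line-veblen` the union of X, Y and all lines joining them is already closed under lines, so
  -- the inductive span needs only one step.
  ∨-elim : ∀ X Y {z} → z ∈ X ∨ Y → ¬ ¬ (z ∈ X ⊎ z ∈ Y ⊎ ∃₂ λ x y → x ∈ X × y ∈ Y × Line x y z)
  ∨-elim X Y z∈ k = z∈ λ s → go s λ where
      (left a)     → k (inj₁ a)
      (right b)    → k (inj₂ (inj₁ b))
      (both a b l) → k (inj₂ (inj₂ (_ , _ , a , b , l)))
    where
    go : ∀ {z} → Span (λ x → x ∈ X ⊎ x ∈ Y) z → ¬ ¬ Joined X Y z
    go (base (inj₁ a)) k = k (left a)
    go (base (inj₂ b)) k = k (right b)
    go (line s t l)    k = go s λ a → go t λ b → joined-closed X Y a b l k

  -- If z ∈ Z lies on the line from x ∈ X to y ∈ Y, exchange puts y on the line through x and z,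
  -- hence in Z, unless z is a multiple of x.
  ∨-modular : ∀ X Y Z → X ⊆ Z → (X ∨ Y) ∧ Z ⊆ X ∨ (Y ∧ Z)
  ∨-modular X Y Z X⊆Z (z∈ , z∈Z) = stable (X ∨ (Y ∧ Z)) λ k → ∨-elim X Y z∈ λ where
    (inj₁ a)        → k (∨-inˡ X (Y ∧ Z) a)
    (inj₂ (inj₁ b)) → k (∨-inʳ X (Y ∧ Z) (b , z∈Z))
    (inj₂ (inj₂ (x , y , a , b , l))) → line-exchange l λ where
      (inj₁ m) → k (∨-inˡ X (Y ∧ Z) (closed X a a m))
      (inj₂ m) → k (closed (X ∨ (Y ∧ Z)) (∨-inˡ X (Y ∧ Z) a)
                      (∨-inʳ X (Y ∧ Z) (b , closed Z (X⊆Z a) z∈Z m)) l)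

  ⊕-exchange : ∀ X {y z} → z ∈ X ⊕ y → z ∉ X → y ∈ X ⊕ z
  ⊕-exchange X {y} {z} z∈ z∉X = stable (X ⊕ z) λ k → ∨-elim X (pt y) z∈ λ where
    (inj₁ a)        → z∉X a
    (inj₂ (inj₁ b)) → k (∨-inʳ X (pt z) (pt-sym b))
    (inj₂ (inj₂ (x , w , a , b , l))) → line-exchange l λ where
      (inj₁ m) → z∉X (closed X a a m)
      (inj₂ m) → k (pt-⊆ (X ⊕ z) (closed (X ⊕ z) (⊕-inˡ X z a) (⊕-inʳ X z) m) (pt-sym b))

  -- A chain of one-point extensions starting from the empty subspace: one notion that is
  -- cardinality for groups and K-dimension for fields.
  data Dim (X : Sub) : ℕ → Set (lsuc (c ⊔ ℓ ⊔ p)) where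
    empty  : (∀ {x} → x ∉ X) → Dim X zero
    extend : ∀ {d} W y → Dim W d → y ∉ W → X ≐ W ⊕ y → Dim X (suc d)

  dim-≐ : ∀ {X Y d} → X ≐ Y → Dim X d → Dim Y d
  dim-≐ (X⊆Y , Y⊆X) (empty none) = empty (none ∘ Y⊆X)
  dim-≐ (X⊆Y , Y⊆X) (extend W y D y∉W (f , g)) = extend W y D y∉W ((λ m → f (Y⊆X m)) , (λ m → X⊆Y (g m)))

  extend-⊕ : ∀ {X d} y → Dim X d → y ∉ X → Dim (X ⊕ y) (suc d)
  extend-⊕ {X} y D y∉X = extend X y D y∉X (≐-refl (X ⊕ y))

  meet-gain : ∀ X Y W y {x} → Y ≐ W ⊕ y → x ∈ X → x ∈ Y → x ∉ W → X ∧ Y ≐ (X ∧ W) ⊕ x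
  meet-gain X Y W y {x} (Y⊆ , ⊆Y) x∈X x∈Y x∉W =
      (λ {w} (w∈X , w∈Y) → swap (∨-modular (pt x) W X (pt-⊆ X x∈X) (comm-⊕ (Y⊆Wx w∈Y) , w∈X)))
    , ⊕-⊆ (X ∧ W) x (X ∧ Y) (λ (a , b) → a , ⊆Y (⊕-inˡ W y b)) (x∈X , x∈Y)
    where
    Y⊆Wx : Y ⊆ W ⊕ x
    Y⊆Wx w∈Y = ⊕-⊆ W y (W ⊕ x) (⊕-inˡ W x) (⊕-exchange W (Y⊆ x∈Y) x∉W) (Y⊆ w∈Y)
    comm-⊕ : W ⊕ x ⊆ pt x ∨ W
    comm-⊕ = ∨-⊆ W (pt x) (pt x ∨ W) (∨-inʳ (pt x) W) (∨-inˡ (pt x) W)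
    swap : pt x ∨ (W ∧ X) ⊆ (X ∧ W) ⊕ x
    swap = ∨-⊆ (pt x) (W ∧ X) ((X ∧ W) ⊕ x) (∨-inʳ (X ∧ W) (pt x)) (λ (a , b) → ∨-inˡ (X ∧ W) (pt x) (b , a))

  meet-same : ∀ X Y W y → Y ≐ W ⊕ y → y ∉ X ∨ W → X ∧ Y ≐ X ∧ W
  meet-same X Y W y (Y⊆ , ⊆Y) y∉ =
      (λ {w} (w∈X , w∈Y) → w∈X , stable W λ w∉W →
          y∉ (⊕-⊆ W w (X ∨ W) (∨-inʳ X W) (∨-inˡ X W w∈X) (⊕-exchange W (Y⊆ w∈Y) w∉W)))
    , (λ (a , b) → a , ⊆Y (⊕-inˡ W y b))

  -- Each point added to Y raises exactly one of the join and the meet by one. Existence of both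
  -- dimensions is part of the claim, since uniqueness is not yet available.
  dim-∨∧ : ∀ {X Y a b} → Dim X a → Dim Y b →
    ¬ ¬ ∃₂ λ s m → Dim (X ∨ Y) s × Dim (X ∧ Y) m × s + m ≡ a + b
  dim-∨∧ {X} {Y} {a} DX (empty none) k = k
    (a , 0 , dim-≐ (∨-inˡ X Y , ∨-⊆ X Y X id (⊥-elim ∘ none)) DX , empty (none ∘ proj₂) , refl)
  dim-∨∧ {X} {Y} {a} {suc b} DX (extend W y DW y∉W Y≐@(Y⊆ , ⊆Y)) k =
    dim-∨∧ DX DW λ (s , m , Ds , Dm , eq) → decide (y ∈ X ∨ W) λ where
      (yes y∈) →
        let gain : ∀ {x} → x ∈ X → x ∈ Y → x ∉ W → ⊥
            gain x∈X x∈Y x∉W = k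
              ( s , suc m
              , dim-≐ ( ∨-⊆ X W (X ∨ Y) (∨-inˡ X Y) (λ w → ∨-inʳ X Y (⊆Y (⊕-inˡ W y w)))
                      , ∨-⊆ X Y (X ∨ W) (∨-inˡ X W) (λ w → ⊕-⊆ W y (X ∨ W) (∨-inʳ X W) y∈ (Y⊆ w))) Ds
              , extend (X ∧ W) _ Dm (λ m → x∉W (proj₂ m)) (meet-gain X Y W y Y≐ x∈X x∈Y x∉W)
              , trans (+-suc s m) (trans (cong suc eq) (sym (+-suc a b))))
        in ∨-elim X W y∈ λ where
          (inj₁ y∈X)        → gain y∈X (⊆Y (⊕-inʳ W y)) y∉W
          (inj₂ (inj₁ y∈W)) → y∉W y∈W
          (inj₂ (inj₂ (x , v , x∈X , v∈W , l))) → line-exchange (line-sym l) λ where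
            (inj₁ q) → y∉W (closed W v∈W v∈W q)
            (inj₂ q) → gain x∈X (⊆Y (closed (W ⊕ y) (⊕-inˡ W y v∈W) (⊕-inʳ W y) q))
                            (λ x∈W → y∉W (closed W x∈W v∈W l))
      (no y∉) → k
        ( suc s , m
        , extend (X ∨ W) y Ds y∉
            ( ∨-⊆ X Y ((X ∨ W) ⊕ y) (λ x → ⊕-inˡ (X ∨ W) y (∨-inˡ X W x))
                (λ w → ⊕-⊆ W y ((X ∨ W) ⊕ y) (λ v → ⊕-inˡ (X ∨ W) y (∨-inʳ X W v)) (⊕-inʳ (X ∨ W) y) (Y⊆ w))
            , ⊕-⊆ (X ∨ W) y (X ∨ Y) (∨-⊆ X W (X ∨ Y) (∨-inˡ X Y) (λ w → ∨-inʳ X Y (⊆Y (⊕-inˡ W y w))))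
                (∨-inʳ X Y (⊆Y (⊕-inʳ W y))))
        , dim-≐ (≐-sym (X ∧ Y) (X ∧ W) (meet-same X Y W y Y≐ y∉)) Dm
        , trans (cong suc eq) (sym (+-suc a b)))

  private
    -- Cutting Y with the hyperplane X of X ⊕ x loses at most one dimension; this drives the
    -- induction for `dim-mono`. The point of Y outside X is kept because a multiple of it corrects
    -- every later generator into X.
    section : ∀ X x {Y b} → Dim Y b → Y ⊆ X ⊕ x → ¬ ¬ ∃ λ b′ → Dim (X ∧ Y) b′ ×
      ((Y ⊆ X × b ≤ b′) ⊎ ((∃ λ y → y ∈ Y × y ∉ X) × b ≤ suc b′))
    section X x (empty none) Y⊆ k = k (0 , empty (none ∘ proj₂) , inj₁ ((⊥-elim ∘ none) , z≤n))
    section X x {Y} (extend W y DW y∉W Y≐@(Y⊆ , ⊆Y)) Y⊆Xx k =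
      section X x DW (λ w → Y⊆Xx (⊆Y (⊕-inˡ W y w))) λ where
        (b′ , D , inj₁ (W⊆X , le)) → decide (y ∈ X) λ where
          (yes y∈X) →
            let Y⊆X : Y ⊆ X
                Y⊆X w = ⊕-⊆ W y X W⊆X y∈X (Y⊆ w)
            in k (_ , dim-≐ {Y} {X ∧ Y} ((λ w → Y⊆X w , w) , λ m → proj₂ m) (extend W y DW y∉W Y≐) , inj₁ (Y⊆X , ≤-refl))
          (no y∉X) → k
            ( b′ , dim-≐ (≐-sym (X ∧ Y) (X ∧ W) (meet-same X Y W y Y≐ (λ m → y∉X (∨-⊆ X W X id W⊆X m)))) D
            , inj₂ ((y , ⊆Y (⊕-inʳ W y) , y∉X) , s≤s le))
        (b′ , D , inj₂ ((y₀ , y₀∈W , y₀∉X) , le)) →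
          let gain : ∀ {z} → z ∈ X → z ∈ Y → z ∉ W → ⊥
              gain z∈X z∈Y z∉W = k
                ( suc b′ , extend (X ∧ W) _ D (λ m → z∉W (proj₂ m)) (meet-gain X Y W y Y≐ z∈X z∈Y z∉W)
                , inj₂ ((y₀ , ⊆Y (⊕-inˡ W y y₀∈W) , y₀∉X) , s≤s le))
              y∈ : y ∈ X ⊕ y₀
              y∈ = ⊕-⊆ X x (X ⊕ y₀) (⊕-inˡ X y₀)
                     (⊕-exchange X (Y⊆Xx (⊆Y (⊕-inˡ W y y₀∈W))) y₀∉X) (Y⊆Xx (⊆Y (⊕-inʳ W y)))
          in ∨-elim X (pt y₀) y∈ λ where
            (inj₁ y∈X)      → gain y∈X (⊆Y (⊕-inʳ W y)) y∉W
            (inj₂ (inj₁ q)) → y∉W (pt-⊆ W y₀∈W q)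
            (inj₂ (inj₂ (z , w , z∈X , w∈ , l))) → line-exchange (line-sym l) λ where
              (inj₁ q) → y∉W (closed W (pt-⊆ W y₀∈W w∈) (pt-⊆ W y₀∈W w∈) q)
              (inj₂ q) → gain z∈X
                (⊆Y (closed (W ⊕ y) (⊕-inˡ W y (pt-⊆ W y₀∈W w∈)) (⊕-inʳ W y) q))
                (λ z∈W → y∉W (closed W z∈W (pt-⊆ W y₀∈W w∈) l))

  dim-mono : ∀ {X Y a b} → Dim X a → Dim Y b → Y ⊆ X → b ≤ a
  dim-mono DX (empty _) _ = z≤n
  dim-mono (empty none) (extend W y _ _ (_ , ⊆Y)) Y⊆X = ⊥-elim (none (Y⊆X (⊆Y (⊕-inʳ W y))))
  dim-mono {X} {Y} {suc a} (extend W x DW _ (X⊆ , _)) DY Y⊆X = ≤-stable λ k →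
    section W x DY (λ m → X⊆ (Y⊆X m)) λ where
      (b′ , D , inj₁ (_ , le)) → k (m≤n⇒m≤1+n (≤-trans le (dim-mono DW D proj₁)))
      (b′ , D , inj₂ (_ , le)) → k (≤-trans le (s≤s (dim-mono DW D proj₁)))

  dim-unique : ∀ {X a b} → Dim X a → Dim X b → a ≡ b
  dim-unique D D′ = ≤-antisym (dim-mono D′ D id) (dim-mono D D′ id)

  dim-≥⇒⊆ : ∀ {X Y a b} → Dim X a → Dim Y b → X ⊆ Y → b ≤ a → Y ⊆ X
  dim-≥⇒⊆ {X} {Y} DX DY X⊆Y b≤a {y} y∈Y = stable X λ y∉X →
    <⇒≱ (dim-mono DY (extend-⊕ y DX y∉X) (⊕-⊆ X y Y X⊆Y y∈Y)) b≤a

  dim-modular : ∀ {X Y a b s m} → Dim X a → Dim Y b → Dim (X ∨ Y) s → Dim (X ∧ Y) m → s + m ≡ a + b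
  dim-modular DX DY Ds Dm = ≡-stable λ k → dim-∨∧ DX DY λ (s′ , m′ , Ds′ , Dm′ , eq) →
    k (trans (cong₂ _+_ (dim-unique Ds Ds′) (dim-unique Dm Dm′)) eq)

  dim-disjoint : ∀ {X Y Z a b d} → Dim X a → Dim Y b → Dim Z d → X ⊆ Z → Y ⊆ Z →
    (∀ {x} → x ∈ X → x ∉ Y) → a + b ≤ d
  dim-disjoint {X} {Y} {Z} DX DY DZ X⊆Z Y⊆Z disj = ≤-stable λ k → dim-∨∧ DX DY λ (s , m , Ds , Dm , eq) →
    k (subst (_≤ _) (trans (sym (+-identityʳ s)) (trans (cong (s +_) (dim-unique (empty (λ (x , y) → disj x y)) Dm)) eq))
         (dim-mono DZ Ds (∨-⊆ X Y Z X⊆Z Y⊆Z)))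

  dim-pos : ∀ {X a x} → Dim X a → x ∈ X → 1 ≤ a
  dim-pos (empty none) x∈X = ⊥-elim (none x∈X)
  dim-pos (extend _ _ _ _ _) _ = s≤s z≤n

  dim-inhabited : ∀ {X a} → Dim X a → 1 ≤ a → ∃ λ x → x ∈ X
  dim-inhabited (extend W y _ _ (_ , ⊆X)) _ = y , ⊆X (⊕-inʳ W y)

-- Products and duality

module Products {c ℓ p : Level} (geometry : Geometry c ℓ p) where
  open Geometry geometry
  open Subspaces geometry

  cancelˡ : ∀ w z → w ⁻¹ ∙ (w ∙ z) ≈ z
  cancelˡ w z = ≈-trans (≈-sym (assoc _ _ _)) (≈-trans (∙-congʳ (inverseˡ w)) (identityˡ z))

  cancelʳ : ∀ w z → w ∙ (w ⁻¹ ∙ z) ≈ z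
  cancelʳ w z = ≈-trans (≈-sym (assoc _ _ _)) (≈-trans (∙-congʳ (inverseʳ w)) (identityˡ z))

  infixr 8 _◂_ _▸_
  infixl 8 _·_ _⊘_

  -- w ▸ X is w⁻¹X and w ◂ X is wX. As preimages they are closed by `line-∙` alone.
  _▸_ : Pt → Sub → Sub
  w ▸ X = record
    { mem    = λ z → w ∙ z ∈ X
    ; stable = stable X
    ; closed = λ a b l → closed X a b (line-∙ w l)
    }

  _◂_ : Pt → Sub → Sub
  w ◂ X = (w ⁻¹) ▸ X

  -- The residual of multiplication. Orthogonals and stabilizers are instances, and inclusions into
  -- a residual carry a property of products from generators to their span.
  _⊘_ : Sub → Sub → Sub
  W ⊘ Z = record
    { mem    = λ t → ∀ z → z ∈ Z → z ∙ t ∈ W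
    ; stable = λ h z z∈Z → stable W λ k → h λ h′ → k (h′ z z∈Z)
    ; closed = λ a b l z z∈Z → closed W (a z z∈Z) (b z z∈Z) (line-∙ z l)
    }

  _·_ : Sub → Sub → Sub
  X · Y = ⟪ (λ z → ∃₂ λ x y → x ∈ X × y ∈ Y × z ≈ x ∙ y) ⟫

  ∈-◂ : ∀ w X {x} → x ∈ X → w ∙ x ∈ w ◂ X
  ∈-◂ w X x∈X = ∈-resp X (≈-sym (cancelˡ w _)) x∈X

  ▸-dim : ∀ w {X a} → Dim X a → Dim (w ▸ X) a
  ▸-dim w (empty none) = empty (λ m → none m)
  ▸-dim w {X} (extend W y DW y∉W (X⊆ , ⊆X)) = extend (w ▸ W) (w ⁻¹ ∙ y) (▸-dim w DW)
      (λ m → y∉W (∈-resp W (cancelʳ w y) m))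
      ( (λ {z} z∈ → ∈-resp J (cancelˡ w z) (W⊕y⊆ (X⊆ z∈)))
      , ⊕-⊆ (w ▸ W) (w ⁻¹ ∙ y) (w ▸ X) (λ m → ⊆X (⊕-inˡ W y m))
          (∈-resp X (≈-sym (cancelʳ w y)) (⊆X (⊕-inʳ W y))))
    where
    J : Sub
    J = (w ▸ W) ⊕ (w ⁻¹ ∙ y)
    W⊕y⊆ : W ⊕ y ⊆ w ◂ J
    W⊕y⊆ = ⊕-⊆ W y (w ◂ J)
      (λ u∈W → ⊕-inˡ (w ▸ W) (w ⁻¹ ∙ y) (∈-resp W (≈-sym (cancelʳ w _)) u∈W))
      (⊕-inʳ (w ▸ W) (w ⁻¹ ∙ y))

  ◂-dim : ∀ w {X a} → Dim X a → Dim (w ◂ X) a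
  ◂-dim w = ▸-dim (w ⁻¹)

  ·-in : ∀ X Y {x y} → x ∈ X → y ∈ Y → x ∙ y ∈ X · Y
  ·-in X Y x∈X y∈Y k = k (base (_ , _ , x∈X , y∈Y , ≈-refl))

  ·-⊆ : ∀ X Y W → (∀ {x y} → x ∈ X → y ∈ Y → x ∙ y ∈ W) → X · Y ⊆ W
  ·-⊆ X Y W h = ⟪⟫-⊆ W λ (x , y , x∈X , y∈Y , e) → ∈-resp W (≈-sym e) (h x∈X y∈Y)

  ·-mono : ∀ X Y X′ Y′ → X ⊆ X′ → Y ⊆ Y′ → X · Y ⊆ X′ · Y′
  ·-mono X Y X′ Y′ f g = ·-⊆ X Y (X′ · Y′) λ a b → ·-in X′ Y′ (f a) (g b)

  ·-comm : ∀ X Y → X · Y ⊆ Y · X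
  ·-comm X Y = ·-⊆ X Y (Y · X) λ a b → ∈-resp (Y · X) (comm _ _) (·-in Y X b a)

  ·-⊆₃ : ∀ X Y Z W → (∀ {x y z} → x ∈ X → y ∈ Y → z ∈ Z → (x ∙ y) ∙ z ∈ W) → (X · Y) · Z ⊆ W
  ·-⊆₃ X Y Z W h = ·-⊆ (X · Y) Z W λ t∈ z∈ → ∈-resp W (comm _ _) (⊘-in t∈ _ z∈)
    where
    ⊘-in : X · Y ⊆ W ⊘ Z
    ⊘-in = ·-⊆ X Y (W ⊘ Z) λ x∈ y∈ z z∈ → ∈-resp W (comm _ _) (h x∈ y∈ z∈)

  ▸-· : ∀ w X Y → w ▸ (X · Y) ≐ (w ▸ X) · Y
  ▸-· w X Y =
      (λ {z} m → ∈-resp ((w ▸ X) · Y) (cancelˡ w z) (inside m))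
    , ·-⊆ (w ▸ X) Y (w ▸ (X · Y)) (λ a b → ∈-resp (X · Y) (assoc _ _ _) (·-in X Y a b))
    where
    inside : X · Y ⊆ w ◂ ((w ▸ X) · Y)
    inside = ·-⊆ X Y (w ◂ ((w ▸ X) · Y)) λ {x} {y} a b →
      ∈-resp ((w ▸ X) · Y) (assoc _ _ _) (·-in (w ▸ X) Y (∈-resp X (≈-sym (cancelʳ w x)) a) b)

  StableUnder : Sub → Sub → Set _
  StableUnder H X = ∀ {x h} → x ∈ X → h ∈ H → x ∙ h ∈ X

  ∧-stable : ∀ H X Y → StableUnder H X → StableUnder H Y → StableUnder H (X ∧ Y)
  ∧-stable H X Y f g (a , b) h = f a h , g b h

  ∨-stable : ∀ H X Y → StableUnder H X → StableUnder H Y → StableUnder H (X ∨ Y)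
  ∨-stable H X Y f g {x} {h} m h∈H = ∈-resp (X ∨ Y) (comm h x) (inside m h h∈H)
    where
    inside : X ∨ Y ⊆ (X ∨ Y) ⊘ H
    inside = ∨-⊆ X Y ((X ∨ Y) ⊘ H)
      (λ a z z∈ → ∨-inˡ X Y (∈-resp X (comm _ _) (f a z∈)))
      (λ b z z∈ → ∨-inʳ X Y (∈-resp Y (comm _ _) (g b z∈)))

  ▸-stable : ∀ H w X → StableUnder H X → StableUnder H (w ▸ X)
  ▸-stable H w X f a h∈ = ∈-resp X (assoc _ _ _) (f a h∈)

  ·-stable : ∀ H X Y → StableUnder H X → StableUnder H (X · Y)
  ·-stable H X Y f {x} {h} m h∈H = ∈-resp (X · Y) (comm h x) (inside m h h∈H)
    where
    inside : X · Y ⊆ (X · Y) ⊘ H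
    inside = ·-⊆ X Y ((X · Y) ⊘ H) λ a b h h∈ →
      ∈-resp (X · Y) (≈-trans (∙-congʳ (comm _ _)) (assoc _ _ _))
        (·-in X Y (f a h∈) b)

  ¬stable : ∀ H X → ¬ StableUnder H X → ¬ ¬ ∃₂ λ x h → x ∈ X × h ∈ H × x ∙ h ∉ X
  ¬stable H X ns k = ns λ {x} {h} x∈ h∈ → stable X λ xh∉ → k (x , h , x∈ , h∈ , xh∉)

-- For a field extension the hyperplane is the kernel of a nonzero functional, for a group the
-- complement of a point; `spanning` says that its codimension is one.
record Frame {c ℓ p : Level} (geometry : Geometry c ℓ p) (n : ℕ) : Set (lsuc (c ⊔ ℓ ⊔ p)) where
  open Geometry geometry
  open Subspaces geometry
  field
    dim-⊤      : Dim ⊤ₛ n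
    hyperplane : Sub
    proper     : ∃ λ x → x ∉ hyperplane
    spanning   : ∀ y {z} → z ∉ hyperplane → y ∈ hyperplane ⊕ z

module Duality {c ℓ p : Level} {geometry : Geometry c ℓ p} {n : ℕ} (frame : Frame geometry n) where
  open Geometry geometry
  open Subspaces geometry
  open Products geometry
  open Frame frame renaming (hyperplane to O)

  dim : ∀ X → ¬ ¬ ∃ λ d → Dim X d
  dim X k = dim-∨∧ dim-⊤ dim-⊤ λ _ → go dim-⊤ λ (d , D) → k (d , dim-≐ (proj₁ , (λ m → m , tt)) D)
    where
    go : ∀ {Y b} → Dim Y b → ¬ ¬ ∃ λ d → Dim (X ∧ Y) d
    go (empty none) k = k (0 , empty (λ m → none (proj₂ m)))
    go {Y} (extend W y D y∉W (Y⊆ , ⊆Y)) k = go D λ (d , Dd) → decide (∃ λ x → x ∈ X × x ∈ Y × x ∉ W) λ where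
      (yes (x , x∈X , x∈Y , x∉W)) → k (suc d , extend (X ∧ W) x Dd (λ m → x∉W (proj₂ m)) (meet-gain X Y W y (Y⊆ , ⊆Y) x∈X x∈Y x∉W))
      (no none) → k (d , dim-≐ ((λ (a , b) → a , ⊆Y (⊕-inˡ W y b)) , (λ (a , b) → a , stable W λ b∉ → none (_ , a , b , b∉))) Dd)

  dim-≤n : ∀ {X a} → Dim X a → a ≤ n
  dim-≤n {X} D = dim-mono dim-⊤ D (λ _ → tt)

  -- The orthogonal space for the form (x, z) ↦ λ(xz), where λ is a linear functional with kernel O.
  perp : Sub → Sub
  perp X = O ⊘ X

  perp-⊤ : ∀ {z} → z ∉ perp ⊤ₛ
  perp-⊤ {z} h = let (o , o∉) = proper in
    o∉ (∈-resp O (≈-trans (comm _ _) (cancelʳ z o)) (h (z ⁻¹ ∙ o) tt))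

  private
    -- One further condition λ(yz) = 0 cuts the orthogonal by at most one dimension.
    perp-drop : ∀ W y {b b′} → Dim (perp (W ⊕ y)) b → Dim (perp W) b′ → b′ ≤ suc b
    perp-drop W y {b} {b′} D D′ = ≤-stable λ k → decide (∃ λ z → z ∈ perp W × z ∉ perp (W ⊕ y)) λ where
        (no none) → k (m≤n⇒m≤1+n (dim-mono D D′ λ m → stable V λ m∉ → none (_ , m , m∉)))
        (yes (z₂ , z₂∈ , z₂∉)) →
          k (dim-mono (extend-⊕ z₂ D z₂∉) D′ (λ {z₁} z₁∈ → incl z₂∈ z₂∉ z₁∈))
      where
      V : Sub
      V = perp (W ⊕ y)
      V-in : ∀ {z} → z ∈ perp W → y ∙ z ∈ O → z ∈ V
      V-in {z} z∈ yz∈ u u∈ = ∈-resp O (comm z u) (inside u∈)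
        where
        inside : W ⊕ y ⊆ z ▸ O
        inside = ⊕-⊆ W y (z ▸ O) (λ w∈ → ∈-resp O (comm _ z) (z∈ _ w∈)) (∈-resp O (comm y z) yz∈)
      incl : ∀ {z₁ z₂} → z₂ ∈ perp W → z₂ ∉ V → z₁ ∈ perp W → z₁ ∈ V ⊕ z₂
      incl {z₁} {z₂} z₂∈ z₂∉ z₁∈ = stable (V ⊕ z₂) λ k →
        let finish : y ∙ z₁ ∈ y ◂ (V ⊕ z₂) → ⊥
            finish m = k (∈-resp (V ⊕ z₂) (cancelˡ y z₁) m)
            span-in : pt (y ∙ z₂) ⊆ y ◂ (V ⊕ z₂)
            span-in = pt-⊆ (y ◂ (V ⊕ z₂)) (∈-◂ y (V ⊕ z₂) (⊕-inʳ V z₂))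
        -- z₂ ∉ V means y ∙ z₂ ∉ O, so y ∙ z₁ is brought into O by subtracting a multiple of y ∙ z₂;
        -- the difference divided by y lies in V.
        in ∨-elim O (pt (y ∙ z₂)) (spanning (y ∙ z₁) (λ m → z₂∉ (V-in z₂∈ m))) λ where
          (inj₁ m)        → k (⊕-inˡ V z₂ (V-in z₁∈ m))
          (inj₂ (inj₁ m)) → finish (span-in m)
          (inj₂ (inj₂ (o , w , o∈ , w∈ , l))) → line-exchange (line-sym l) λ where
            (inj₁ q) → finish (closed (y ◂ (V ⊕ z₂)) (span-in w∈) (span-in w∈) q)
            (inj₂ q) → finish (closed (y ◂ (V ⊕ z₂))
              (⊕-inˡ V z₂ (V-in (closed (y ◂ perp W)
                  (pt-⊆ (y ◂ perp W) (∈-◂ y (perp W) z₂∈) w∈) (∈-◂ y (perp W) z₁∈) q)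
                (∈-resp O (≈-sym (cancelʳ y o)) o∈)))
              (span-in w∈) l)

    -- From X up to `⊤ₛ` there are n - a points to add. Each lowers the orthogonal by at most one,
    -- and it ends empty. The fuel t bounds the codimension.
    perp-≤ : ∀ t {X a b} → n ≤ t + a → Dim X a → Dim (perp X) b → a + b ≤ n
    perp-≤ t {X} {a} {b} le D D′ = ≤-stable λ k → decide (∃ λ x → x ∉ X) λ where
        (no none) → k (subst (_≤ n) (trans (sym (+-identityʳ a)) (cong (a +_)
                      (dim-unique (empty (λ z∈ → perp-⊤ (λ x _ → z∈ x (stable X λ x∉ → none (x , x∉))))) D′)))
                      (dim-≤n D))
        (yes (y , y∉)) → go t le y∉ k
      where
      go : ∀ t → n ≤ t + a → ∀ {y} → y ∉ X → ¬ ¬ (a + b ≤ n)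
      go zero le {y} y∉ _ = <⇒≱ (dim-≤n (extend-⊕ y D y∉)) le
      go (suc t) le {y} y∉ k = dim (perp (X ⊕ y)) λ (b′ , Db′) → k
        (≤-trans (+-monoʳ-≤ a (perp-drop X y Db′ D′))
          (subst (_≤ n) (sym (+-suc a b′)) (perp-≤ t (subst (n ≤_) (sym (+-suc t a)) le) (extend-⊕ y D y∉) Db′)))

    -- The same drop, counted from the empty subspace, whose orthogonal is everything.
    perp-≥ : ∀ {X a b} → Dim X a → Dim (perp X) b → n ≤ a + b
    perp-≥ (empty none) D′ = dim-mono D′ dim-⊤ λ _ x x∈ → ⊥-elim (none x∈)
    perp-≥ {b = b} (extend {d} W y DW y∉W (X⊆ , ⊆X)) D′ = ≤-stable λ k → dim (perp W) λ (b′ , Db′) →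
      k (≤-trans (perp-≥ DW Db′) (subst (d + b′ ≤_) (+-suc d b)
        (+-monoʳ-≤ d (perp-drop W y (dim-≐ ((λ z∈ u u∈ → z∈ u (⊆X u∈)) , (λ z∈ u u∈ → z∈ u (X⊆ u∈))) D′) Db′))))

  perp-dim : ∀ {X a b} → Dim X a → Dim (perp X) b → a + b ≡ n
  perp-dim D D′ = ≤-antisym (perp-≤ n (m≤m+n n _) D D′) (perp-≥ D D′)

  perp-perp : ∀ X → perp (perp X) ⊆ X
  perp-perp X z∈ = stable X λ k → dim X λ (a , Da) → dim (perp X) λ (b , Db) → dim (perp (perp X)) λ (d , Dd) →
    k (dim-≥⇒⊆ Da Dd (λ x∈ u u∈ → ∈-resp O (comm _ _) (u∈ _ x∈))
        (≤-reflexive (+-cancelˡ-≡ b d a (trans (perp-dim Db Dd) (trans (sym (perp-dim Da Db)) (+-comm a b))))) z∈)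

-- The boundary |XS| − |X| and Kneser's theorem

-- Linear arithmetic by certificate: the hypotheses are added to one inequality a ≤ b, and k is the
-- part to cancel from both sides, checked by the ring solver.
linear : ∀ k {a b c d} → a ≤ b → a ≡ k + c → b ≡ k + d → c ≤ d
linear k h refl refl = +-cancelˡ-≤ k _ _ h

≤≡ : ∀ {a b : ℕ} → a ≡ b → a ≤ b
≤≡ = ≤-reflexive

≥≡ : ∀ {a b : ℕ} → a ≡ b → b ≤ a
≥≡ = ≤-reflexive ∘ sym

infixl 5 _⊞_
_⊞_ : ∀ {a b c d} → a ≤ b → c ≤ d → a + c ≤ b + d
_⊞_ = +-mono-≤

least : ∀ {a} (P : ℕ → Set a) → ∀ n → P n → ¬ ¬ ∃ λ m → P m × ∀ k → P k → m ≤ k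
least P n = go n n ≤-refl
  where
  go : ∀ t n → n ≤ t → P n → ¬ ¬ ∃ λ m → P m × ∀ k → P k → m ≤ k
  go t n n≤t Pn k = decide (∃ λ m → m < n × P m) λ where
      (no none)            → k (n , Pn , λ j Pj → ≮⇒≥ λ j<n → none (j , j<n , Pj))
      (yes (m , m<n , Pm)) → smaller t n≤t m<n Pm k
    where
    smaller : ∀ t → n ≤ t → ∀ {m} → m < n → P m → ¬ ¬ ∃ λ m → P m × ∀ k → P k → m ≤ k
    smaller zero    n≤0 m<n Pm = ⊥-elim (n≮0 (≤-trans m<n n≤0))
    smaller (suc t) n≤t m<n Pm = go t _ (≤-pred (≤-trans m<n n≤t)) Pm

module Isoperimetry {c ℓ p : Level} {geometry : Geometry c ℓ p} {n : ℕ} (frame : Frame geometry n) where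
  open Geometry geometry
  open Subspaces geometry
  open Products geometry
  open Frame frame renaming (hyperplane to O)
  open Duality frame

  -- A subgroup, or the nonzero elements of an intermediate field. Inverses are automatic: xM ⊆ M
  -- has the dimension of M.
  record Subfield (M : Sub) : Set (c ⊔ ℓ ⊔ p) where
    field
      unit : ε ∈ M
      mult : ∀ {x y} → x ∈ M → y ∈ M → x ∙ y ∈ M

    inv : ∀ {x} → x ∈ M → x ⁻¹ ∈ M
    inv {x} x∈M = stable M λ k → dim M λ (m , DM) →
      k (∈-resp M (≈-trans (comm _ _) (identityˡ _))
          (dim-≥⇒⊆ (◂-dim x DM) DM (λ z∈ → ∈-resp M (cancelʳ x _) (mult x∈M z∈)) ≤-refl unit))

    coset-⊆ : ∀ {y z} X → StableUnder M X → z ∈ X → z ∈ y ◂ M → y ◂ M ⊆ X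
    coset-⊆ {y} {z} X XM z∈X z∈yM {w} w∈yM = ∈-resp X z∙≈w (XM z∈X (mult (inv z∈yM) w∈yM))
      where
      z∙≈w : z ∙ ((y ⁻¹ ∙ z) ⁻¹ ∙ (y ⁻¹ ∙ w)) ≈ w
      z∙≈w = ≈-trans (∙-congʳ (≈-sym (cancelʳ y z))) (≈-trans (assoc _ _ _)
               (≈-trans (∙-congˡ (cancelʳ (y ⁻¹ ∙ z) _)) (cancelʳ y w)))

  open Subfield

  self-coset : ∀ y {M} → ε ∈ M → y ∈ y ◂ M
  self-coset y {M} ε∈M = ∈-resp M (≈-sym (inverseˡ y)) ε∈M

  module Boundary (S : Sub) where

    -- The dual of X with respect to S. Since x ∙ s ∙ z is symmetric in x and z (`rotate`), `star`
    -- forms a Galois connection with itself, and the saturated subspaces are its closed elements.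
    star : Sub → Sub
    star X = perp (X · S)

    -- cl X = {x | xS ⊆ XS}
    cl : Sub → Sub
    cl X = star (star X)

    star-in : ∀ X {z} → (∀ {x s} → x ∈ X → s ∈ S → (x ∙ s) ∙ z ∈ O) → z ∈ star X
    star-in X {z} h u u∈ = ∈-resp O (comm z u)
      (·-⊆ X S (z ▸ O) (λ x∈ s∈ → ∈-resp O (comm _ _) (h x∈ s∈)) u∈)

    star-out : ∀ X {x s z} → z ∈ star X → x ∈ X → s ∈ S → (x ∙ s) ∙ z ∈ O
    star-out X z∈ x∈ s∈ = z∈ _ (·-in X S x∈ s∈)

    rotate : ∀ x s z → (x ∙ s) ∙ z ≈ (z ∙ s) ∙ x
    rotate x s z = ≈-trans (comm _ _) (≈-trans (∙-congˡ (comm x s)) (≈-sym (assoc z s x)))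

    cl-inc : ∀ X → X ⊆ cl X
    cl-inc X x∈ = star-in (star X) λ z∈ s∈ → ∈-resp O (rotate _ _ _) (star-out X z∈ x∈ s∈)

    star-anti : ∀ X Y → X ⊆ Y → star Y ⊆ star X
    star-anti X Y X⊆Y z∈ = star-in X λ x∈ s∈ → star-out Y z∈ (X⊆Y x∈) s∈

    star-stable : ∀ H X → StableUnder H X → StableUnder H (star X)
    star-stable H X XH {z} {h} z∈ h∈ = star-in X λ {x} {s} x∈ s∈ →
      ∈-resp O (≈-trans (rotate _ _ _) (≈-trans (≈-sym (assoc _ _ _)) (≈-trans
          (∙-congʳ (rotate _ _ _)) (assoc _ _ _))))
        (star-out X z∈ (XH x∈ h∈) s∈)

    Sat : Sub → Set _
    Sat X = cl X ⊆ X

    star-sat : ∀ X → Sat (star X)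
    star-sat X = star-anti X (cl X) (cl-inc X)

    ∧-sat : ∀ X Y → Sat X → Sat Y → Sat (X ∧ Y)
    ∧-sat X Y sX sY z∈ =
        sX (star-anti (star X) (star (X ∧ Y)) (star-anti (X ∧ Y) X proj₁) z∈)
      , sY (star-anti (star Y) (star (X ∧ Y)) (star-anti (X ∧ Y) Y proj₂) z∈)

    shift : ∀ w x t u → ((w ∙ x) ∙ t) ∙ u ≈ (x ∙ t) ∙ (w ∙ u)
    shift w x t u = ≈-trans (∙-congʳ (≈-trans (∙-congʳ (comm w x)) (≈-trans (assoc x w t)
      (≈-trans (∙-congˡ (comm w t)) (≈-sym (assoc x t w)))))) (assoc (x ∙ t) w u)

    ▸-sat : ∀ w X → Sat X → Sat (w ▸ X)
    ▸-sat w X sX z∈ = sX (star-in (star X) λ u∈ s∈ → ∈-resp O (shift w _ _ _)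
      (star-out (star (w ▸ X)) z∈
        (star-in (w ▸ X) λ x∈ t∈ → ∈-resp O (shift w _ _ _) (star-out X u∈ x∈ t∈)) s∈))

    unsat-star : ∀ H X → Sat X → ¬ StableUnder H X → ¬ StableUnder H (star X)
    unsat-star H X sX ns XH = ns λ x∈ h∈ → sX (star-stable H (star X) XH (cl-inc X x∈) h∈)

    star-dim : ∀ {X b e} → Dim (X · S) b → Dim (star X) e → b + e ≡ n
    star-dim = perp-dim

    -- The orthogonal of `star X · S` is `cl X`, that is X. Together with `star-dim` this gives
    -- `star X` the boundary (n - |X|) - (n - |XS|), which is that of X.
    star-·-dim : ∀ {X a b} → Sat X → Dim X a → Dim (star X · S) b → b + a ≡ n
    star-·-dim {X} sX DX D = perp-dim D (dim-≐ ((λ m → cl-inc X m) , (λ m → sX m)) DX)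

    cl-·-dim : ∀ {X a b} → Dim (X · S) a → Dim (cl X · S) b → b ≡ a
    cl-·-dim {X} {a} {b} D D′ = ≡-stable λ k → dim (star X) λ (e , De) →
      k (+-cancelʳ-≡ e b a (trans (star-dim {cl X} D′ (dim-≐ ((λ m → cl-inc (star X) m) , (λ m → star-sat X m)) De))
                                 (sym (star-dim {X} D De))))

    -- The boundary |XS| − |X| is at most r.
    Small : ℕ → Sub → Set _
    Small r X = ∀ {a b} → Dim X a → Dim (X · S) b → b ≤ r + a

    small-intro : ∀ {r X a b} → Dim X a → Dim (X · S) b → b ≤ r + a → Small r X
    small-intro {r} D E le D′ E′ = subst₂ _≤_ (dim-unique E E′) (cong (r +_) (dim-unique D D′)) le

    ¬small : ∀ {r X a b} → Dim X a → Dim (X · S) b → ¬ Small r X → r + a < b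
    ¬small D E ns = ≰⇒> λ le → ns (small-intro D E le)

    ▸-small : ∀ w {r X} → Small r X → Small r (w ▸ X)
    ▸-small w {r} {X} sX {a} D E = ≤-stable λ k → dim X λ (x , DX) → dim (X · S) λ (xs , DXS) →
      k (subst₂ _≤_ (dim-unique (dim-≐ (▸-· w X S) (▸-dim w DXS)) E)
                    (cong (r +_) (dim-unique (▸-dim w DX) D)) (sX DX DXS))

    star-small : ∀ {r X} → Sat X → Small r X → Small r (star X)
    star-small {r} {X} sX small {e} {b} De Db = ≤-stable λ k → dim X λ (a , Da) → dim (X · S) λ (xs , Dxs) →
      k (arith r e b a xs (≥≡ (star-dim {X} Dxs De)) (≤≡ (star-·-dim sX Da Db)) (small Da Dxs))
      where
      arith : ∀ r e b a xs → n ≤ xs + e → b + a ≤ n → xs ≤ r + a → b ≤ r + e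
      arith r e b a xs h₁ h₂ h₃ = linear (n + a + xs) (h₁ ⊞ h₂ ⊞ h₃) (solve (n ∷ r ∷ e ∷ b ∷ a ∷ xs ∷ [])) (solve (n ∷ r ∷ e ∷ b ∷ a ∷ xs ∷ []))

    -- The product of the meet lies in the meet of the products, and the product of the join lies in
    -- their join.
    submodular : ∀ {X Y a b i j} → Dim (X · S) a → Dim (Y · S) b →
      Dim ((X ∧ Y) · S) i → Dim ((X ∨ Y) · S) j → j + i ≤ a + b
    submodular {X} {Y} DX DY DI DJ = ≤-stable λ k → dim-∨∧ DX DY λ (s , m , Ds , Dm , eq) →
      k (≤-trans (dim-mono Ds DJ J⊆ ⊞ dim-mono Dm DI I⊆) (≤≡ eq))
      where
      I⊆ : (X ∧ Y) · S ⊆ (X · S) ∧ (Y · S)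
      I⊆ = ·-⊆ (X ∧ Y) S ((X · S) ∧ (Y · S)) λ (x , y) s → ·-in X S x s , ·-in Y S y s
      J⊆ : (X ∨ Y) · S ⊆ (X · S) ∨ (Y · S)
      J⊆ m = ·-⊆ (X ∨ Y) S ((X · S) ∨ (Y · S)) (λ {z} {s} z∈ s∈ → ∈-resp ((X · S) ∨ (Y · S)) (comm s z)
        (∨-⊆ X Y (s ▸ ((X · S) ∨ (Y · S)))
          (λ x∈ → ∨-inˡ (X · S) (Y · S) (∈-resp (X · S) (comm _ _) (·-in X S x∈ s∈)))
          (λ y∈ → ∨-inʳ (X · S) (Y · S) (∈-resp (Y · S) (comm _ _) (·-in Y S y∈ s∈))) z∈)) m

    -- X has boundary at most r and X ∧ Y more than r, so submodularity leaves X ∨ Y a smaller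
    -- boundary than Y has.
    uncross : ∀ {r X Y a as b bs} → Dim X a → Dim (X · S) as → Dim Y b → Dim (Y · S) bs →
      Small r X → ¬ Small r (X ∧ Y) → ¬ ¬ ∃₂ λ i j → ∃ λ js →
        Dim (X ∧ Y) i × Dim (X ∨ Y) j × Dim ((X ∨ Y) · S) js ×
        j + i ≡ a + b × js + suc (r + i) ≤ as + bs × js + b < j + bs
    uncross {r} {X} {Y} {a} {as} {b} {bs} DX DXS DY DYS small ns k =
      dim (X ∧ Y) λ (i , Di) → dim (X ∨ Y) λ (j , Dj) →
      dim ((X ∧ Y) · S) λ (is , Dis) → dim ((X ∨ Y) · S) λ (js , Djs) →
      let mod = dim-modular DX DY Dj Di
          gap = ≤-trans (+-monoʳ-≤ js (¬small Di Dis ns)) (submodular {X} {Y} DXS DYS Dis Djs)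
      in k (i , j , js , Di , Dj , Djs , mod , gap , arith i j js (small DX DXS) (≥≡ mod) gap)
      where
      arith : ∀ i j js → as ≤ r + a → a + b ≤ j + i → js + suc (r + i) ≤ as + bs → js + b < j + bs
      arith i j js h₁ h₂ h₃ = linear (r + i + a + as) (h₁ ⊞ h₂ ⊞ h₃)
        (solve (i ∷ j ∷ js ∷ a ∷ b ∷ as ∷ bs ∷ r ∷ [])) (solve (i ∷ j ∷ js ∷ a ∷ b ∷ as ∷ bs ∷ r ∷ []))

    -- Without subtraction, the inequality reads |VS| - |V| < |QS| - |Q|.
    BelowStable : Sub → Sub → Set _
    BelowStable Q N = ∀ {q qs} → Dim Q q → Dim (Q · S) qs → ∀ V → Sat V →
      (∀ {a b} → Dim V a → Dim (V · S) b → b + q < a + qs) → StableUnder N V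

    cl-below : ∀ {J j js q qs} → Dim J j → Dim (J · S) js → js + q < j + qs →
      ∀ {a b} → Dim (cl J) a → Dim (cl J · S) b → b + q < a + qs
    cl-below {J} {q = q} {qs} Dj Djs lt Da Db =
      ≤-trans (subst (λ t → suc (t + q) ≤ _) (sym (cl-·-dim {J} Djs Db)) lt)
              (+-monoˡ-≤ qs (dim-mono Da Dj (cl-inc J)))

    -- The join J of `star Y` and zQ has smaller boundary than Q, so `star J` is stable under N. It
    -- lies in Y, and any point of it would bring all of yN into Y. Hence `star J` is empty, JS is
    -- the whole space, and submodularity becomes the stated bound.
    uncross-star : ∀ {r Y z Q N k i q qs y} → Sat Y → Small r Y → Dim Y k → Dim Q q → Dim (Q · S) qs →
      Dim (star Y ∧ z ◂ Q) i → ¬ Small r (star Y ∧ z ◂ Q) → Subfield N → BelowStable Q N →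
      Y ⊆ y ◂ N → ¬ (y ◂ N ⊆ Y) → k + suc (r + i) ≤ qs
    uncross-star {r} {Y} {z} {Q} {N} {k} {i} {q} {qs} {y} sY small Dk Dq Dqs Di ns fN below Y⊆yN yN⊈Y =
      ≤-stable λ c → dim (star Y) λ (e , De) → dim (star Y · S) λ (es , Des) →
      uncross De Des (◂-dim z Dq) (dim-≐ (▸-· (z ⁻¹) Q S) (◂-dim z Dqs)) (star-small sY small) ns
      λ (i′ , j , js , Di′ , Dj , Djs , mod , gap , lt) →
      let J = star Y ∨ z ◂ Q
          starJ-stable : StableUnder N (star J)
          starJ-stable x∈ h∈ = star-sat J (star-stable N (cl J)
            (below Dq Dqs (cl J) (star-sat (star J)) (cl-below {J} Dj Djs lt)) (cl-inc (star J) x∈) h∈)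
          starJ⊆Y : star J ⊆ Y
          starJ⊆Y m = sY (star-anti (star Y) J (∨-inˡ (star Y) (z ◂ Q)) m)
          none : ∀ {w} → w ∉ star J
          none w∈ = yN⊈Y λ v∈ → starJ⊆Y (coset-⊆ fN (star J) starJ-stable w∈ (Y⊆yN (starJ⊆Y w∈)) v∈)
          js≡n = trans (sym (+-identityʳ js)) (star-dim {J} Djs (empty none))
      in c (arith e es js (≥≡ js≡n) (≤≡ (star-·-dim sY Dk Des)) (subst (λ t → js + suc (r + t) ≤ es + qs) (dim-unique Di′ Di) gap))
      where
      arith : ∀ e es js → n ≤ js → es + k ≤ n → js + suc (r + i) ≤ es + qs → k + suc (r + i) ≤ qs
      arith e es js h₁ h₂ h₃ = linear (n + js + es) (h₁ ⊞ h₂ ⊞ h₃)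
        (solve (n ∷ js ∷ es ∷ k ∷ r ∷ i ∷ qs ∷ [])) (solve (n ∷ js ∷ es ∷ k ∷ r ∷ i ∷ qs ∷ []))

    ◂-·-dim : ∀ w {X a} → Dim (X · S) a → Dim ((w ◂ X) · S) a
    ◂-·-dim w {X} D = dim-≐ (▸-· (w ⁻¹) X S) (◂-dim w D)

    Unstable : Sub → Sub → Set _
    Unstable P Y = ∃₂ λ y q → y ∈ Y × q ∈ P × y ∙ q ∉ Y

    Class : Sub → ℕ → Sub → Set _
    Class P r Y = Sat Y × Small r Y × Unstable P Y

    Minimal : Sub → ℕ → ℕ → Set _
    Minimal P r k = ∀ {Z j} → Class P r Z → Dim Z j → k ≤ j

    -- A smallest saturated set of boundary at most r that is not stable under P lies in a coset of M.
    Localized : Sub → Set _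
    Localized M = ∀ P {r Y k y q} → P ⊆ M → Small r M → Sat Y → Small r Y →
      y ∈ Y → q ∈ P → y ∙ q ∉ Y → Dim Y k → Minimal P r k → Y ⊆ y ◂ M

    -- If Y ⊆ yN is smallest but Y ⊈ yM, then Y ∩ yM has boundary more than r, so by submodularity Y ∪ yM has
    -- smaller boundary than M and saturates to yN.  The same argument for the dual of Y makes both Y and
    -- yNS ∖ YS too small to fill NS, which properly contains MS.
    localized-step : ∀ {M N x} → Subfield M → Sat M → Subfield N → Localized N → M ⊆ N → x ∈ N → x ∉ M →
      (∀ {r} → Small r M → Small r N) → BelowStable M N → Localized M
    localized-step {M} {N} {x} fM sM fN locN M⊆N x∈N x∉M smallN below
                   P {r} {Y} {k} {y} {q} P⊆M smM sY smY y∈ q∈ yq∉ DY min {w} w∈Y =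
      stable (y ◂ M) λ c →
        dim M λ (m , DM) → dim (M · S) λ (ms , DMS) → dim (N · S) λ (ns , DNS) →
        dim (Y · S) λ (ks , DYS) → dim (Y ∧ y ◂ M) λ (i₀ , Di₀) → decide (Small r (Y ∧ y ◂ M)) λ where
          (yes small) → c (proj₂ (dim-≥⇒⊆ Di₀ DY proj₁
            (min ( ∧-sat Y (y ◂ M) sY (▸-sat (y ⁻¹) M sM) , small
                 , y , q , (y∈ , self-coset y {M} (unit fM)) , q∈ , λ m → yq∉ (proj₁ m)) Di₀) w∈Y))
          (no big) → uncross DY DYS (◂-dim y DM) (◂-·-dim y {M} DMS) smY big
            λ (i , j , js , Di , Dj , Djs , mod , gap , lt) →
            let J : Sub
                J = Y ∨ y ◂ M
                yN⊆J : y ◂ N ⊆ cl J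
                yN⊆J = coset-⊆ fN (cl J) (below DM DMS (cl J) (star-sat (star J)) (cl-below {J} Dj Djs lt))
                         (cl-inc J (∨-inˡ Y (y ◂ M) y∈)) (self-coset y {N} (unit fN))
                ns≤js : ns ≤ js
                ns≤js = ≤-stable λ c → dim (cl J · S) λ (b , Db) → c (subst (ns ≤_) (cl-·-dim {J} Djs Db)
                  (dim-mono Db (◂-·-dim y {N} DNS) (·-mono (y ◂ N) S (cl J) S yN⊆J id)))
                Y⊆yN : Y ⊆ y ◂ N
                Y⊆yN = locN P (λ m → M⊆N (P⊆M m)) (smallN smM) sY smY y∈ q∈ yq∉ DY min
                1≤i : 1 ≤ i
                1≤i = dim-pos Di (y∈ , self-coset y {M} (unit fM))
                contra : k + (r + 2) ≤ ms → ms + m ≤ ns → ⊥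
                contra h₁ h₂ = n≮0 (final ks ns js i m ms ns≤js gap (smY DY DYS) 1≤i h₁ h₂ (smM DM DMS))
            -- M is saturated and x ∉ M, so NS is larger than MS; both are stable under M, so the
            -- difference has room for a whole coset of M.
            in ¬⊆ {N · S} {M · S} (λ NS⊆MS → x∉M (sM (star-anti (star M) (star N) (λ z∈ u u∈ → z∈ u (NS⊆MS u∈)) (cl-inc N x∈N))))
               λ (v , v∈ , v∉) →
               let ms+m≤ns : ms + m ≤ ns
                   ms+m≤ns = dim-disjoint DMS (◂-dim v DM) DNS (·-mono M S N S M⊆N id)
                     (coset-⊆ fM (N · S) (λ {a} a∈ h∈ → ·-stable N N S (mult fN) a∈ (M⊆N h∈)) v∈ (self-coset v {M} (unit fM)))
                     (λ u∈MS u∈vM → v∉ (coset-⊆ fM (M · S) (·-stable M M S (mult fM)) u∈MS u∈vM (self-coset v {M} (unit fM))))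
               in ¬stable P (star Y) (unsat-star P Y sY λ st → yq∉ (st y∈ q∈)) λ (z , h , z∈ , h∈ , zh∉) →
               dim (star Y ∧ z ◂ M) λ (i′ , Di′) → decide (Small r (star Y ∧ z ◂ M)) λ where
                 -- The meet with zM is in the minimized class, so it has dimension at least k, and
                 -- it is disjoint from `star (y ◂ N)`. Hence k ≤ |`star Y`| - |`star (y ◂ N)`| =
                 -- |NS| - |YS|.
                 (yes small) → dim (star Y) λ (e , De) → dim (star (y ◂ N)) λ (t , Dt) →
                   contra (case₁ e t i i′ js ks ms ns
                     (min ( ∧-sat (star Y) (z ◂ M) (star-sat Y) (▸-sat (z ⁻¹) M sM) , small
                          , z , h , (z∈ , self-coset z {M} (unit fM)) , h∈ , λ m → zh∉ (proj₁ m)) Di′)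
                     (dim-disjoint Di′ Dt De proj₁ (λ m → star-anti Y (y ◂ N) Y⊆yN m)
                       (λ (_ , u∈zM) u∈ → zh∉ (star-anti Y (y ◂ N) Y⊆yN
                          (star-stable N (y ◂ N) (▸-stable N (y ⁻¹) N (mult fN))
                            (coset-⊆ fM (star (y ◂ N))
                               (λ a∈ h∈ → star-stable N (y ◂ N) (▸-stable N (y ⁻¹) N (mult fN)) a∈ (M⊆N h∈))
                               u∈ u∈zM (self-coset z {M} (unit fM)))
                            (M⊆N (P⊆M h∈))))))
                     (≥≡ (star-dim {y ◂ N} (◂-·-dim y {N} DNS) Dt)) (≤≡ (star-dim {Y} DYS De)) ns≤js gap 1≤i) ms+m≤ns
                 (no big′) → contra (case₂ i′ ms
                     (uncross-star sY smY DY DM DMS Di′ big′ fN below Y⊆yN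
                       (λ yN⊆Y → yq∉ (yN⊆Y (∈-◂ y N (M⊆N (P⊆M q∈))))))
                     (dim-pos Di′ (z∈ , self-coset z {M} (unit fM)))) ms+m≤ns
      where
      ¬⊆ : ∀ {X Y} → ¬ (X ⊆ Y) → ¬ ¬ ∃ λ v → v ∈ X × v ∉ Y
      ¬⊆ {X} {Y} X⊈Y c = X⊈Y λ {v} v∈ → stable Y λ v∉ → c (v , v∈ , v∉)
      final : ∀ ks ns js i m ms → ns ≤ js → js + suc (r + i) ≤ ks + ms → ks ≤ r + k → 1 ≤ i →
        k + (r + 2) ≤ ms → ms + m ≤ ns → ms ≤ r + m → 4 ≤ 0
      final ks ns js i m ms h₁ h₂ h₃ h₄ h₅ h₆ h₇ =
        linear (ns + js + r + i + ks + k + r + ms + m + ms) (h₁ ⊞ h₂ ⊞ h₃ ⊞ h₄ ⊞ h₅ ⊞ h₆ ⊞ h₇)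
          (solve (ks ∷ ns ∷ js ∷ i ∷ m ∷ ms ∷ r ∷ k ∷ [])) (solve (ks ∷ ns ∷ js ∷ i ∷ m ∷ ms ∷ r ∷ k ∷ []))
      case₁ : ∀ e t i i′ js ks ms ns → k ≤ i′ → i′ + t ≤ e → n ≤ ns + t → ks + e ≤ n → ns ≤ js →
        js + suc (r + i) ≤ ks + ms → 1 ≤ i → k + (r + 2) ≤ ms
      case₁ e t i i′ js ks ms ns h₁ h₂ h₃ h₄ h₅ h₆ h₇ =
        linear (i′ + t + n + ks + e + ns + js + i) (h₁ ⊞ h₂ ⊞ h₃ ⊞ h₄ ⊞ h₅ ⊞ h₆ ⊞ h₇)
          (solve (e ∷ t ∷ i ∷ i′ ∷ js ∷ ks ∷ ms ∷ ns ∷ r ∷ k ∷ n ∷ [])) (solve (e ∷ t ∷ i ∷ i′ ∷ js ∷ ks ∷ ms ∷ ns ∷ r ∷ k ∷ n ∷ []))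
      case₂ : ∀ i′ ms → k + suc (r + i′) ≤ ms → 1 ≤ i′ → k + (r + 2) ≤ ms
      case₂ i′ ms h₁ h₂ = linear i′ (h₁ ⊞ h₂) (solve (i′ ∷ ms ∷ r ∷ k ∷ [])) (solve (i′ ∷ ms ∷ r ∷ k ∷ []))

    -- The state of the descending chain at boundary r; `localized` is the invariant that makes the
    -- next step possible.
    record Kernel (r : ℕ) (Below : Sub → Set (lsuc (c ⊔ ℓ ⊔ p))) : Set (lsuc (c ⊔ ℓ ⊔ p)) where
      field
        M         : Sub
        subfield  : Subfield M
        sat       : Sat M
        small     : Small r M
        localized : Localized M
        stabilizes : ∀ V → Sat V → Below V → StableUnder M V

    -- The `Lift` stays on the same level and only shields the implicit arguments from being
    -- instantiated.
    BoundaryBelow BoundaryAtMost : ℕ → Sub → Set (lsuc (c ⊔ ℓ ⊔ p))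
    BoundaryBelow r V = Lift (lsuc (c ⊔ ℓ ⊔ p)) (∀ {a b} → Dim V a → Dim (V · S) b → b < r + a)
    BoundaryAtMost r V = Lift (lsuc (c ⊔ ℓ ⊔ p)) (Small r V)

    -- One step of the descending chain of subfields

    module Step {r : ℕ} {σ : ℕ} (DS : Dim S σ) (r≤σ : r ≤ σ) (old : Kernel r (BoundaryBelow r)) where
      open Kernel old

      module _ {X k y q} (sX : Sat X) (smX : Small r X) (y∈X : y ∈ X) (q∈M : q ∈ M) (yq∉X : y ∙ q ∉ X)
               (DX : Dim X k) (min : Minimal M r k) where

        -- A smallest saturated set of boundary at most r that is not M-stable, translated to contain 1, is
        -- the next subfield of the chain.
        P₀ : Sub
        P₀ = y ▸ X

        satP₀ : Sat P₀
        satP₀ = ▸-sat y X sX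

        smallP₀ : Small r P₀
        smallP₀ = ▸-small y smX

        dimP₀ : Dim P₀ k
        dimP₀ = ▸-dim y DX

        ε∈P₀ : ε ∈ P₀
        ε∈P₀ = ∈-resp X (≈-trans (≈-sym (identityˡ y)) (comm ε y)) y∈X

        q∉P₀ : q ∉ P₀
        q∉P₀ = yq∉X

        εq∉ : ε ∙ q ∉ P₀
        εq∉ m = q∉P₀ (∈-resp P₀ (identityˡ q) m)

        P₀⊆M : P₀ ⊆ M
        P₀⊆M m = ∈-resp M (cancelˡ y _) (localized M id small sX smX y∈X q∈M yq∉X DX min m)

        stable⇒M⊆ : ∀ {Z w} → StableUnder M Z → w ∈ Z → w ∈ M → M ⊆ Z
        stable⇒M⊆ {Z} {w} ZM w∈Z w∈M {v} v∈M = ∈-resp Z (cancelʳ w v) (ZM w∈Z (mult subfield (inv subfield w∈M) v∈M))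

        -- A boundary below r would make P₀ stable under M, and then q = ε ∙ q would lie in P₀.
        exact : ∀ {b} → Dim (P₀ · S) b → b ≡ r + k
        exact {b} D = ≤-antisym (smallP₀ dimP₀ D) (≮⇒≥ λ lt → εq∉
          (stabilizes P₀ satP₀ (lift λ D₁ D₂ → subst₂ (λ u v → u < r + v) (dim-unique D D₂) (dim-unique dimP₀ D₁) lt)
             ε∈P₀ q∈M))

        below : ∀ Q → Small r Q → BelowStable Q M
        below Q smQ Dq Dqs V sV h = stabilizes V sV (lift λ Da Db → arith _ _ _ _ (h Da Db) (smQ Dq Dqs))
          where
          arith : ∀ a b q qs → b + q < a + qs → qs ≤ r + q → b < r + a
          arith a b q qs h₁ h₂ = linear (q + qs) (h₁ ⊞ h₂) (solve (a ∷ b ∷ q ∷ qs ∷ r ∷ [])) (solve (a ∷ b ∷ q ∷ qs ∷ r ∷ []))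

        M⊈P₀ : ¬ (ε ◂ M ⊆ P₀)
        M⊈P₀ h = εq∉ (h (∈-◂ ε M q∈M))

        P₀⊆εM : P₀ ⊆ ε ◂ M
        P₀⊆εM m = ∈-resp M (≈-sym (≈-trans (≈-sym (identityˡ _)) (cancelʳ ε _))) (P₀⊆M m)

        M-disjoint : ∀ {z h} → z ∈ star P₀ → h ∈ M → z ∙ h ∉ star P₀ → ∀ {u} → u ∈ z ◂ M → u ∉ star M
        M-disjoint z∈ h∈ zh∉ u∈ u∈* = zh∉ (star-anti P₀ M P₀⊆M
          (star-stable M M (mult subfield) (coset-⊆ subfield (star M) (star-stable M M (mult subfield)) u∈* u∈
             (self-coset _ {M} (unit subfield))) h∈))

        -- The room that `closed-P₀` needs: MS exceeds r by at least two copies of P₀. As P₀ is not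
        -- stable under M, neither is `star P₀`, and the coset zM of a point z that witnesses this
        -- is compared with `star P₀`.
        narrow : ∀ {ms} → Dim (M · S) ms → k + k + r ≤ ms
        narrow {ms} DMS = ≤-stable λ c →
          dim M λ (m , DM) → dim (P₀ · S) λ (ks , Dks) → dim (star P₀) λ (e , De) → dim (star M) λ (m* , Dm*) →
          ¬stable M (star P₀) (unsat-star M P₀ satP₀ λ st → εq∉ (st ε∈P₀ q∈M)) λ (z , h , z∈ , h∈ , zh∉) →
          dim (star P₀ ∧ z ◂ M) λ (i , Di) → decide (Small r (star P₀ ∧ z ◂ M)) λ where
            (yes sm) → c (case₁ ks e m* i
               (min ( ∧-sat (star P₀) (z ◂ M) (star-sat P₀) (▸-sat (z ⁻¹) M sat) , sm
                    , z , h , (z∈ , self-coset z {M} (unit subfield)) , h∈ , λ m → zh∉ (proj₁ m)) Di)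
               (dim-disjoint Di Dm* De proj₁ (λ m → star-anti P₀ M P₀⊆M m)
                 (λ (_ , u∈) u∈* → M-disjoint z∈ h∈ zh∉ u∈ u∈*))
               (≤≡ (star-dim {P₀} Dks De)) (≥≡ (star-dim {M} DMS Dm*)) (≥≡ (exact Dks)))
            (no big) → decide (∃ λ z₂ → z₂ ∈ star P₀ × z₂ ∉ star M ∨ z ◂ M) λ where
              -- By modularity `star P₀` is now `star M` joined with its meet with zM, which is too
              -- small for the bound of `uncross-star`.
              (no none) → dim (star M ∨ (z ◂ M ∧ star P₀)) λ (j , Dj) →
                n≮0 (case₂ ks e m* i j
                  (dim-mono Dj De λ {u} u∈ → ∨-modular (star M) (z ◂ M) (star P₀) (λ m → star-anti P₀ M P₀⊆M m)
                     (stable (star M ∨ z ◂ M) (λ u∉ → none (u , u∈ , u∉)) , u∈))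
                  (≤-stable λ c → dim (star M ∧ (z ◂ M ∧ star P₀)) λ (o , Do) →
                    c (≤-trans (m≤m+n j o) (≤≡ (dim-modular Dm* (dim-≐ {star P₀ ∧ z ◂ M} {z ◂ M ∧ star P₀} ((λ (a , b) → b , a) , (λ (a , b) → b , a)) Di) Dj Do))))
                  (≥≡ (star-dim {P₀} Dks De)) (≤≡ (star-dim {M} DMS Dm*)) (≤≡ (exact Dks))
                  (uncross-star {y = ε} satP₀ smallP₀ dimP₀ DM DMS Di big subfield (below M small) P₀⊆εM M⊈P₀))
              -- Now `star M`, zP₀ and z₂P₀ are independent inside `perp S`, so 2k + σ ≤ ms. This is
              -- where r ≤ σ enters.
              (yes (z₂ , z₂∈ , z₂∉)) → dim (perp S) λ (s⊥ , Ds⊥) → dim (star M ∨ z ◂ P₀) λ (j , Dj) →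
                let zP⊆zM : ∀ {z} → z ◂ P₀ ⊆ z ◂ M
                    zP⊆zM m = P₀⊆M m
                    zP⊆⊥ : ∀ {z} → z ∈ star P₀ → z ◂ P₀ ⊆ perp S
                    zP⊆⊥ {z} z∈ {u} u∈ s s∈ = ∈-resp O
                      (≈-trans (∙-congʳ (comm _ _)) (≈-trans (assoc _ _ _) (∙-congˡ (≈-trans (comm _ _) (cancelʳ z u)))))
                      (star-out P₀ z∈ u∈ s∈)
                    M*⊆⊥ : star M ⊆ perp S
                    M*⊆⊥ m s s∈ = ∈-resp O (∙-congʳ (identityˡ s)) (star-out M m (unit subfield) s∈)
                    M*zM-stable : StableUnder M (star M ∨ z ◂ M)
                    M*zM-stable = ∨-stable M (star M) (z ◂ M) (star-stable M M (mult subfield)) (▸-stable M (z ⁻¹) M (mult subfield))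
                in c (case₃ m* j s⊥
                  (dim-disjoint Dm* (◂-dim z dimP₀) Dj (∨-inˡ (star M) (z ◂ P₀)) (∨-inʳ (star M) (z ◂ P₀))
                    (λ u∈* u∈ → M-disjoint z∈ h∈ zh∉ (zP⊆zM {z} u∈) u∈*))
                  (dim-disjoint Dj (◂-dim z₂ dimP₀) Ds⊥ (∨-⊆ (star M) (z ◂ P₀) (perp S) M*⊆⊥ (zP⊆⊥ z∈)) (zP⊆⊥ z₂∈)
                    (λ u∈ u∈′ → z₂∉ (coset-⊆ subfield (star M ∨ z ◂ M) M*zM-stable
                       (∨-⊆ (star M) (z ◂ P₀) (star M ∨ z ◂ M) (∨-inˡ (star M) (z ◂ M))
                          (λ v → ∨-inʳ (star M) (z ◂ M) (zP⊆zM {z} v)) u∈)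
                       (zP⊆zM {z₂} u∈′) (self-coset z₂ {M} (unit subfield)))))
                  (≤≡ (perp-dim DS Ds⊥)) (≥≡ (star-dim {M} DMS Dm*)) r≤σ)
          where
          case₁ : ∀ ks e m* i → k ≤ i → i + m* ≤ e → ks + e ≤ n → n ≤ ms + m* → r + k ≤ ks → k + k + r ≤ ms
          case₁ ks e m* i h₁ h₂ h₃ h₄ h₅ = linear (i + m* + e + ks + n) (h₁ ⊞ h₂ ⊞ h₃ ⊞ h₄ ⊞ h₅)
            (solve (ks ∷ e ∷ m* ∷ i ∷ k ∷ r ∷ ms ∷ n ∷ [])) (solve (ks ∷ e ∷ m* ∷ i ∷ k ∷ r ∷ ms ∷ n ∷ []))
          case₂ : ∀ ks e m* i j → e ≤ j → j ≤ m* + i → n ≤ ks + e → ms + m* ≤ n → ks ≤ r + k →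
            k + suc (r + i) ≤ ms → 1 ≤ 0
          case₂ ks e m* i j h₁ h₂ h₃ h₄ h₅ h₆ = linear (e + j + n + ms + m* + ks + k + r + i) (h₁ ⊞ h₂ ⊞ h₃ ⊞ h₄ ⊞ h₅ ⊞ h₆)
            (solve (ks ∷ e ∷ m* ∷ i ∷ j ∷ k ∷ r ∷ ms ∷ n ∷ [])) (solve (ks ∷ e ∷ m* ∷ i ∷ j ∷ k ∷ r ∷ ms ∷ n ∷ []))
          case₃ : ∀ m* j s⊥ → m* + k ≤ j → j + k ≤ s⊥ → σ + s⊥ ≤ n → n ≤ ms + m* → r ≤ σ → k + k + r ≤ ms
          case₃ m* j s⊥ h₁ h₂ h₃ h₄ h₅ = linear (m* + j + s⊥ + σ + n) (h₁ ⊞ h₂ ⊞ h₃ ⊞ h₄ ⊞ h₅)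
            (solve (m* ∷ j ∷ s⊥ ∷ k ∷ r ∷ σ ∷ ms ∷ n ∷ [])) (solve (m* ∷ j ∷ s⊥ ∷ k ∷ r ∷ σ ∷ ms ∷ n ∷ []))

        -- P₀ and x⁻¹P₀ share ε. If their meet has boundary at most r, minimality makes it all of
        -- P₀. Otherwise the closure of their join contains M, and submodularity gives |MS| ≤ 2k + r
        -- - 2, against `narrow`.
        closed-P₀ : ∀ {x x′} → x ∈ P₀ → x′ ∈ P₀ → x ∙ x′ ∈ P₀
        closed-P₀ {x} {x′} x∈ x′∈ = stable P₀ λ xx′∉ →
          dim M λ (m , DM) → dim (M · S) λ (ms , DMS) → dim (P₀ · S) λ (ks , Dks) →
          dim (P₀ ∧ x ▸ P₀) λ (i₀ , Di₀) → decide (Small r (P₀ ∧ x ▸ P₀)) λ where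
            (yes sm) → xx′∉ (proj₂ (dim-≥⇒⊆ Di₀ dimP₀ proj₁
              (min ( ∧-sat P₀ (x ▸ P₀) satP₀ (▸-sat x P₀ satP₀) , sm
                   , ε , q , (ε∈P₀ , xε∈ x∈) , q∈M , λ m → εq∉ (proj₁ m)) Di₀) x′∈))
            (no big) → uncross dimP₀ Dks (▸-dim x dimP₀) (dim-≐ (▸-· x P₀ S) (▸-dim x Dks)) smallP₀ big
              λ (i , j , js , Di , Dj , Djs , mod , gap , lt) →
              let J = P₀ ∨ x ▸ P₀
                  M⊆clJ : M ⊆ cl J
                  M⊆clJ = stable⇒M⊆ {cl J} {ε} (below P₀ smallP₀ dimP₀ Dks (cl J) (star-sat (star J)) (cl-below {J} Dj Djs lt))
                    (cl-inc J (∨-inˡ P₀ (x ▸ P₀) ε∈P₀)) (unit subfield)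
              in dim (cl J · S) λ (b , Db) → n≮0 (arith ms ks i js
                   (subst (ms ≤_) (cl-·-dim {J} Djs Db) (dim-mono Db DMS (·-mono M S (cl J) S M⊆clJ id)))
                   gap (≤≡ (exact Dks)) (dim-pos Di (ε∈P₀ , xε∈ x∈)) (narrow DMS))
          where
          xε∈ : ∀ {x} → x ∈ P₀ → x ∙ ε ∈ P₀
          xε∈ x∈ = ∈-resp P₀ (≈-trans (≈-sym (identityˡ _)) (comm ε _)) x∈
          arith : ∀ ms ks i js → ms ≤ js → js + suc (r + i) ≤ ks + ks → ks ≤ r + k → 1 ≤ i → k + k + r ≤ ms → 2 ≤ 0
          arith ms ks i js h₁ h₂ h₃ h₄ h₅ = linear (ms + js + r + i + ks + ks + k + k + r)
            (h₁ ⊞ h₂ ⊞ h₃ ⊞ h₃ ⊞ h₄ ⊞ h₅)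
            (solve (ms ∷ ks ∷ i ∷ js ∷ k ∷ r ∷ [])) (solve (ms ∷ ks ∷ i ∷ js ∷ k ∷ r ∷ []))

        subfieldP₀ : Subfield P₀
        subfieldP₀ = record { unit = ε∈P₀ ; mult = closed-P₀ }

        -- Take a smallest counterexample, of dimension d. Localization puts it in a coset of M. If
        -- `star V` meets zP₀ with boundary at most r, minimality gives zP₀ ⊆ `star V`; otherwise
        -- `uncross-star` gives d < k, although V is not stable under M and so k ≤ d.
        stabilizes-P₀ : ∀ V → Sat V → Small r V → StableUnder P₀ V
        stabilizes-P₀ V₀ sV₀ smV₀ {v₀} {h₀} v₀∈ h₀∈ = stable V₀ λ bad → dim V₀ λ (d₀ , DV₀) →
          least (λ d → ∃ λ V → Class P₀ r V × Dim V d) d₀ (V₀ , (sV₀ , smV₀ , v₀ , h₀ , v₀∈ , h₀∈ , bad) , DV₀)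
          λ (d , (V , (sV , smV , v , h , v∈ , h∈ , vh∉) , DV) , minV) →
          dim (P₀ · S) λ (ks , Dks) →
          ¬stable P₀ (star V) (unsat-star P₀ V sV λ st → vh∉ (st v∈ h∈)) λ (z , g , z∈ , g∈ , zg∉) →
          dim (star V ∧ z ◂ P₀) λ (i , Di) → decide (Small r (star V ∧ z ◂ P₀)) λ where
            (yes sm) → zg∉ (proj₁ (dim-≥⇒⊆ Di (◂-dim z dimP₀) proj₂
              (min ( ∧-sat (star V) (z ◂ P₀) (star-sat V) (▸-sat (z ⁻¹) P₀ satP₀) , sm
                   , z , g , (z∈ , self-coset z {P₀} ε∈P₀) , P₀⊆M g∈ , λ m → zg∉ (proj₁ m)) Di)
              (∈-◂ z P₀ g∈)))
            (no big) → n≮0 (arith d ks i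
              (uncross-star sV smV DV dimP₀ Dks Di big subfield (below P₀ smallP₀)
                (localized P₀ P₀⊆M small sV smV v∈ h∈ vh∉ DV λ cl D → minV _ (_ , cl , D))
                (λ vM⊆V → vh∉ (vM⊆V (∈-◂ v M (P₀⊆M h∈)))))
              (≤≡ (exact Dks))
              (min (sV , smV , v , h , v∈ , P₀⊆M h∈ , vh∉) DV))
          where
          arith : ∀ d ks i → d + suc (r + i) ≤ ks → ks ≤ r + k → k ≤ d → 1 + i ≤ 0
          arith d ks i h₁ h₂ h₃ = linear (d + r + ks + k) (h₁ ⊞ h₂ ⊞ h₃)
            (solve (d ∷ ks ∷ i ∷ k ∷ r ∷ [])) (solve (d ∷ ks ∷ i ∷ k ∷ r ∷ []))

        new : Kernel r (BoundaryAtMost r)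
        new = record
          { M = P₀
          ; subfield = subfieldP₀
          ; sat = satP₀
          ; small = smallP₀
          ; localized = localized-step subfieldP₀ satP₀ subfield localized P₀⊆M q∈M q∉P₀
              -- P₀ has boundary exactly r, so a bound t for it is at least r and thus bounds M as
              -- well.
              (λ {t} sm {a} {b} Da Db → ≤-stable λ c → dim (P₀ · S) λ (ks , Dks) →
                 c (≤-trans (small Da Db) (+-monoˡ-≤ a (+-cancelʳ-≤ k r t (≤-trans (≥≡ (exact Dks)) (sm dimP₀ Dks))))))
              (below P₀ smallP₀)
          ; stabilizes = λ V sV sm → stabilizes-P₀ V sV (lower sm)
          }

      step : ¬ ¬ Kernel r (BoundaryAtMost r)
      step c = decide (∃ λ d → ∃ λ X → Class M r X × Dim X d) λ where
        (no none) → c record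
          { M = M ; subfield = subfield ; sat = sat ; small = small ; localized = localized
          ; stabilizes = λ V sV smV {x} {h} x∈ h∈ → stable V λ xh∉ → dim V λ (d , DV) →
              none (d , V , (sV , lower smV , x , h , x∈ , h∈ , xh∉) , DV) }
        (yes (d₀ , X₀)) → least (λ d → ∃ λ X → Class M r X × Dim X d) d₀ X₀
          λ (d , (X , (sX , smX , y , q , y∈ , q∈ , yq∉) , DX) , min) →
            c (new sX smX y∈ q∈ yq∉ DX λ cl D → min _ (_ , cl , D))

    -- Boundary below r + 1 means boundary at most r, so the steps chain. The start is the whole
    -- space: |VS| ≥ |V| leaves nothing below boundary 0.
    kernel : ∀ {σ} → Dim S σ → 1 ≤ σ → ∀ r → r ≤ σ → ¬ ¬ Kernel r (BoundaryAtMost r)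
    kernel {σ} DS 1≤σ zero r≤σ = Step.step DS r≤σ record
      { M = ⊤ₛ
      ; subfield = record { unit = tt ; mult = λ _ _ → tt }
      ; sat = λ _ → tt
      ; small = λ D E → dim-mono D E (λ _ → tt)
      ; localized = λ _ _ _ _ _ _ _ _ _ _ _ → tt
      ; stabilizes = λ V _ below {x} x∈ _ → stable V λ _ → dim V λ (a , Da) → dim (V · S) λ (b , Db) →
          let (s , s∈) = dim-inhabited DS 1≤σ
          in <⇒≱ (lower below Da Db) (dim-mono Db (▸-dim (s ⁻¹) Da)
               (λ m → ∈-resp (V · S) (≈-trans (comm _ _) (cancelʳ s _)) (·-in V S m s∈)))
      }
    kernel {σ} DS 1≤σ (suc r) r<σ c = kernel DS 1≤σ r (<⇒≤ r<σ) λ prev →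
      let open Kernel prev in Step.step DS r<σ record
        { M = M ; subfield = subfield ; sat = sat
        ; small = λ D E → m≤n⇒m≤1+n (small D E)
        ; localized = localized
        ; stabilizes = λ V sV below → stabilizes V sV (lift λ D E → ≤-pred (lower below D E))
        } c

    -- Let r be the boundary of `cl A`. If r ≤ |S|, the kernel M at r stabilizes `cl A`, so |AM| ≤
    -- |`cl A`| and |SM| ≤ r + |M|. Otherwise |AS| > |`cl A`| + |S|, and the trivial subfield `pt ε`
    -- suffices.
    kneser : ∀ {A x y} → x ∈ A → y ∈ S →
      ¬ ¬ ∃ λ M → Subfield M × StableUnder M (A · S) ×
        (∀ {u v w m} → Dim (A · M) u → Dim (S · M) v → Dim (A · S) w → Dim M m → u + v ≤ w + m)
    kneser {A} {x} {y} x∈A y∈S c =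
      dim S λ (σ , DS) → dim (A · S) λ (w , DAS) → dim (cl A) λ (a , DA) → decide (w ≤ σ + a) λ where
        (yes w≤) → kernel DS (dim-pos DS y∈S) (w ∸ a) (≤-trans (∸-monoˡ-≤ a w≤) (≤≡ (m+n∸n≡m σ a))) λ K →
          let open Kernel K
              clA-small : Small (w ∸ a) (cl A)
              clA-small D E = subst₂ (λ b a′ → b ≤ (w ∸ a) + a′) (sym (cl-·-dim {A} DAS E)) (dim-unique DA D)
                (subst (w ≤_) (+-comm a (w ∸ a)) (m≤n+m∸n w a))
              clA-stable : StableUnder M (cl A)
              clA-stable = stabilizes (cl A) (star-sat (star A)) (lift clA-small)
              starA-stable : StableUnder M (star A)
              starA-stable z∈ h∈ = star-sat A (star-stable M (cl A) clA-stable (cl-inc (star A) z∈) h∈)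
              a≤w : a ≤ w
              a≤w = ≤-stable λ c → dim (cl A · S) λ (w′ , D) → c (subst (a ≤_) (cl-·-dim {A} DAS D)
                (dim-mono D (▸-dim (y ⁻¹) DA)
                  (λ m → ∈-resp (cl A · S) (≈-trans (comm _ _) (cancelʳ y _)) (·-in (cl A) S m y∈S))))
          in c ( M , subfield
               , (λ {u} {h} u∈ h∈ → perp-perp (A · S) (perp-stable M (star A) starA-stable
                    (λ z z∈ → ∈-resp O (comm _ _) (z∈ u u∈)) h∈))
               , λ {u} {v} {w′} {m} Du Dv Dw Dm → arith a u v m
                   (dim-mono DA Du (·-⊆ A M (cl A) λ a∈ h∈ → clA-stable (cl-inc A a∈) h∈))
                   (small Dm (dim-≐ (·-comm S M , ·-comm M S) Dv))
                   (≥≡ (trans (dim-unique Dw DAS) (sym (m∸n+n≡m a≤w)))))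
        (no w≰) → c ( pt ε , record { unit = pt-self ε ; mult = λ {x} {y} a b → pt-stable (pt ε) a b }
                    , pt-stable (A · S)
                    , λ {u} {v} {w′} {m} Du Dv Dw Dm → ≤-trans
                        (dim-mono DA Du (·-⊆ A (pt ε) (cl A) λ a∈ h∈ → cl-inc A (pt-stable A a∈ h∈))
                          ⊞ dim-mono DS Dv (·-⊆ S (pt ε) S (pt-stable S)))
                        (≤-trans (≤≡ (+-comm a σ)) (≤-trans (<⇒≤ (≰⇒> w≰))
                          (subst (_≤ w′ + m) (dim-unique Dw DAS) (m≤m+n w′ m)))))
      where
      perp-stable : ∀ H X → StableUnder H X → StableUnder H (perp X)
      perp-stable H X XH z∈ h∈ x x∈ = ∈-resp O
        (≈-trans (assoc _ _ _) (∙-congˡ (comm _ _))) (z∈ _ (XH x∈ h∈))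
      pt-stable : ∀ X → StableUnder (pt ε) X
      pt-stable X {x} x∈ h∈ = stable X λ k → h∈ λ l → k (closed X xε∈ xε∈ (line-∙ x l))
        where
        xε∈ : x ∙ ε ∈ X
        xε∈ = ∈-resp X (≈-trans (≈-sym (identityˡ x)) (comm ε x)) x∈
      arith : ∀ {r w} a u v m → u ≤ a → v ≤ r + m → r + a ≤ w → u + v ≤ w + m
      arith {r} {w} a u v m h₁ h₂ h₃ = linear (a + r) (h₁ ⊞ h₂ ⊞ h₃)
        (solve (a ∷ u ∷ v ∷ m ∷ r ∷ w ∷ [])) (solve (a ∷ u ∷ v ∷ m ∷ r ∷ w ∷ []))

greatest : ∀ {a} (P : ℕ → Set a) → ∀ b → (∀ k → P k → k ≤ b) → ∀ n → P n →
  ¬ ¬ ∃ λ m → P m × ∀ k → P k → k ≤ m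
greatest P b bound n Pn c =
  least (λ j → ∃ λ k → P k × k + j ≡ b) (b ∸ n) (n , Pn , m+[n∸m]≡n (bound n Pn))
    λ (j , (m , Pm , m+j≡b) , min) → c (m , Pm , λ k Pk →
      +-cancelʳ-≤ j k m (≤-trans (+-monoʳ-≤ k (min (b ∸ k) (k , Pk , m+[n∸m]≡n (bound k Pk))))
        (≤-reflexive (trans (m+[n∸m]≡n (bound k Pk)) (sym m+j≡b)))))

*-pos : ∀ m n → 1 ≤ m * n → 1 ≤ n
*-pos m zero    1≤ = subst (1 ≤_) (*-zeroʳ m) 1≤
*-pos m (suc n) _  = s≤s z≤n

-- Stabilizers and semistability

module Stabilizers {c ℓ p : Level} {geometry : Geometry c ℓ p} {n : ℕ} (frame : Frame geometry n) where
  open Geometry geometry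
  open Subspaces geometry
  open Products geometry
  open Duality frame
  open Isoperimetry frame
  open Subfield

  stab : Sub → Sub
  stab X = X ⊘ X

  stab-subfield : ∀ X → Subfield (stab X)
  stab-subfield X = record
    { unit = λ z z∈ → ∈-resp X (≈-trans (≈-sym (identityˡ z)) (comm ε z)) z∈
    ; mult = λ x∈ y∈ z z∈ → ∈-resp X (assoc _ _ _) (y∈ _ (x∈ z z∈))
    }

  ·-inˡ : ∀ X M → ε ∈ M → X ⊆ X · M
  ·-inˡ X M ε∈M x∈ = ∈-resp (X · M) (≈-trans (comm _ _) (identityˡ _)) (·-in X M x∈ ε∈M)

  ·-stableʳ : ∀ {H} X → Subfield H → StableUnder H (X · H)
  ·-stableʳ {H} X fH {x} {h} m h∈ = ∈-resp (X · H) (comm h x)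
    (·-⊆ X H (h ▸ (X · H)) (λ x∈ k∈ → ∈-resp (X · H) (≈-trans (≈-sym (assoc _ _ _)) (comm _ _)) (·-in X H x∈ (mult fH k∈ h∈))) m)

  -- `kneser` yields some stabilizing M, not the full stabilizer H. Applied to AH and BH, whose
  -- product is still AB, it gives M ⊆ H, while |AHM| ≥ |AH| and |BHM| ≥ |BH|.
  kneser-stab : ∀ {A B x y} → x ∈ A → y ∈ B → ∀ {u v w h} → Dim (A · stab (A · B)) u →
    Dim (B · stab (A · B)) v → Dim (A · B) w → Dim (stab (A · B)) h → u + v ≤ w + h
  kneser-stab {A} {B} x∈A y∈B {u} {v} {w} {h} Du Dv Dw Dh = ≤-stable λ k →
    Boundary.kneser BH {AH} (·-inˡ A H (unit fH) x∈A) (·-inˡ B H (unit fH) y∈B) λ (M , fM , stable-M , ineq) →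
    dim (AH · M) λ (u′ , Du′) → dim (BH · M) λ (v′ , Dv′) → dim M λ (m , Dm) →
    k (≤-trans (dim-mono Du′ Du (·-inˡ AH M (unit fM)) ⊞ dim-mono Dv′ Dv (·-inˡ BH M (unit fM)))
      (≤-trans (ineq Du′ Dv′ (dim-≐ ((λ m → ·-mono A B AH BH (·-inˡ A H (unit fH)) (·-inˡ B H (unit fH)) m) , (λ m → AHBH⊆ m)) Dw) Dm)
        (+-monoʳ-≤ w (dim-mono Dh Dm λ m∈ z z∈ →
          AHBH⊆ (stable-M (·-mono A B AH BH (·-inˡ A H (unit fH)) (·-inˡ B H (unit fH)) z∈) m∈)))))
    where
    H AH BH : Sub
    H = stab (A · B)
    AH = A · H
    BH = B · H
    fH : Subfield H
    fH = stab-subfield (A · B)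
    AHBH⊆ : AH · BH ⊆ A · B
    AHBH⊆ = ·-⊆₃ A H BH (A · B) λ {a} {g} a∈ g∈ b∈ → ·-⊆ B H ((a ∙ g) ▸ (A · B))
      (λ {b} {h} b∈ h∈ → ∈-resp (A · B)
        (≈-trans (∙-congʳ (≈-trans (assoc a b g) (≈-trans (∙-congˡ (comm b g)) (≈-sym (assoc a g b))))) (assoc _ _ _))
        (h∈ _ (g∈ _ (·-in A B a∈ b∈)))) b∈

  -- X is filled with cosets of H. A coset meeting an H-stable subspace lies in it, so each new one
  -- adds exactly h. The fuel t bounds what is left to fill.
  subfield-∣ : ∀ {H X h x} → Subfield H → StableUnder H X → Dim H h → Dim X x → h ∣ x
  subfield-∣ {H} {X} {h} {x} fH XH DH DX = go x {∅ₛ} (empty lower) (λ m → ⊥-elim (lower m)) (λ m _ → m) (h ∣0) (≤-reflexive (sym (+-identityʳ x)))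
    where
    go : ∀ t {C c} → Dim C c → C ⊆ X → StableUnder H C → h ∣ c → x ≤ t + c → h ∣ x
    go t {C} {c} DC C⊆X CH h∣c x≤ = decidable-stable (h ∣? x) λ k → decide (∃ λ y → y ∈ X × y ∉ C) λ where
        (no none) → k (subst (h ∣_) (≤-antisym (dim-mono DX DC C⊆X) (dim-mono DC DX λ {y} y∈ → stable C λ y∉ → none (y , y∈ , y∉))) h∣c)
        (yes (y , y∈ , y∉)) → dim-∨∧ DC (◂-dim y DH) λ (s , m , Ds , Dm , eq) →
          let yH⊆X : y ◂ H ⊆ X
              yH⊆X = coset-⊆ fH X XH y∈ (self-coset y {H} (unit fH))
              m≡0 : m ≡ 0
              m≡0 = dim-unique Dm (empty λ (u∈C , u∈yH) → y∉ (coset-⊆ fH C CH u∈C u∈yH (self-coset y {H} (unit fH))))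
              s≡ : s ≡ c + h
              s≡ = trans (sym (+-identityʳ s)) (trans (cong (s +_) (sym m≡0)) eq)
          in smaller t x≤ (dim-pos DH (unit fH)) Ds (∨-⊆ C (y ◂ H) X C⊆X yH⊆X)
               (∨-stable H C (y ◂ H) CH (▸-stable H (y ⁻¹) H (mult fH)))
               (subst (h ∣_) (sym s≡) (∣m∣n⇒∣m+n h∣c ∣-refl)) s≡ k
      where
      smaller : ∀ t → x ≤ t + c → 1 ≤ h → ∀ {C′ s} → Dim C′ s → C′ ⊆ X → StableUnder H C′ → h ∣ s → s ≡ c + h → ¬ ¬ (h ∣ x)
      smaller zero x≤ 1≤h {s = s} Ds C′⊆X _ h∣s s≡ _ = <⇒≱ (≤-trans (m<m+n c 1≤h) (≤-reflexive (sym s≡)))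
        (≤-trans (dim-mono DX Ds C′⊆X) x≤)
      smaller (suc t) x≤ 1≤h Ds C′⊆X C′H h∣s s≡ k = k (go t Ds C′⊆X C′H h∣s
        (≤-trans x≤ (≤-trans (≤-reflexive (sym (+-suc t c))) (+-monoʳ-≤ t (≤-trans (m<m+n c 1≤h) (≤-reflexive (sym s≡)))))))

  module _ {H H′ h h′} (fH : Subfield H) (fH′ : Subfield H′) (DH : Dim H h) (DH′ : Dim H′ h′)
           (hh′ : h * h′ ≡ n)
           (bistable : ∀ {X x w} → StableUnder H X → StableUnder H′ X → w ∈ X → Dim X x → n ≤ x) where

    -- An H-subspace Z maximising h|Z ∧ W| − r|Z| and then |Z| is unique, so it is invariant under H′ and
    -- hence the whole space, where that quantity vanishes.
    semistable : ∀ {Z W r z i} → StableUnder H Z → StableUnder H′ W → Dim W (h′ * r) → Dim Z z →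
      Dim (Z ∧ W) i → h * i ≤ r * z
    semistable {Z₀} {W} {r} ZH₀ WH′ DW DZ₀ DI₀ = ≤-stable λ k →
      greatest (λ g → ∃ λ Z → Gain g Z) (h * n) (λ g (Z , G) → gain-≤ G) 1
        (Z₀ , record { stableH = ZH₀ ; dimZ = DZ₀ ; dimI = DI₀ ; gain = ≤-trans (≤-reflexive (+-comm _ 1)) (≰⇒> k) })
      λ (g , (Z₁ , G₁) , maxg) → greatest (λ z → ∃ λ Z → Gain g Z × Dim Z z) n (λ z (Z , _ , D) → dim-≤n D) _ (Z₁ , G₁ , Gain.dimZ G₁)
      λ (z , (Z , G , DZ) , maxz) →
      let open Gain G renaming (z to z′; i to i)
          1≤g : 1 ≤ g
          1≤g = maxg 1 (Z₀ , record { stableH = ZH₀ ; dimZ = DZ₀ ; dimI = DI₀ ; gain = ≤-trans (≤-reflexive (+-comm _ 1)) (≰⇒> k) })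
      in decide (StableUnder H′ Z) λ where
        -- Z is then the whole space, and h |Z ∧ W| ≤ h h′ r = r n leaves no positive gain.
        (yes ZH′) →
          let (w , w∈Z , w∈W) = dim-inhabited dimI (*-pos h i (≤-trans 1≤g (≤-trans (m≤n+m g (r * z′)) gain)))
          in <⇒≱ 1≤g (+-cancelˡ-≤ (r * z′) g 0 (≤-trans gain (≤-trans (*-monoʳ-≤ h (dim-mono DW dimI proj₂))
               (≤-trans (≤-reflexive (whole h h′ r)) (≤-trans (*-monoʳ-≤ r (≤-trans (≤-reflexive hh′) (bistable stableH ZH′ w∈Z dimZ)))
               (≤-reflexive (sym (+-identityʳ _))))))))
        (no ¬ZH′) → ¬stable H′ Z ¬ZH′ λ (x , t , x∈ , t∈ , xt∉) →
          dim (Z ∧ t ◂ Z) λ (a , Da) → dim (Z ∨ t ◂ Z) λ (b , Db) →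
          dim ((Z ∧ t ◂ Z) ∧ W) λ (ia , Dia) → dim ((Z ∨ t ◂ Z) ∧ W) λ (ib , Dib) →
          dim-∨∧ dimI (dim-≐ {t ◂ (Z ∧ W)} {t ◂ Z ∧ W}
              ( (λ (u∈Z , u∈W) → u∈Z , ∈-resp W (≈-trans (comm _ _) (cancelʳ t _)) (WH′ u∈W t∈))
              , (λ (u∈Z , u∈W) → u∈Z , ∈-resp W (comm _ _) (WH′ u∈W (inv fH′ t∈)))) (◂-dim t dimI))
          λ (s , m , Ds , Dm , eq) →
          -- The gain is supermodular and equal on Z and tZ, because tW = W. As Z ∧ tZ gains at most
          -- g, the join Z ∨ tZ gains at least g, and maximality of |Z| forces tZ ⊆ Z.
          let ◂ZH = ▸-stable H (t ⁻¹) Z stableH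
              small : h * ia ≤ r * a + g
              small = ≮⇒≥ λ lt → <⇒≱ ≤-refl (maxg (suc g) (_ , record
                { stableH = ∧-stable H Z (t ◂ Z) stableH ◂ZH ; dimZ = Da ; dimI = Dia
                ; gain = ≤-trans (≤-reflexive (+-suc (r * a) g)) lt }))
              joins : i + i ≤ ib + ia
              joins = ≤-trans (≥≡ eq)
                (dim-mono Dib Ds (∨-⊆ (Z ∧ W) (t ◂ Z ∧ W) ((Z ∨ t ◂ Z) ∧ W)
                    (λ (u , v) → ∨-inˡ Z (t ◂ Z) u , v) (λ (u , v) → ∨-inʳ Z (t ◂ Z) u , v))
                  ⊞ dim-mono Dia Dm (λ ((u , v) , (u′ , _)) → (u , u′) , v))
              b≤z : b ≤ z
              b≤z = maxz b (_ , record
                { stableH = ∨-stable H Z (t ◂ Z) stableH ◂ZH ; dimZ = Db ; dimI = Dib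
                ; gain = arith a b g ia ib z′ i gain small (*-monoʳ-≤ h joins) (*-monoʳ-≤ r (≤≡ (dim-modular dimZ (◂-dim t dimZ) Db Da))) } , Db)
          in xt∉ (dim-≥⇒⊆ DZ Db (∨-inˡ Z (t ◂ Z)) b≤z (∈-resp (Z ∨ t ◂ Z) (comm t x) (∨-inʳ Z (t ◂ Z) (∈-◂ t Z x∈))))
      where
      record Gain (g : ℕ) (Z : Sub) : Set (lsuc (c ⊔ ℓ ⊔ p)) where
        field
          {z i}   : ℕ
          stableH : StableUnder H Z
          dimZ    : Dim Z z
          dimI    : Dim (Z ∧ W) i
          gain    : r * z + g ≤ h * i
      gain-≤ : ∀ {g Z} → Gain g Z → g ≤ h * n
      gain-≤ {g} G = ≤-trans (m≤n+m g _) (≤-trans (Gain.gain G) (*-monoʳ-≤ h (dim-≤n (Gain.dimI G))))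
      whole : ∀ h h′ r → h * (h′ * r) ≡ r * (h * h′)
      whole h h′ r = solve (h ∷ h′ ∷ r ∷ [])
      arith : ∀ a b g ia ib z i → r * z + g ≤ h * i → h * ia ≤ r * a + g → h * (i + i) ≤ h * (ib + ia) →
        r * (b + a) ≤ r * (z + z) → r * b + g ≤ h * ib
      arith a b g ia ib z i h₁ h₂ h₃ h₄ = linear (2 * (r * z) + g + h * ia + 2 * (h * i) + r * a)
        (h₁ ⊞ h₁ ⊞ h₂ ⊞ h₃ ⊞ h₄)
        (solve (a ∷ b ∷ g ∷ ia ∷ ib ∷ z ∷ i ∷ r ∷ h ∷ [])) (solve (a ∷ b ∷ g ∷ ia ∷ ib ∷ z ∷ i ∷ r ∷ h ∷ []))

    -- z and r are ranks over H and over H′. For groups this counts pairs of cosets, each pair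
    -- meeting in at most one point.
    rank-bound : ∀ {A Z W a r z} → A ⊆ Z → A ⊆ W → StableUnder H Z → StableUnder H′ W →
      Dim A a → Dim Z (h * z) → Dim W (h′ * r) → a ≤ r * z
    rank-bound {A} {Z} {W} {a} {r} {z} A⊆Z A⊆W ZH WH′ DA DZ DW = ≤-stable λ k → dim (Z ∧ W) λ (i , Di) →
      k (≤-trans (dim-mono Di DA (λ m → A⊆Z m , A⊆W m)) (cancel (dim-pos DH (unit fH))
        (≤-trans (semistable ZH WH′ DW DZ Di) (≤-reflexive (reorder r h z)))))
      where
      reorder : ∀ r h z → r * (h * z) ≡ h * (r * z)
      reorder r h z = solve (r ∷ h ∷ z ∷ [])
      cancel : ∀ {h x y} → 1 ≤ h → h * x ≤ h * y → x ≤ y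
      cancel {suc h} _ = *-cancelˡ-≤ (suc h)

-- Conflicting stabilizers

-- (b - a)(c - 1) ≥ 0, written without subtraction.
rearrange : ∀ {a b c} → a ≤ b → 1 ≤ c → a * c + b ≤ b * c + a
rearrange {a} {b} {suc c} a≤b _ = subst₂ _≤_ (left a b) (right a b) (+-monoˡ-≤ (a + b) (*-monoˡ-≤ c a≤b))
  where
  left : ∀ a b → a * c + (a + b) ≡ a * suc c + b
  left a b = trans (sym (+-assoc (a * c) a b)) (cong (_+ b) (trans (+-comm (a * c) a) (sym (*-suc a c))))
  right : ∀ a b → b * c + (a + b) ≡ b * suc c + a
  right a b = trans (cong (b * c +_) (+-comm a b)) (left b a)

module Flags {c ℓ p : Level} {geometry : Geometry c ℓ p} {n : ℕ} (frame : Frame geometry n)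
  (F : Fin n → Subspaces.Sub geometry)
  (dim-F : ∀ i → Subspaces.Dim geometry (F i) (suc (toℕ i)))
  (F-mono : ∀ i j → toℕ i ≤ toℕ j → Subspaces._⊆_ geometry (F i) (F j))
  (ε∈F : ∀ i → Subspaces._∈_ geometry (Geometry.ε geometry) (F i)) where
  open Geometry geometry
  open Subspaces geometry
  open Products geometry
  open Duality frame
  open Isoperimetry frame
  open Subfield
  open Stabilizers frame

  -- r, s and v are ranks over H, so `kneser≤` is Kneser's bound divided by h; `exact` makes H the
  -- full stabilizer.
  record Stabilized (i j k : Fin n) : Set (lsuc (c ⊔ ℓ ⊔ p)) where
    field
      H : Sub
      {h r s v} : ℕ
      subfield : Subfield H
      stable-P : StableUnder H (F i · F j)
      exact    : ∀ {x} → (∀ {z} → z ∈ F i · F j → z ∙ x ∈ F i · F j) → x ∈ H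
      dim-H    : Dim H h
      dim-iH   : Dim (F i · H) (h * r)
      dim-jH   : Dim (F j · H) (h * s)
      dim-P    : Dim (F i · F j) (h * v)
      kneser≤  : r + s ≤ suc v
      P⊆       : F i · F j ⊆ F k

    iH jH P : Sub
    iH = F i · H
    jH = F j · H
    P = F i · F j

    ε∈P : ε ∈ P
    ε∈P = ·-inˡ (F i) (F j) (ε∈F j) (ε∈F i)

    H⊆P : H ⊆ P
    H⊆P h∈ = ∈-resp P (identityˡ _) (stable-P ε∈P h∈)

    iH-stable : StableUnder H iH
    iH-stable = ·-stableʳ (F i) subfield

    jH-stable : StableUnder H jH
    jH-stable = ·-stableʳ (F j) subfield

    i⊆iH : F i ⊆ iH
    i⊆iH = ·-inˡ (F i) H (unit subfield)

    j⊆jH : F j ⊆ jH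
    j⊆jH = ·-inˡ (F j) H (unit subfield)

    1≤h : 1 ≤ h
    1≤h = dim-pos dim-H (unit subfield)

    hv≤k : h * v ≤ suc (toℕ k)
    hv≤k = dim-mono (dim-F k) dim-P P⊆

    1≤r : 1 ≤ r
    1≤r = *-pos h r (dim-pos dim-iH (i⊆iH (ε∈F i)))

    1≤s : 1 ≤ s
    1≤s = *-pos h s (dim-pos dim-jH (j⊆jH (ε∈F j)))

  swap : ∀ {i j k} → Stabilized i j k → Stabilized j i k
  swap {i} {j} C = record
    { H = H ; subfield = subfield
    ; stable-P = λ x∈ h∈ → ·-comm (F i) (F j) (stable-P (·-comm (F j) (F i) x∈) h∈)
    ; exact = λ e → exact λ z∈ → ·-comm (F j) (F i) (e (·-comm (F i) (F j) z∈))
    ; dim-H = dim-H ; dim-iH = dim-jH ; dim-jH = dim-iH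
    ; dim-P = dim-≐ (·-comm (F i) (F j) , ·-comm (F j) (F i)) dim-P
    ; kneser≤ = ≤-trans (≤-reflexive (+-comm s r)) kneser≤
    ; P⊆ = λ m → P⊆ (·-comm (F j) (F i) m)
    }
    where open Stabilized C

  stabilized : ∀ {i j k} → F i · F j ⊆ F k → ¬ ¬ Stabilized i j k
  stabilized {i} {j} {k} P⊆ c =
    dim H λ (h , DH) → dim (F i · H) λ (a , Da) → dim (F j · H) λ (b , Db) → dim (F i · F j) λ (w , Dw) →
      finish DH Da Db Dw (subfield-∣ fH (·-stableʳ (F i) fH) DH Da) (subfield-∣ fH (·-stableʳ (F j) fH) DH Db)
        (subfield-∣ fH P-stable DH Dw) (kneser-stab {F i} {F j} (ε∈F i) (ε∈F j) Da Db Dw DH)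
    where
    H : Sub
    H = stab (F i · F j)
    fH : Subfield H
    fH = stab-subfield (F i · F j)
    P-stable : StableUnder H (F i · F j)
    P-stable x∈ h∈ = h∈ _ x∈
    finish : ∀ {h a b w} → Dim H h → Dim (F i · H) a → Dim (F j · H) b → Dim (F i · F j) w →
      h ∣ a → h ∣ b → h ∣ w → a + b ≤ w + h → ⊥
    finish {h} DH Da Db Dw (divides r refl) (divides s refl) (divides v refl) le = c record
      { H = H ; subfield = fH ; stable-P = P-stable ; exact = λ e z z∈ → e z∈
      ; dim-H = DH
      ; dim-iH = subst (Dim _) (*-comm r h) Da ; dim-jH = subst (Dim _) (*-comm s h) Db
      ; dim-P = subst (Dim _) (*-comm v h) Dw
      ; kneser≤ = cancel (dim-pos DH (unit fH)) (≤-trans (≤-reflexive (*-distribʳ-+ h r s)) le)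
      ; P⊆ = P⊆ }
      where
      cancel : ∀ {h x v} → 1 ≤ h → x * h ≤ v * h + h → x ≤ suc v
      cancel {suc h} {x} {v} _ le = *-cancelʳ-≤ x (suc v) (suc h) (≤-trans le (≤-reflexive (+-comm (v * suc h) (suc h))))

  -- F k is smaller than the trivial subgroups 1 and G allow in Kneser's theorem: k < i + j and k < n − 1.
  record Critical (i j k : Fin n) : Set (lsuc (c ⊔ ℓ ⊔ p)) where
    field
      stabilizedBy : Stabilized i j k
      excess       : toℕ k < toℕ i + toℕ j
      k-proper     : suc (toℕ k) < n
    open Stabilized stabilizedBy public

    hv<n : h * v < n
    hv<n = ≤-trans (s≤s hv≤k) k-proper

  critical-swap : ∀ {i j k} → Critical i j k → Critical j i k
  critical-swap {i} {j} C = record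
    { stabilizedBy = swap stabilizedBy ; k-proper = k-proper
    ; excess = ≤-trans excess (≤-reflexive (+-comm (toℕ i) (toℕ j))) }
    where open Critical C

  module Coprime {i j k i′ j′ k′} (C : Critical i j k) (C′ : Critical i′ j′ k′) where
    open Critical C
    open module C′ = Critical C′ using () renaming (H to H′; h to h′; r to r′; s to s′; v to v′)

    module _ (hh′ : h * h′ ≡ n) (lcm≥n : ∀ {x} → h ∣ x → h′ ∣ x → 1 ≤ x → n ≤ x)
             (j≤i : toℕ j ≤ toℕ i) (j′≤i′ : toℕ j′ ≤ toℕ i′) (i≤i′ : toℕ i ≤ toℕ i′) where

      private
        bistable : ∀ {X x w} → StableUnder H X → StableUnder H′ X → w ∈ X → Dim X x → n ≤ x
        bistable XH XH′ w∈ D =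
          lcm≥n (subfield-∣ subfield XH dim-H D) (subfield-∣ C′.subfield XH′ C′.dim-H D) (dim-pos D w∈)

        bound : ∀ {A Z W a r z} → A ⊆ Z → A ⊆ W → StableUnder H Z → StableUnder H′ W →
          Dim A a → Dim Z (h * z) → Dim W (h′ * r) → a ≤ r * z
        bound = rank-bound subfield C′.subfield dim-H C′.dim-H hh′ bistable

        v<h′ : v < h′
        v<h′ = *-cancelˡ-< h v h′ (subst (h * v <_) (sym hh′) hv<n)

        v′<h : v′ < h
        v′<h = *-cancelˡ-< h′ v′ h (subst (h′ * v′ <_) (trans (sym hh′) (*-comm h h′)) C′.hv<n)

        rs≤h : r′ + s′ ≤ h
        rs≤h = ≤-trans C′.kneser≤ v′<h

        i-bound : suc (toℕ i) ≤ r′ * r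
        i-bound = bound i⊆iH (λ m → C′.i⊆iH (F-mono i i′ i≤i′ m)) iH-stable C′.iH-stable (dim-F i) dim-iH C′.dim-iH

      conflict : ⊥
      conflict with ≤-total (toℕ j) (toℕ j′)
      -- With i + 1 ≤ r′r, j + 1 ≤ s′s and r′ + s′ ≤ h, Kneser gives i + j + 2 ≤ hv ≤ k + 1, against
      -- k < i + j.
      ... | inj₁ j≤j′ = n≮0 (arith (toℕ i) (toℕ j) (toℕ k) r s v r′ s′ h i-bound
              (bound j⊆jH (λ m → C′.j⊆jH (F-mono j j′ j≤j′ m)) jH-stable C′.jH-stable (dim-F j) dim-jH C′.dim-jH)
              (rearrange (≤-trans (m≤m+n r′ s′) rs≤h) 1≤r) (rearrange (≤-trans (m≤n+m s′ r′) rs≤h) 1≤s)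
              (*-monoʳ-≤ h kneser≤) hv≤k excess rs≤h)
        where
        arith : ∀ i j k r s v r′ s′ h → suc i ≤ r′ * r → suc j ≤ s′ * s → r′ * r + h ≤ h * r + r′ →
          s′ * s + h ≤ h * s + s′ → h * (r + s) ≤ h * suc v → h * v ≤ suc k → k < i + j → r′ + s′ ≤ h → 2 ≤ 0
        arith i j k r s v r′ s′ h h₁ h₂ h₃ h₄ h₅ h₆ h₇ h₈ =
          linear (r′ * r + s′ * s + h * (r + s) + h * suc v + suc k + r′ + s′ + i + j + h)
            (h₁ ⊞ h₂ ⊞ h₃ ⊞ h₄ ⊞ h₅ ⊞ h₆ ⊞ h₇ ⊞ h₈)
            (solve (i ∷ j ∷ k ∷ r ∷ s ∷ v ∷ r′ ∷ s′ ∷ h ∷ [])) (solve (i ∷ j ∷ k ∷ r ∷ s ∷ v ∷ r′ ∷ s′ ∷ h ∷ []))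
      ... | inj₂ j′≤j with ≤-total (toℕ k) (toℕ i′)
      -- PH′ is stable under H and H′, hence everything; but it lies in F i′ · H′, whose rank r′
      -- over H′ is less than h.
      ...   | inj₁ k≤i′ = dim (P · H′) λ (x , Dx) →
                <⇒≱ (≤-trans (m<m+n r′ C′.1≤s) rs≤h) (*-cancelˡ-≤ h′ {{>-nonZero C′.1≤h}} (≤-trans (≤-reflexive (trans (*-comm h′ h) hh′))
                  (≤-trans (bistable (·-stable H P H′ stable-P) (·-stableʳ P C′.subfield)
                              (·-inˡ P H′ (unit C′.subfield) ε∈P) Dx)
                    (dim-mono C′.dim-iH Dx (·-mono P H′ (F i′) H′ (λ m → F-mono k i′ k≤i′ (P⊆ m)) id)))))
      -- F k contains F i′ and P, whose meet has dimension at most r′v. So i′ ≤ k - (h - r′)v ≤ k -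
      -- v, which makes i′ + j′ too small for Kneser's bound on the second pair.
      ...   | inj₂ i′≤k = dim-∨∧ (dim-F i′) dim-P λ (a , b , Da , Db , eq) →
                n≮0 (arith (toℕ i) (toℕ j) (toℕ k) (toℕ i′) (toℕ j′) (toℕ k′) r s v r′ s′ v′ h h′ i-bound
                  (bound j⊆jH (λ m → C′.i⊆iH (F-mono j i′ (≤-trans j≤i i≤i′) m)) jH-stable C′.iH-stable (dim-F j) dim-jH C′.dim-iH)
                  (bound (λ m → j⊆jH (F-mono j′ j j′≤j m)) C′.j⊆jH jH-stable C′.jH-stable (dim-F j′) dim-jH C′.dim-jH)
                  C′.excess C′.hv≤k (*-monoʳ-≤ h′ C′.kneser≤) excess
                  (≤-trans (≥≡ eq) (dim-mono (dim-F k) Da (∨-⊆ (F i′) P (F k) (F-mono i′ k i′≤k) P⊆)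
                    ⊞ bound proj₂ (λ m → C′.i⊆iH (proj₁ m)) stable-P C′.iH-stable Db dim-P C′.dim-iH))
                  (*-monoˡ-≤ v (≤-trans (m<m+n r′ C′.1≤s) rs≤h))
                  (*-monoʳ-≤ r′ (≤-trans kneser≤ v<h′))
                  (rearrange (≤-trans (≤-trans (m≤n+m s r) kneser≤) v<h′) C′.1≤s) kneser≤ 1≤r)
        where
        arith : ∀ i j k i′ j′ k′ r s v r′ s′ v′ h h′ → suc i ≤ r′ * r → suc j ≤ r′ * s → suc j′ ≤ s′ * s →
          k′ < i′ + j′ → h′ * v′ ≤ suc k′ → h′ * (r′ + s′) ≤ h′ * suc v′ → k < i + j →
          suc i′ + h * v ≤ suc k + r′ * v → suc r′ * v ≤ h * v → r′ * (r + s) ≤ r′ * h′ →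
          s * s′ + h′ ≤ h′ * s′ + s → r + s ≤ suc v → 1 ≤ r → 4 ≤ 0
        arith i j k i′ j′ k′ r s v r′ s′ v′ h h′ h₁ h₂ h₃ h₄ h₅ h₆ h₇ h₈ h₉ h₁₀ h₁₁ h₁₂ h₁₃ =
          linear (r′ * (r + s) + r′ * h′ + s′ * s + i + j + k + i′ + j′ + k′ + h′ * v′ + h′ * s′ + h * v + r′ * v
                   + r + s + v + h′ + 3)
            (h₁ ⊞ h₂ ⊞ h₃ ⊞ h₄ ⊞ h₅ ⊞ h₆ ⊞ h₇ ⊞ h₈ ⊞ h₉ ⊞ h₁₀ ⊞ h₁₁ ⊞ h₁₂ ⊞ h₁₃)
            (solve (i ∷ j ∷ k ∷ i′ ∷ j′ ∷ k′ ∷ r ∷ s ∷ v ∷ r′ ∷ s′ ∷ v′ ∷ h ∷ h′ ∷ []))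
            (solve (i ∷ j ∷ k ∷ i′ ∷ j′ ∷ k′ ∷ r ∷ s ∷ v ∷ r′ ∷ s′ ∷ v′ ∷ h ∷ h′ ∷ []))

half-≤ : ∀ m a b → m + m ≤ suc (a + b) → b ≤ a → m ≤ a
half-≤ m a b le b≤a = ≮⇒≥ λ a<m → 1+n≰n (≤-trans (≤-reflexive (cong suc (sym (+-suc a b))))
  (≤-trans (a<m ⊞ ≤-trans (s≤s b≤a) a<m) le))

lcm-bound : ∀ a b {x} → a ∣ x → b ∣ x → 1 ≤ x → lcm a b ≤ x
lcm-bound a b {suc x} a∣x b∣x _ = ∣⇒≤ (lcm-least a∣x b∣x)

-- Degree twelve: orders 6 and 4, and orders 3 and 2

module Twelve {c ℓ p : Level} {geometry : Geometry c ℓ p} (frame : Frame geometry 12)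
  (F : Fin 12 → Subspaces.Sub geometry)
  (dim-F : ∀ i → Subspaces.Dim geometry (F i) (suc (toℕ i)))
  (F-mono : ∀ i j → toℕ i ≤ toℕ j → Subspaces._⊆_ geometry (F i) (F j))
  (ε∈F : ∀ i → Subspaces._∈_ geometry (Geometry.ε geometry) (F i)) where
  open Geometry geometry
  open Subspaces geometry
  open Products geometry
  open Duality frame
  open Isoperimetry frame
  open Subfield
  open Stabilizers frame
  open Flags frame F dim-F F-mono ε∈F

  module Order {i j k m} (C : Critical i j k) (h≡m : Critical.h C ≡ m) where
    open Critical C
    dH : Dim H m
    dH = subst (Dim H) h≡m dim-H
    diH : Dim iH (m * r)
    diH = subst (λ t → Dim iH (t * r)) h≡m dim-iH
    djH : Dim jH (m * s)
    djH = subst (λ t → Dim jH (t * s)) h≡m dim-jH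
    dP : Dim P (m * v)
    dP = subst (λ t → Dim P (t * v)) h≡m dim-P
    mv<12 : m * v < 12
    mv<12 = subst (λ t → t * v < 12) h≡m hv<n
    mv≤k : m * v ≤ suc (toℕ k)
    mv≤k = subst (λ t → t * v ≤ suc (toℕ k)) h≡m hv≤k
    1≤v : 1 ≤ v
    1≤v = *-pos m v (dim-pos dP ε∈P)
    i≤ : suc (toℕ i) ≤ m * r
    i≤ = dim-mono diH (dim-F i) i⊆iH
    j≤ : suc (toℕ j) ≤ m * s
    j≤ = dim-mono djH (dim-F j) j⊆jH
    H⊆iH : H ⊆ iH
    H⊆iH h∈ = ∈-resp iH (identityˡ _) (·-in (F i) H (ε∈F i) h∈)
    H⊆jH : H ⊆ jH
    H⊆jH h∈ = ∈-resp jH (identityˡ _) (·-in (F j) H (ε∈F j) h∈)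
    i⊆H : r ≤ 1 → F i ⊆ H
    i⊆H r≤1 m∈ = dim-≥⇒⊆ dH diH H⊆iH (≤-trans (*-monoʳ-≤ m r≤1) (≤-reflexive (*-identityʳ m))) (i⊆iH m∈)
    j⊆H : s ≤ 1 → F j ⊆ H
    j⊆H s≤1 m∈ = dim-≥⇒⊆ dH djH H⊆jH (≤-trans (*-monoʳ-≤ m s≤1) (≤-reflexive (*-identityʳ m))) (j⊆jH m∈)
    i-full : m * r ≤ suc (toℕ i) → iH ⊆ F i
    i-full = dim-≥⇒⊆ (dim-F i) diH i⊆iH
    j-full : m * s ≤ suc (toℕ j) → jH ⊆ F j
    j-full = dim-≥⇒⊆ (dim-F j) djH j⊆jH

  bistable-∣ : ∀ {i j k i′ j′ k′} (C : Critical i j k) (C′ : Critical i′ j′ k′) → ∀ {X x w} →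
    StableUnder (Critical.H C) X → StableUnder (Critical.H C′) X → w ∈ X → Dim X x →
    Critical.h C ∣ x × Critical.h C′ ∣ x × 1 ≤ x
  bistable-∣ C C′ XH XH′ w∈ D =
      subfield-∣ (Critical.subfield C) XH (Critical.dim-H C) D
    , subfield-∣ (Critical.subfield C′) XH′ (Critical.dim-H C′) D , dim-pos D w∈

  private
    -- Order 6 forces v = r = 1, so F i ⊆ H, and a flag member inside H′ lies in H ∧ H′, of
    -- dimension at most 2. If v′ = 1, this makes i′ and j′ at most 1, too small. If v′ = 2, F i′
    -- contains H, and F i′ · H′, of dimension at most 8, contains HH′, whose dimension is a
    -- multiple of 12.
    six-four-core : ∀ {i j k i′ j′ k′} (C : Critical i j k) (C′ : Critical i′ j′ k′) →
      Critical.h C ≡ 6 → Critical.h C′ ≡ 4 → toℕ j ≤ toℕ i → Critical.s C′ ≤ 1 → ⊥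
    six-four-core {i} {j} {k} {i′} {j′} {k′} C C′ h≡6 h′≡4 j≤i s′≤1 =
        dim (H ∧ H′) λ (d , Dd) → with-d (meet≤2 (subfield-∣ fD (λ x∈ (h∈ , _) → mult subfield x∈ h∈) Dd O.dH)
                                                 (subfield-∣ fD (λ x∈ (_ , h∈) → mult C′.subfield x∈ h∈) Dd O′.dH)) Dd
      where
      open Critical C
      open module C′ = Critical C′ using () renaming (H to H′; r to r′; s to s′; v to v′)
      open module O = Order C h≡6 using ()
      open module O′ = Order C′ h′≡4 using ()
      fD : Subfield (H ∧ H′)
      fD = record { unit = unit subfield , unit C′.subfield
                  ; mult = λ (a , b) (a′ , b′) → mult subfield a a′ , mult C′.subfield b b′ }
      meet≤2 : ∀ {d} → d ∣ 6 → d ∣ 4 → d ≤ 2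
      meet≤2 d∣6 d∣4 = ∣⇒≤ (∣m+n∣m⇒∣n {m = 4} d∣6 d∣4)
      v≤1 : v ≤ 1
      v≤1 = ≤-pred (*-cancelˡ-< 6 v 2 O.mv<12)
      r≤1 : r ≤ 1
      r≤1 = +-cancelʳ-≤ 1 r 1 (≤-trans (+-monoʳ-≤ r 1≤s) (≤-trans kneser≤ (s≤s v≤1)))
      i⊆H : F i ⊆ H
      i⊆H = O.i⊆H r≤1
      6≤k : 6 ≤ suc (toℕ k)
      6≤k = ≤-trans (*-monoʳ-≤ 6 O.1≤v) O.mv≤k
      3≤i : 3 ≤ toℕ i
      3≤i = half-≤ 3 (toℕ i) (toℕ j) (m≤n⇒m≤1+n (≤-trans 6≤k excess)) j≤i
      suc-i≤6 : suc (toℕ i) ≤ 6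
      suc-i≤6 = dim-mono O.dH (dim-F i) i⊆H
      j′⊆H′ : F j′ ⊆ H′
      j′⊆H′ = O′.j⊆H s′≤1
      in-both : ∀ {d} → d ≤ 2 → Dim (H ∧ H′) d → ∀ x → F x ⊆ H′ → toℕ x ≤ 1
      in-both d≤2 Dd x x⊆H′ = ≤-pred (≤-trans (dim-mono Dd (dim-F x)
        (λ m → i⊆H (F-mono x i (≤-trans (≤-pred (dim-mono O′.dH (dim-F x) x⊆H′)) 3≤i) m) , x⊆H′ m)) d≤2)
      with-d : ∀ {d} → d ≤ 2 → Dim (H ∧ H′) d → ⊥
      with-d d≤2 Dd with v′ ≤? 1
      ... | yes v′≤1 = <⇒≱ (≤-trans (s≤s (in-both d≤2 Dd i′ (O′.i⊆H r′≤1) ⊞ j′≤1)) (from-yes (3 ≤? 4)))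
              (≤-trans (*-monoʳ-≤ 4 O′.1≤v) (≤-trans O′.mv≤k C′.excess))
        where
        j′≤1 = in-both d≤2 Dd j′ j′⊆H′
        r′≤1 : r′ ≤ 1
        r′≤1 = +-cancelʳ-≤ 1 r′ 1 (≤-trans (+-monoʳ-≤ r′ C′.1≤s) (≤-trans C′.kneser≤ (s≤s v′≤1)))
      ... | no v′≰1 = H⊆i′⇒⊥ (H⊆i′ (≤-<-connex (toℕ k) (toℕ i′)))
        where
        j′≤1 = in-both d≤2 Dd j′ j′⊆H′
        8≤i′+1 : 8 ≤ suc (toℕ i′)
        8≤i′+1 = ≤-trans (*-monoʳ-≤ 4 (≰⇒> v′≰1)) (≤-trans O′.mv≤k (≤-trans C′.excess
          (≤-trans (+-monoʳ-≤ (toℕ i′) j′≤1) (≤-reflexive (+-comm (toℕ i′) 1)))))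
        r′≤2 : r′ ≤ 2
        r′≤2 = +-cancelʳ-≤ 1 r′ 2 (≤-trans (+-monoʳ-≤ r′ C′.1≤s) (≤-trans C′.kneser≤ (*-cancelˡ-< 4 v′ 3 O′.mv<12)))
        H⊆i′⇒⊥ : H ⊆ F i′ → ⊥
        H⊆i′⇒⊥ H⊆ = dim (H · H′) λ (x , Dx) →
          let (6∣x , 4∣x , 1≤x) = bistable-∣ C C′ (·-stable H H H′ (mult subfield)) (·-stableʳ H C′.subfield)
                                    (·-in H H′ (unit subfield) (unit C′.subfield)) Dx
          in <⇒≱ (s≤s (≤-trans (dim-mono O′.diH Dx (·-mono H H′ (F i′) H′ H⊆ id)) (*-monoʳ-≤ 4 r′≤2)))
               (≤-trans (from-yes (9 ≤? 12)) (lcm-bound 6 4 (subst (_∣ x) h≡6 6∣x) (subst (_∣ x) h′≡4 4∣x) 1≤x))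
        H⊆i′ : toℕ k ≤ toℕ i′ ⊎ toℕ i′ < toℕ k → H ⊆ F i′
        H⊆i′ (inj₁ k≤i′) m∈ = F-mono k i′ k≤i′ (P⊆ (H⊆P m∈))
        -- Here k ≥ 8, so i + j ≥ 9 and i ≥ 5; thus F i is all of H.
        H⊆i′ (inj₂ i′<k) m∈ = F-mono i i′ (≤-trans (≤-pred suc-i≤6) (≤-trans (from-yes (5 ≤? 7)) (≤-pred 8≤i′+1)))
          (dim-≥⇒⊆ (dim-F i) O.dH i⊆H
            (s≤s (half-≤ 5 (toℕ i) (toℕ j) (s≤s (≤-trans (s≤s (≤-trans 8≤i′+1 i′<k)) excess)) j≤i)) m∈)

  six-four : ∀ {i j k i′ j′ k′} (C : Critical i j k) (C′ : Critical i′ j′ k′) →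
    Critical.h C ≡ 6 → Critical.h C′ ≡ 4 → ⊥
  six-four {i} {j} C C′ h≡6 h′≡4 with Critical.s C′ ≤? 1 | ≤-total (toℕ j) (toℕ i)
  ... | yes s′≤1 | inj₁ j≤i = six-four-core C C′ h≡6 h′≡4 j≤i s′≤1
  ... | yes s′≤1 | inj₂ i≤j = six-four-core (critical-swap C) C′ h≡6 h′≡4 i≤j s′≤1
  ... | no s′≰1 | j∼i = oriented j∼i
    where
    r′≤1 : Critical.r C′ ≤ 1
    r′≤1 = +-cancelʳ-≤ 2 _ 1 (≤-trans (+-monoʳ-≤ _ (≰⇒> s′≰1)) (≤-trans (Critical.kneser≤ C′)
      (*-cancelˡ-< 4 _ 3 (Order.mv<12 C′ h′≡4))))
    oriented : toℕ j ≤ toℕ i ⊎ toℕ i ≤ toℕ j → ⊥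
    oriented (inj₁ j≤i) = six-four-core C (critical-swap C′) h≡6 h′≡4 j≤i r′≤1
    oriented (inj₂ i≤j) = six-four-core (critical-swap C) (critical-swap C′) h≡6 h′≡4 i≤j r′≤1

  private
    module ThreeTwo {i j k i′ j′ k′} (C : Critical i j k) (C′ : Critical i′ j′ k′)
        (h≡3 : Critical.h C ≡ 3) (h′≡2 : Critical.h C′ ≡ 2)
        (full : 3 * Critical.r C ≤ suc (toℕ i)) (j′≤i′ : toℕ j′ ≤ toℕ i′) where
      open Critical C
      open module C′ = Critical C′ using () renaming (H to H′; r to r′; s to s′; v to v′; P to P′)
      open module O = Order C h≡3 using ()
      open module O′ = Order C′ h′≡2 using ()

      v≤3 : v ≤ 3
      v≤3 = ≤-pred (*-cancelˡ-< 3 v 4 O.mv<12)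

      v′≤5 : v′ ≤ 5
      v′≤5 = ≤-pred (*-cancelˡ-< 2 v′ 6 O′.mv<12)

      i-stable : StableUnder H (F i)
      i-stable m h∈ = O.i-full full (iH-stable (i⊆iH m) h∈)

      private
        sum : ∀ r s v i j k → 2 * r + 2 * s ≤ 2 * suc v → 2 * v ≤ suc k → k < i + j →
          2 * r + 2 * s ≤ suc i + suc j
        sum r s v i j k h₁ h₂ h₃ = linear (2 * v + suc k) (h₁ ⊞ h₂ ⊞ h₃)
          (solve (r ∷ s ∷ v ∷ i ∷ j ∷ k ∷ [])) (solve (r ∷ s ∷ v ∷ i ∷ j ∷ k ∷ []))

      -- For order 2 Kneser's bound and k′ < i′ + j′ leave no slack: F j′ must fill F j′ · H′ and is
      -- therefore stable under H′.
      total : 2 * r′ + 2 * s′ ≤ suc (toℕ i′) + suc (toℕ j′)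
      total = sum r′ s′ v′ (toℕ i′) (toℕ j′) (toℕ k′)
        (≤-trans (≤-reflexive (sym (*-distribˡ-+ 2 r′ s′))) (*-monoʳ-≤ 2 C′.kneser≤)) O′.mv≤k C′.excess

      j′-full : 2 * s′ ≤ suc (toℕ j′)
      j′-full = +-cancelˡ-≤ (2 * r′) _ _ (≤-trans total (+-monoˡ-≤ _ O′.i≤))

      k′-full : suc (toℕ k′) ≤ 2 * v′
      k′-full = arith r′ s′ v′ (toℕ i′) (toℕ j′) (toℕ k′) C′.excess O′.i≤ O′.j≤ C′.kneser≤
        where
        arith : ∀ r s v i j k → k < i + j → suc i ≤ 2 * r → suc j ≤ 2 * s → r + s ≤ suc v → suc k ≤ 2 * v
        arith r s v i j k h₁ h₂ h₃ h₄ = linear (i + j + 2 * r + 2 * s + 2) (h₁ ⊞ h₂ ⊞ h₃ ⊞ h₄ ⊞ h₄)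
          (solve (r ∷ s ∷ v ∷ i ∷ j ∷ k ∷ [])) (solve (r ∷ s ∷ v ∷ i ∷ j ∷ k ∷ []))

      v′<r′+s′ : suc v′ ≤ r′ + s′
      v′<r′+s′ = arith r′ s′ v′ (toℕ i′) (toℕ j′) (toℕ k′) C′.excess O′.i≤ O′.j≤ O′.mv≤k
        where
        arith : ∀ r s v i j k → k < i + j → suc i ≤ 2 * r → suc j ≤ 2 * s → 2 * v ≤ suc k → suc v ≤ r + s
        arith r s v i j k h₁ h₂ h₃ h₄ = *-cancelˡ-≤ 2 (linear (i + j + k + 1) (h₁ ⊞ h₂ ⊞ h₃ ⊞ h₄)
          (solve (r ∷ s ∷ v ∷ i ∷ j ∷ k ∷ [])) (solve (r ∷ s ∷ v ∷ i ∷ j ∷ k ∷ [])))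

      j′-stable : StableUnder H′ (F j′)
      j′-stable m h∈ = O′.j-full j′-full (C′.jH-stable (C′.j⊆jH m) h∈)

      ⊇unit : ∀ M X → StableUnder M X → ε ∈ X → M ⊆ X
      ⊇unit M X XM ε∈X m∈ = ∈-resp X (identityˡ _) (XM ε∈X m∈)

      2∤3 : ∀ {M} → Subfield M → Dim M 2 → StableUnder M H → ⊥
      2∤3 fM DM HM = from-no (2 ∣? 3) (subfield-∣ fM HM DM O.dH)

      H′⊈H : ¬ (H′ ⊆ H)
      H′⊈H H′⊆H = 2∤3 C′.subfield O′.dH (λ x∈ h∈ → mult subfield x∈ (H′⊆H h∈))

      six∣ : ∀ {X x w} → StableUnder H X → StableUnder H′ X → w ∈ X → Dim X x → 6 ∣ x
      six∣ {x = x} XH XH′ w∈ D =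
        let (a , b , _) = bistable-∣ C C′ XH XH′ w∈ D
        in lcm-least {3} {2} (subst (_∣ x) h≡3 a) (subst (_∣ x) h′≡2 b)

      six≤ : ∀ {X x w} → StableUnder H X → StableUnder H′ X → w ∈ X → Dim X x → 6 ≤ x
      six≤ {x = zero} XH XH′ w∈ D = ⊥-elim (n≮0 (dim-pos D w∈))
      six≤ {x = suc x} XH XH′ w∈ D = ∣⇒≤ (six∣ XH XH′ w∈ D)

      D : Sub
      D = H · H′

      ε∈D : ε ∈ D
      ε∈D = ·-inˡ H H′ (unit C′.subfield) (unit subfield)

      D-stableH : StableUnder H D
      D-stableH = ·-stable H H H′ (mult subfield)

      D-stableH′ : StableUnder H′ D
      D-stableH′ = ·-stableʳ H C′.subfield

      D-⊆ : ∀ X → StableUnder H′ X → H ⊆ X → D ⊆ X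
      D-⊆ X XH′ H⊆X = ·-⊆ H H′ X λ h∈ g∈ → XH′ (H⊆X h∈) g∈

      fD : Subfield D
      fD = record { unit = ε∈D ; mult = λ {x} x∈ y∈ → ·-⊆ H H′ (x ▸ D)
        (λ h∈ g∈ → ∈-resp D (assoc _ _ _) (D-stableH′ (D-stableH x∈ h∈) g∈)) y∈ }

      D-6≤ : ∀ {d} → Dim D d → 6 ≤ d
      D-6≤ = six≤ D-stableH D-stableH′ ε∈D

      -- Otherwise D ⊆ F j′, and v′ ≤ 5 forces r′ = s′ = 3. Then F i′ and F j′ lie in D, so P′ has
      -- dimension at most 6, while Kneser demands 10.
      H⊈j′ : ¬ (H ⊆ F j′)
      H⊈j′ H⊆j′ = dim D λ (d , Dd) →
        let D⊆j′ = D-⊆ (F j′) j′-stable H⊆j′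
            6≤j′ = ≤-trans (D-6≤ Dd) (dim-mono (dim-F j′) Dd D⊆j′)
            3≤s′ = *-cancelˡ-≤ 2 (≤-trans 6≤j′ O′.j≤)
            3≤r′ = *-cancelˡ-≤ 2 (≤-trans (≤-trans 6≤j′ (s≤s j′≤i′)) O′.i≤)
            rs≤6 : r′ + s′ ≤ 6
            rs≤6 = ≤-trans C′.kneser≤ (s≤s v′≤5)
            s′≤3 : s′ ≤ 3
            s′≤3 = +-cancelˡ-≤ 3 s′ 3 (≤-trans (+-monoˡ-≤ s′ 3≤r′) rs≤6)
            r′≤3 : r′ ≤ 3
            r′≤3 = +-cancelʳ-≤ 3 r′ 3 (≤-trans (+-monoʳ-≤ r′ 3≤s′) rs≤6)
            i′⊆D : F i′ ⊆ D
            i′⊆D = dim-≥⇒⊆ Dd (dim-F i′) (λ m → F-mono j′ i′ j′≤i′ (D⊆j′ m)) (≤-trans (≤-trans O′.i≤ (*-monoʳ-≤ 2 r′≤3)) (D-6≤ Dd))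
            P′⊆D : P′ ⊆ D
            P′⊆D = ·-⊆ (F i′) (F j′) D λ a b → mult fD (i′⊆D a) (i′⊆D (F-mono j′ i′ j′≤i′ b))
        in <⇒≱ (≤-trans (from-yes (7 ≤? 10)) (*-monoʳ-≤ 2 (≤-pred (≤-trans (3≤r′ ⊞ 3≤s′) C′.kneser≤))))
             (≤-trans (dim-mono Dd O′.dP P′⊆D) (≤-trans (dim-mono (dim-F j′) Dd D⊆j′) (≤-trans O′.j≤ (*-monoʳ-≤ 2 s′≤3))))

      j′⊆i : F j′ ⊆ F i
      j′⊆i with ≤-total (toℕ i) (toℕ j′)
      ... | inj₁ i≤j′ = ⊥-elim (H⊈j′ λ h∈ → F-mono i j′ i≤j′ (⊇unit H (F i) i-stable (ε∈F i) h∈))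
      ... | inj₂ j′≤i = F-mono j′ i j′≤i

      D⊆i : D ⊆ F i
      D⊆i = ·-⊆ H H′ (F i) λ h∈ g∈ → ∈-resp (F i) (comm _ _) (i-stable (j′⊆i (⊇unit H′ (F j′) j′-stable (ε∈F j′) g∈)) h∈)

      -- F i · H′ has dimension divisible by 6 and at least 9, hence 12, and it lies in Q.
      ⊇i : ∀ {Q q} → StableUnder H′ Q → F i ⊆ Q → 9 ≤ suc (toℕ i) → Dim Q q → 12 ≤ q
      ⊇i {Q} QH′ i⊆Q 9≤i DQ = ≤-stable λ c → dim (F i · H′) λ (x , Dx) →
        c (≤-trans (twelve (six∣ (·-stable H (F i) H′ i-stable) (·-stableʳ (F i) C′.subfield)
                              (·-inˡ (F i) H′ (unit C′.subfield) (ε∈F i)) Dx)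
                     (≤-trans 9≤i (dim-mono Dx (dim-F i) (·-inˡ (F i) H′ (unit C′.subfield)))))
             (dim-mono DQ Dx (·-⊆ (F i) H′ Q λ a b → QH′ (i⊆Q a) b)))
        where
        twelve : ∀ {x} → 6 ∣ x → 9 ≤ x → 12 ≤ x
        twelve (divides zero refl) ()
        twelve (divides (suc zero) refl) 9≤6 = ⊥-elim (from-no (9 ≤? 6) 9≤6)
        twelve (divides (suc (suc q)) refl) _ = m≤m+n 12 (q * 6)

      conflict : ⊥
      conflict with r ≤? 2
      -- F i equals D, so P is stable under H′ as well, and `exact` would put H′ inside H.
      ... | yes r≤2 = dim D λ (d , Dd) →
          let i⊆D : F i ⊆ D
              i⊆D = dim-≥⇒⊆ Dd (dim-F i) D⊆i (≤-trans (≤-trans O.i≤ (*-monoʳ-≤ 3 r≤2)) (D-6≤ Dd))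
              P-stable : StableUnder H′ P
              P-stable = ·-stable H′ (F i) (F j) λ m h∈ → D⊆i (D-stableH′ (i⊆D m) h∈)
          in H′⊈H λ h∈ → exact λ z∈ → P-stable z∈ h∈
      -- Now (r, s, v) = (3, 1, 3), F i has dimension 9 and F j ⊆ H. The bounds below force s′ = 2,
      -- with F j of dimension 2 and F j′ of dimension 4.
      ... | no r≰2 = H⊆P′⇒⊥ H⊆P′
        where
        3≤r : 3 ≤ r
        3≤r = ≰⇒> r≰2
        r+s≤4 : r + s ≤ 4
        r+s≤4 = ≤-trans kneser≤ (s≤s v≤3)
        s≤1 : s ≤ 1
        s≤1 = +-cancelˡ-≤ 3 s 1 (≤-trans (+-monoˡ-≤ s 3≤r) r+s≤4)
        r≤3 : r ≤ 3
        r≤3 = +-cancelʳ-≤ 1 r 3 (≤-trans (+-monoʳ-≤ r 1≤s) r+s≤4)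
        3≤v : 3 ≤ v
        3≤v = ≤-pred (≤-trans (3≤r ⊞ 1≤s) kneser≤)
        9≤i : 9 ≤ suc (toℕ i)
        9≤i = ≤-trans (*-monoʳ-≤ 3 3≤r) full
        i≤8 : toℕ i ≤ 8
        i≤8 = ≤-pred (≤-trans O.i≤ (*-monoʳ-≤ 3 r≤3))
        1≤j : 1 ≤ toℕ j
        1≤j = +-cancelˡ-≤ 8 1 (toℕ j) (≤-trans (≤-trans (*-monoʳ-≤ 3 3≤v) (≤-trans O.mv≤k excess)) (+-monoˡ-≤ (toℕ j) i≤8))
        j⊆H : F j ⊆ H
        j⊆H = O.j⊆H s≤1
        k′<i : toℕ k′ < toℕ i
        k′<i = ≰⇒> λ i≤k′ → <⇒≱ (*-monoʳ-< 2 (s≤s v′≤5)) (⊇i C′.stable-P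
          (λ m → dim-≥⇒⊆ O′.dP (dim-F k′) C′.P⊆ k′-full (F-mono i k′ i≤k′ m)) 9≤i O′.dP)
        v′≤4 : v′ ≤ 4
        v′≤4 = *-cancelˡ-≤ 2 (≤-trans O′.mv≤k (≤-trans k′<i i≤8))
        r′+s′≤5 : r′ + s′ ≤ 5
        r′+s′≤5 = ≤-trans C′.kneser≤ (s≤s v′≤4)
        j<j′ : toℕ j < toℕ j′
        j<j′ = ≰⇒> λ j′≤j → H′⊈H λ h∈ → j⊆H (F-mono j′ j j′≤j (⊇unit H′ (F j′) j′-stable (ε∈F j′) h∈))
        j⊆j′ : F j ⊆ F j′
        j⊆j′ = F-mono j j′ (<⇒≤ j<j′)
        2≤s′ : 2 ≤ s′
        2≤s′ = ≰⇒> λ s′≤1 → from-no (3 ≤? 2) (≤-trans (s≤s (≤-trans (s≤s 1≤j) j<j′)) (≤-trans O′.j≤ (*-monoʳ-≤ 2 s′≤1)))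
        s′≤r′ : s′ ≤ r′
        s′≤r′ = *-cancelˡ-≤ 2 (≤-trans j′-full (≤-trans (s≤s j′≤i′) O′.i≤))
        s′≤2 : s′ ≤ 2
        s′≤2 = ≮⇒≥ λ 3≤s′ → from-no (6 ≤? 5) (≤-trans (≤-trans 3≤s′ s′≤r′ ⊞ 3≤s′) r′+s′≤5)
        4≤j′ : 4 ≤ suc (toℕ j′)
        4≤j′ = ≤-trans (*-monoʳ-≤ 2 2≤s′) j′-full
        j′≤4 : suc (toℕ j′) ≤ 4
        j′≤4 = ≤-trans O′.j≤ (*-monoʳ-≤ 2 s′≤2)
        j≤1 : suc (toℕ j) ≤ 2
        j≤1 = ≮⇒≥ λ 3≤j → H⊈j′ λ h∈ → j⊆j′ (dim-≥⇒⊆ (dim-F j) O.dH j⊆H 3≤j h∈)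
        jH′⊆D : F j · H′ ⊆ D
        jH′⊆D = ·-mono (F j) H′ H H′ j⊆H id
        -- F j · H′ has even dimension. Dimension 2 would mean F j = H′, inside H; so it fills F j′.
        j′⊆D : F j′ ⊆ D
        j′⊆D {x} x∈ = stable D λ x∉ → dim (F j · H′) λ (y , Dy) →
          x∉ (jH′⊆D (dim-≥⇒⊆ Dy (dim-F j′) (·-⊆ (F j) H′ (F j′) (λ a b → j′-stable (j⊆j′ a) b))
            (≤-trans j′≤4 (four (subfield-∣ C′.subfield (·-stableʳ (F j) C′.subfield) O′.dH Dy) (≰⇒> λ y≤2 →
              H′⊈H λ h∈ → j⊆H (dim-≥⇒⊆ (dim-F j) O′.dH
                (λ m → dim-≥⇒⊆ O′.dH Dy (⊇unit H′ (F j · H′) (·-stableʳ (F j) C′.subfield) (·-inˡ (F j) H′ (unit C′.subfield) (ε∈F j)))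
                   y≤2 (·-inˡ (F j) H′ (unit C′.subfield) m))
                (s≤s 1≤j) h∈)))) x∈))
          where
          four : ∀ {x} → 2 ∣ x → 3 ≤ x → 4 ≤ x
          four (divides zero refl) ()
          four (divides (suc zero) refl) 3≤2 = ⊥-elim (from-no (3 ≤? 2) 3≤2)
          four (divides (suc (suc q)) refl) _ = m≤m+n 4 (q * 2)
        -- If F j · F j had dimension 2 it would equal F j, a subfield of order 2 inside H of order
        -- 3.
        H⊆jj : H ⊆ F j · F j
        H⊆jj {x} x∈ = stable (F j · F j) λ x∉ → dim (F j · F j) λ (y , Dy) →
          x∉ (dim-≥⇒⊆ Dy O.dH (·-⊆ (F j) (F j) H (λ a b → mult subfield (j⊆H a) (j⊆H b))) (≰⇒> λ y≤2 →
            let jj⊆j : F j · F j ⊆ F j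
                jj⊆j = dim-≥⇒⊆ (dim-F j) Dy (·-inˡ (F j) (F j) (ε∈F j)) (≤-trans y≤2 (s≤s 1≤j))
            in 2∤3 {F j} (record { unit = ε∈F j ; mult = λ a b → jj⊆j (·-in (F j) (F j) a b) })
                 (subst (Dim (F j)) (≤-antisym j≤1 (s≤s 1≤j)) (dim-F j))
                 (λ a b → mult subfield a (j⊆H b))) x∈)
        H⊆P′ : H ⊆ P′
        H⊆P′ m = ·-mono (F j) (F j) (F i′) (F j′) (λ a → F-mono j′ i′ j′≤i′ (j⊆j′ a)) j⊆j′ (H⊆jj m)
        H⊆P′⇒⊥ : H ⊆ P′ → ⊥
        H⊆P′⇒⊥ H⊆ = dim D λ (d , Dd) → by-size Dd (r′ ≤? 2)
          where
          D⊆P′ : D ⊆ P′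
          D⊆P′ = D-⊆ P′ C′.stable-P H⊆
          by-size : ∀ {d} → Dim D d → Dec (r′ ≤ 2) → ⊥
          -- P′ is then D, which is stable under H; `exact` would put H, of order 3, into H′, of
          -- order 2.
          by-size Dd (yes r′≤2) =
            let P′⊆D = dim-≥⇒⊆ Dd O′.dP D⊆P′ (≤-trans (*-monoʳ-≤ 2 (≤-pred (≤-trans v′<r′+s′ (r′≤2 ⊞ s′≤2)))) (D-6≤ Dd))
            in from-no (3 ≤? 2) (dim-mono O′.dH O.dH λ h∈ → C′.exact λ z∈ → D⊆P′ (D-stableH (P′⊆D z∈) h∈))
          -- Now P′ has dimension 8 and D has 6. For f ∈ F i′ outside D, the translate of F j′ by f
          -- lies in P′ and misses D because F j′ ⊆ D; but 6 + 4 > 8.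
          by-size {d} Dd (no r′≰2) = ¬⊆ λ (f , f∈ , f∉) →
              <⇒≱ (≤-trans (s≤s (*-monoʳ-≤ 2 v′≤4)) (≤-trans (from-yes (9 ≤? 10)) (D-6≤ Dd ⊞ 4≤j′)))
                (dim-disjoint Dd (◂-dim f (dim-F j′)) O′.dP D⊆P′
                  (λ z∈ → ∈-resp P′ (cancelʳ f _) (·-in (F i′) (F j′) f∈ z∈))
                  (λ z∈D z∈ → f∉ (∈-resp D (recover f _) (mult fD z∈D (inv fD (j′⊆D z∈))))))
            where
            recover : ∀ f z → z ∙ (f ⁻¹ ∙ z) ⁻¹ ≈ f
            recover f z = ≈-trans (∙-congʳ (≈-sym (cancelʳ f z))) (≈-trans (assoc _ _ _)
              (≈-trans (∙-congˡ (inverseʳ _)) (≈-trans (comm _ _) (identityˡ f))))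
            4≤v′ : 4 ≤ v′
            4≤v′ = ≤-pred (≤-trans (≰⇒> r′≰2 ⊞ 2≤s′) C′.kneser≤)
            d≤6 : d ≤ 6
            d≤6 = six (six∣ D-stableH D-stableH′ ε∈D Dd) (≤-trans (dim-mono O′.dP Dd D⊆P′) (*-monoʳ-≤ 2 v′≤4))
              where
              six : ∀ {x} → 6 ∣ x → x ≤ 8 → x ≤ 6
              six (divides zero refl) _ = z≤n
              six (divides (suc zero) refl) _ = ≤-refl
              six (divides (suc (suc q)) refl) le = ⊥-elim (from-no (12 ≤? 8) (≤-trans (m≤m+n 12 (q * 6)) le))
            ¬⊆ : ¬ ¬ ∃ λ f → f ∈ F i′ × f ∉ D
            ¬⊆ c = <⇒≱ (≤-trans (s≤s d≤6) (≤-trans (from-yes (7 ≤? 8)) (*-monoʳ-≤ 2 4≤v′)))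
              (dim-mono Dd O′.dP (·-⊆ (F i′) (F j′) D λ {a} a∈ b∈ → mult fD (stable D λ a∉ → c (a , a∈ , a∉)) (j′⊆D b∈)))

  -- For order 3 the count leaves a slack of one, so at least one of F i and F j is stable under H;
  -- swapping makes it F i.
  three-two : ∀ {i j k i′ j′ k′} (C : Critical i j k) (C′ : Critical i′ j′ k′) →
    Critical.h C ≡ 3 → Critical.h C′ ≡ 2 → ⊥
  three-two {i} {j} {k} {i′} {j′} C C′ h≡3 h′≡2 with 3 * Critical.r C ≤? suc (toℕ i)
  ... | yes full = orient full
    where
    orient : 3 * Critical.r C ≤ suc (toℕ i) → ⊥
    orient full with ≤-total (toℕ j′) (toℕ i′)
    ... | inj₁ j′≤i′ = ThreeTwo.conflict C C′ h≡3 h′≡2 full j′≤i′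
    ... | inj₂ i′≤j′ = ThreeTwo.conflict C (critical-swap C′) h≡3 h′≡2 full i′≤j′
  ... | no not-full = orient (arith r s v (toℕ i) (toℕ j) (toℕ k) (≰⇒> not-full) (*-monoʳ-≤ 3 kneser≤) (Order.mv≤k C h≡3) excess)
    where
    open Critical C
    arith : ∀ r s v i j k → suc i < 3 * r → 3 * (r + s) ≤ 3 * suc v → 3 * v ≤ suc k → k < i + j → 3 * s ≤ suc j
    arith r s v i j k h₁ h₂ h₃ h₄ = linear (i + 3 * r + 3 * v + k + 3) (h₁ ⊞ h₂ ⊞ h₃ ⊞ h₄)
      (solve (r ∷ s ∷ v ∷ i ∷ j ∷ k ∷ [])) (solve (r ∷ s ∷ v ∷ i ∷ j ∷ k ∷ []))
    orient : 3 * s ≤ suc (toℕ j) → ⊥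
    orient full with ≤-total (toℕ j′) (toℕ i′)
    ... | inj₁ j′≤i′ = ThreeTwo.conflict (critical-swap C) C′ h≡3 h′≡2 full j′≤i′
    ... | inj₂ i′≤j′ = ThreeTwo.conflict (critical-swap C) (critical-swap C′) h≡3 h′≡2 full i′≤j′

-- Tower types

maxUpTo-attained : ∀ f i → ∃ λ a → a ≤ i × maxUpTo f i ≡ f a
maxUpTo-attained f zero = 0 , z≤n , refl
maxUpTo-attained f (suc i) with ⊔-sel (f (suc i)) (maxUpTo f i) | maxUpTo-attained f i
... | inj₁ e | _             = suc i , ≤-refl , e
... | inj₂ e | a , a≤i , e′ = a , m≤n⇒m≤1+n a≤i , trans e e′

digit-≤ : ∀ p .{{_ : NonZero p}} a b t → t ≤ a / p + b / p → (a % p + b % p) % p + p * t ≤ a + b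
digit-≤ p a b t t≤ = ≤-trans (m%n≤m (a % p + b % p) p ⊞ *-monoʳ-≤ p t≤)
  (≤-reflexive (trans (regroup p (a % p) (b % p) (a / p) (b / p))
    (sym (cong₂ _+_ (m≡m%n+[m/n]*n a p) (m≡m%n+[m/n]*n b p)))))
  where
  regroup : ∀ p x y u v → x + y + p * (u + v) ≡ x + u * p + (y + v * p)
  regroup p x y u v = solve (p ∷ x ∷ y ∷ u ∷ v ∷ [])

digit-prefix : ∀ p .{{_ : NonZero p}} x t d rs → suc t + d ≤ d * rs → suc (x % p + p * t) + p * d ≤ p * d * rs
digit-prefix p x t d rs h = arith p (x % p) t d rs (m%n<n x p) (*-monoʳ-≤ p h)
  where
  arith : ∀ p x t d rs → x < p → p * (suc t + d) ≤ p * (d * rs) → suc (x + p * t) + p * d ≤ p * d * rs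
  arith p x t d rs h₁ h₂ = linear p (h₁ ⊞ h₂) (solve (p ∷ x ∷ t ∷ d ∷ rs ∷ [])) (solve (p ∷ x ∷ t ∷ d ∷ rs ∷ []))

quotient-< : ∀ p .{{_ : NonZero p}} d r {a} → a < p * d * r → a / p < d * r
quotient-< p d r lt = m<n*o⇒m/o<n (≤-trans lt (≤-reflexive (trans (*-assoc p d r) (*-comm p (d * r)))))

towerMul-≤ : ∀ ps a b → towerMul ps a b ≤ a + b
towerMul-≤ []           a b = z≤n
towerMul-≤ (zero ∷ ps)  a b = z≤n
towerMul-≤ (suc q ∷ ps) a b = digit-≤ (suc q) a b _ (towerMul-≤ ps (a / suc q) (b / suc q))

-- With d = `product ps`, the digits of the prefix wrap around below d, and the quotients by d, at
-- most r - 1 and s - 1, combine to at most r + s - 2. So the index is below d(r + s - 1).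
towerMul-prefix : ∀ ps qs {a b r s} → a < product ps * r → b < product ps * s →
  suc (towerMul (ps ++ qs) a b) + product ps ≤ product ps * (r + s)
towerMul-prefix [] qs {a} {b} {r} {s} a<r b<s = ≤-trans
  (s≤s (≤-trans (≤-reflexive (+-comm _ 1)) (s≤s (towerMul-≤ qs a b))))
  (≤-trans (≤-reflexive (cong suc (sym (+-suc a b))))
    (≤-trans (≤-trans a<r (≤-reflexive (*-identityˡ r)) ⊞ ≤-trans b<s (≤-reflexive (*-identityˡ s)))
      (≤-reflexive (sym (*-identityˡ (r + s))))))
towerMul-prefix (suc q ∷ ps) qs {a} {b} {r} {s} a< b< =
  digit-prefix (suc q) (a % suc q + b % suc q) _ (product ps) (r + s)
    (towerMul-prefix ps qs (quotient-< (suc q) (product ps) r a<) (quotient-< (suc q) (product ps) s b<))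

towerType-prefix : ∀ ps qs {i j r s} → i < product ps * r → j < product ps * s →
  suc (towerType (ps ++ qs) i j) + product ps ≤ product ps * (r + s)
towerType-prefix ps qs {i} {j} i< j< =
  let (a , a≤i , e)  = maxUpTo-attained (λ a → maxUpTo (λ b → towerMul (ps ++ qs) a b) j) i
      (b , b≤j , e′) = maxUpTo-attained (λ b → towerMul (ps ++ qs) a b) j
  in subst (λ t → suc t + product ps ≤ _) (sym (trans e e′))
       (towerMul-prefix ps qs (≤-trans (s≤s a≤i) i<) (≤-trans (s≤s b≤j) j<))

-- Divisors of prime powers, of pq and of 12

prime-power-∣ : ∀ {p} → Prime p → ∀ k {d} → d ∣ p ^ k → ∃ λ a → a ≤ k × d ≡ p ^ a
prime-power-∣ pp zero d∣1 = 0 , z≤n , ∣1⇒≡1 d∣1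
prime-power-∣ {p} pp (suc k) {d} (divides e eq) = split (euclidsLemma e d pp (subst (p ∣_) eq (m∣m*n (p ^ k))))
  where
  instance _ = prime⇒nonZero pp
  split : p ∣ e ⊎ p ∣ d → ∃ λ a → a ≤ suc k × d ≡ p ^ a
  split (inj₁ (divides f refl)) =
    let (a , a≤k , d≡) = prime-power-∣ pp k (divides f (*-cancelˡ-≡ (p ^ k) (f * d) p
          (trans eq (trans (cong (_* d) (*-comm f p)) (*-assoc p f d)))))
    in a , m≤n⇒m≤1+n a≤k , d≡
  split (inj₂ (divides f refl)) =
    let (a , a≤k , f≡) = prime-power-∣ pp k (divides e (*-cancelˡ-≡ (p ^ k) (e * f) p
          (trans eq (trans (sym (*-assoc e f p)) (*-comm (e * f) p)))))
    in suc a , s≤s a≤k , trans (*-comm f p) (cong (p *_) f≡)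

prime-pair-∣ : ∀ {p q} → Prime p → Prime q → ∀ {d} → d ∣ p * q → d ≡ 1 ⊎ d ≡ p ⊎ d ≡ q ⊎ d ≡ p * q
prime-pair-∣ {p} {q} pp pq {d} (divides e eq) = split (euclidsLemma e d pp (subst (p ∣_) eq (m∣m*n q)))
  where
  instance _ = prime⇒nonZero pp
  split : p ∣ e ⊎ p ∣ d → d ≡ 1 ⊎ d ≡ p ⊎ d ≡ q ⊎ d ≡ p * q
  split (inj₁ (divides f refl)) with prime⇒irreducible pq (divides f (*-cancelˡ-≡ q (f * d) p
          (trans eq (trans (cong (_* d) (*-comm f p)) (*-assoc p f d)))))
  ... | inj₁ d≡1 = inj₁ d≡1
  ... | inj₂ d≡q = inj₂ (inj₂ (inj₁ d≡q))
  split (inj₂ (divides f refl)) with prime⇒irreducible pq (divides e (*-cancelˡ-≡ q (e * f) p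
          (trans eq (trans (sym (*-assoc e f p)) (*-comm (e * f) p)))))
  ... | inj₁ refl = inj₂ (inj₁ (*-identityˡ p))
  ... | inj₂ refl = inj₂ (inj₂ (inj₂ (*-comm f p)))

prime-pair-≤ : ∀ {p q} → Prime p → Prime q → p ≢ q → ∀ {x} → q ∣ x → p ∣ x → 1 ≤ x → p * q ≤ x
prime-pair-≤ {p} {q} pp pq p≢q (divides e refl) p∣eq 1≤ with euclidsLemma e q pp p∣eq
... | inj₂ p∣q = ⊥-elim (case-irr (prime⇒irreducible pq p∣q))
  where
  case-irr : p ≡ 1 ⊎ p ≡ q → ⊥
  case-irr (inj₁ refl) = ¬prime[1] pp
  case-irr (inj₂ p≡q) = p≢q p≡q
prime-pair-≤ {p} {q} pp pq p≢q (divides .(zero * p) refl) _ () | inj₁ (divides zero refl)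
prime-pair-≤ {p} {q} pp pq p≢q (divides .(suc f * p) refl) _ _ | inj₁ (divides (suc f) refl) =
  *-monoˡ-≤ q (m≤m+n p (f * p))

divisors-12 : ∀ d → d ∣ 12 → d ≡ 1 ⊎ d ≡ 2 ⊎ d ≡ 3 ⊎ d ≡ 4 ⊎ d ≡ 6 ⊎ d ≡ 12
divisors-12 1  _ = inj₁ refl
divisors-12 2  _ = inj₂ (inj₁ refl)
divisors-12 3  _ = inj₂ (inj₂ (inj₁ refl))
divisors-12 4  _ = inj₂ (inj₂ (inj₂ (inj₁ refl)))
divisors-12 6  _ = inj₂ (inj₂ (inj₂ (inj₂ (inj₁ refl))))
divisors-12 12 _ = inj₂ (inj₂ (inj₂ (inj₂ (inj₂ refl))))
divisors-12 0  d = ⊥-elim (from-no (0 ∣? 12) d)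
divisors-12 5  d = ⊥-elim (from-no (5 ∣? 12) d)
divisors-12 7  d = ⊥-elim (from-no (7 ∣? 12) d)
divisors-12 8  d = ⊥-elim (from-no (8 ∣? 12) d)
divisors-12 9  d = ⊥-elim (from-no (9 ∣? 12) d)
divisors-12 10 d = ⊥-elim (from-no (10 ∣? 12) d)
divisors-12 11 d = ⊥-elim (from-no (11 ∣? 12) d)
divisors-12 (suc (suc (suc (suc (suc (suc (suc (suc (suc (suc (suc (suc (suc n))))))))))))) d =
  ⊥-elim (<⇒≱ (m≤m+n 13 n) (∣⇒≤ d))

replicate-++ : ∀ a b (x : ℕ) → replicate a x ++ replicate b x ≡ replicate (a + b) x
replicate-++ zero    b x = refl
replicate-++ (suc a) b x = cong (x ∷_) (replicate-++ a b x)

product-replicate : ∀ a x → product (replicate a x) ≡ x ^ a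
product-replicate zero    x = refl
product-replicate (suc a) x = cong (x *_) (product-replicate a x)

replicate-prime : ∀ {p} → Prime p → ∀ a → All Prime (replicate a p)
replicate-prime pp zero    = All.[]
replicate-prime pp (suc a) = pp All.∷ replicate-prime pp a

-- From violations of a tower to critical pairs

module Domination {c ℓ p : Level} {geometry : Geometry c ℓ p} {n : ℕ} (frame : Frame geometry n)
  (F : Fin n → Subspaces.Sub geometry)
  (dim-F : ∀ i → Subspaces.Dim geometry (F i) (suc (toℕ i)))
  (F-mono : ∀ i j → toℕ i ≤ toℕ j → Subspaces._⊆_ geometry (F i) (F j))
  (ε∈F : ∀ i → Subspaces._∈_ geometry (Geometry.ε geometry) (F i))
  (T : Fin n → Fin n → Fin n)
  (F·F⊆F : ∀ i j → Subspaces._⊆_ geometry (Products._·_ geometry (F i) (F j)) (F (T i j))) where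
  open Geometry geometry
  open Subspaces geometry
  open Products geometry
  open Stabilizers frame
  open Flags frame F dim-F F-mono ε∈F

  Violation : List ℕ → Fin n → Fin n → Set
  Violation ps i j = toℕ (T i j) < towerType ps (toℕ i) (toℕ j)

  Dominates : List ℕ → Set
  Dominates ps = ∀ i j → towerType ps (toℕ i) (toℕ j) ≤ toℕ (T i j)

  dominates-or-violates : ∀ ps → Dominates ps ⊎ ∃₂ λ i j → Violation ps i j
  dominates-or-violates ps with any? (λ i → any? (λ j → toℕ (T i j) <? towerType ps (toℕ i) (toℕ j)))
  ... | yes (i , j , v) = inj₂ (i , j , v)
  ... | no none         = inj₁ λ i j → ≮⇒≥ λ v → none (i , j , v)

  -- When h is a partial product the tower value is below h(r + s - 1), and Kneser gives h(r + s -
  -- 1) ≤ hv ≤ k + 1.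
  prefix-served : ∀ {i j k} qs rs (C : Stabilized i j k) → Stabilized.h C ≡ product qs →
    towerType (qs ++ rs) (toℕ i) (toℕ j) ≤ toℕ k
  prefix-served {i} {j} {k} qs rs C h≡ = ≤-pred (+-cancelʳ-≤ (product qs) _ _ (≤-trans
      (towerType-prefix qs rs {r = r} {s = s}
        (subst (λ h → toℕ i < h * r) h≡ (dim-mono dim-iH (dim-F i) i⊆iH))
        (subst (λ h → toℕ j < h * s) h≡ (dim-mono dim-jH (dim-F j) j⊆jH)))
      (≤-trans (*-monoʳ-≤ (product qs) kneser≤) (≤-trans (≤-reflexive (*-suc (product qs) v))
        (≤-trans (≤-reflexive (+-comm (product qs) _))
          (+-monoˡ-≤ (product qs) (subst (λ h → h * v ≤ suc (toℕ k)) h≡ hv≤k)))))))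
    where open Stabilized C

  order-∣ : ∀ {i j k} (C : Stabilized i j k) → Stabilized.h C ∣ n
  order-∣ C = subfield-∣ (Stabilized.subfield C) (λ _ _ → tt) (Stabilized.dim-H C) (Frame.dim-⊤ frame)

  -- The two bounds in `Critical` come from the partial products 1 and n; `prefix-served` rules out
  -- every partial product as order of the stabilizer.
  violation⇒critical : ∀ ps {i j} → product ps ≡ n → Violation ps i j → ¬ ¬ Σ (Critical i j (T i j)) λ C →
    ∀ qs rs → qs ++ rs ≡ ps → Critical.h C ≢ product qs
  violation⇒critical ps {i} {j} ps≡n v c = stabilized (F·F⊆F i j) λ C → c
    ( record
      { stabilizedBy = C
      ; excess = ≤-trans v (≤-pred (≤-pred (≤-trans (≤-reflexive (+-comm 1 _)) (≤-trans
          (towerType-prefix [] ps {r = suc (toℕ i)} {s = suc (toℕ j)} (≤-reflexive (sym (*-identityˡ _))) (≤-reflexive (sym (*-identityˡ _))))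
          (≤-reflexive (trans (*-identityˡ _) (cong suc (+-suc (toℕ i) (toℕ j)))))))))
      ; k-proper = ≤-trans (s≤s v) whole
      }
    , λ { qs rs refl h≡ → <⇒≱ v (prefix-served qs rs C h≡) })
    where
    whole : suc (towerType ps (toℕ i) (toℕ j)) ≤ n
    whole = +-cancelʳ-≤ n _ _ (subst₂ (λ t d → suc (towerType t (toℕ i) (toℕ j)) + d ≤ n + n)
      (++-identityʳ ps) ps≡n (≤-trans
        (towerType-prefix ps [] {r = 1} {s = 1} (inside i) (inside j))
        (≤-reflexive (trans (cong (_* 2) ps≡n) (trans (*-comm n 2) (cong (n +_) (+-identityʳ n)))))))
      where
      inside : ∀ (i : Fin n) → toℕ i < product ps * 1
      inside i = ≤-trans (toℕ<n i) (≤-reflexive (sym (trans (*-identityʳ _) ps≡n)))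

  private
    Coprime-Conflict : ∀ {i j k i′ j′ k′} → Critical i j k → Critical i′ j′ k′ → Set
    Coprime-Conflict C C′ = Critical.h C * Critical.h C′ ≡ n →
      (∀ {x} → Critical.h C ∣ x → Critical.h C′ ∣ x → 1 ≤ x → n ≤ x) → ⊥

    sorted-conflict : ∀ {i j k i′ j′ k′} (C : Critical i j k) (C′ : Critical i′ j′ k′) →
      toℕ j ≤ toℕ i → toℕ j′ ≤ toℕ i′ → Coprime-Conflict C C′
    sorted-conflict {i} {i′ = i′} C C′ j≤i j′≤i′ hh′ lcm≥n with ≤-total (toℕ i) (toℕ i′)
    ... | inj₁ i≤i′ = Coprime.conflict C C′ hh′ lcm≥n j≤i j′≤i′ i≤i′
    ... | inj₂ i′≤i = Coprime.conflict C′ C (trans (*-comm (Critical.h C′) (Critical.h C)) hh′)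
                        (λ a b → lcm≥n b a) j′≤i′ j≤i i′≤i

  coprime-conflict : ∀ {i j k i′ j′ k′} (C : Critical i j k) (C′ : Critical i′ j′ k′) →
    Critical.h C * Critical.h C′ ≡ n →
    (∀ {x} → Critical.h C ∣ x → Critical.h C′ ∣ x → 1 ≤ x → n ≤ x) → ⊥
  coprime-conflict {i} {j} {i′ = i′} {j′} C C′ with ≤-total (toℕ j) (toℕ i) | ≤-total (toℕ j′) (toℕ i′)
  ... | inj₁ j≤i | inj₁ j′≤i′ = sorted-conflict C C′ j≤i j′≤i′
  ... | inj₁ j≤i | inj₂ i′≤j′ = sorted-conflict C (critical-swap C′) j≤i i′≤j′
  ... | inj₂ i≤j | inj₁ j′≤i′ = sorted-conflict (critical-swap C) C′ i≤j j′≤i′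
  ... | inj₂ i≤j | inj₂ i′≤j′ = sorted-conflict (critical-swap C) (critical-swap C′) i≤j i′≤j′

  prime-power : ∀ {q k} → Prime q → n ≡ q ^ k → ∃ λ ps → IsPrimeTowerType n ps × Dominates ps
  prime-power {q} {k} pq n≡ = replicate k q
    , (replicate-prime pq k , trans (product-replicate k q) (sym n≡))
    , λ i j → ≤-stable λ c → stabilized (F·F⊆F i j) λ C →
      let (a , a≤k , h≡) = prime-power-∣ pq k (subst (Stabilized.h C ∣_) n≡ (order-∣ C))
          split = trans (replicate-++ a (k ∸ a) q) (cong (λ t → replicate t q) (m+[n∸m]≡n a≤k))
      in c (subst (λ ps → towerType ps (toℕ i) (toℕ j) ≤ toℕ (T i j)) split
             (prefix-served (replicate a q) (replicate (k ∸ a) q) C (trans h≡ (sym (product-replicate a q)))))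

  -- A violation of (q, r) has stabilizer order r and one of (r, q) has order q: coprime orders with
  -- product n.
  prime-pair : ∀ {q r} → Prime q → Prime r → q ≢ r → n ≡ q * r → ∃ λ ps → IsPrimeTowerType n ps × Dominates ps
  prime-pair {q} {r} pq pr q≢r n≡ with dominates-or-violates (q ∷ r ∷ []) | dominates-or-violates (r ∷ q ∷ [])
  ... | inj₁ dom | _ = _ , (pq All.∷ pr All.∷ All.[] , trans (cong (q *_) (*-identityʳ r)) (sym n≡)) , dom
  ... | inj₂ _ | inj₁ dom = _ , (pr All.∷ pq All.∷ All.[] , trans (cong (r *_) (*-identityʳ q)) (trans (*-comm r q) (sym n≡))) , dom
  ... | inj₂ (i , j , v) | inj₂ (i′ , j′ , v′) = ⊥-elim
      (violation⇒critical (q ∷ r ∷ []) (trans (cong (q *_) (*-identityʳ r)) (sym n≡)) v λ (C , not) →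
       violation⇒critical (r ∷ q ∷ []) (trans (cong (r *_) (*-identityʳ q)) (trans (*-comm r q) (sym n≡))) v′ λ (C′ , not′) →
       let h≡r = only (prime-pair-∣ pq pr (subst (Critical.h C ∣_) n≡ (order-∣ (Critical.stabilizedBy C)))) not
           h′≡q = only (prime-pair-∣ pr pq (subst (Critical.h C′ ∣_) (trans n≡ (*-comm q r)) (order-∣ (Critical.stabilizedBy C′)))) not′
       in coprime-conflict C C′ (trans (cong₂ _*_ h≡r h′≡q) (trans (*-comm r q) (sym n≡)))
            (λ {x} a b 1≤ → subst (_≤ x) (sym n≡) (prime-pair-≤ pq pr q≢r (subst (_∣ x) h≡r a) (subst (_∣ x) h′≡q b) 1≤)))
    where
    only : ∀ {q r h} → h ≡ 1 ⊎ h ≡ q ⊎ h ≡ r ⊎ h ≡ q * r →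
      (∀ qs rs → qs ++ rs ≡ q ∷ r ∷ [] → h ≢ product qs) → h ≡ r
    only (inj₁ h≡1) not = ⊥-elim (not [] _ refl h≡1)
    only {q} (inj₂ (inj₁ h≡q)) not = ⊥-elim (not (q ∷ []) _ refl (trans h≡q (sym (*-identityʳ q))))
    only (inj₂ (inj₂ (inj₁ h≡r))) not = h≡r
    only {q} {r} (inj₂ (inj₂ (inj₂ h≡qr))) not = ⊥-elim (not (q ∷ r ∷ []) [] refl (trans h≡qr (cong (q *_) (sym (*-identityʳ r)))))

module Domination12 {c ℓ p : Level} {geometry : Geometry c ℓ p} (frame : Frame geometry 12)
  (F : Fin 12 → Subspaces.Sub geometry)
  (dim-F : ∀ i → Subspaces.Dim geometry (F i) (suc (toℕ i)))
  (F-mono : ∀ i j → toℕ i ≤ toℕ j → Subspaces._⊆_ geometry (F i) (F j))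
  (ε∈F : ∀ i → Subspaces._∈_ geometry (Geometry.ε geometry) (F i))
  (T : Fin 12 → Fin 12 → Fin 12)
  (F·F⊆F : ∀ i j → Subspaces._⊆_ geometry (Products._·_ geometry (F i) (F j)) (F (T i j))) where
  open Flags frame F dim-F F-mono ε∈F
  open Domination frame F dim-F F-mono ε∈F T F·F⊆F
  open Twelve frame F dim-F F-mono ε∈F

  private
    prime-2 : Prime 2
    prime-2 = from-yes (prime? 2)
    prime-3 : Prime 3
    prime-3 = from-yes (prime? 3)

  twelve : ∃ λ ps → IsPrimeTowerType 12 ps × Dominates ps
  twelve = choose (dominates-or-violates ps₁) (dominates-or-violates ps₂) (dominates-or-violates ps₃)
    where
    ps₁ ps₂ ps₃ : List ℕ
    ps₁ = 2 ∷ 2 ∷ 3 ∷ []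
    ps₂ = 2 ∷ 3 ∷ 2 ∷ []
    ps₃ = 3 ∷ 2 ∷ 2 ∷ []
    Divisor : ℕ → Set
    Divisor h = h ≡ 1 ⊎ h ≡ 2 ⊎ h ≡ 3 ⊎ h ≡ 4 ⊎ h ≡ 6 ⊎ h ≡ 12
    NoPrefix : List ℕ → ℕ → Set
    NoPrefix ps h = ∀ qs rs → qs ++ rs ≡ ps → h ≢ product qs
    three-or-six : ∀ {h} → Divisor h → NoPrefix (2 ∷ 2 ∷ 3 ∷ []) h → h ≡ 3 ⊎ h ≡ 6
    three-or-six (inj₁ e) not = ⊥-elim (not [] _ refl e)
    three-or-six (inj₂ (inj₁ e)) not = ⊥-elim (not (2 ∷ []) _ refl e)
    three-or-six (inj₂ (inj₂ (inj₁ e))) not = inj₁ e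
    three-or-six (inj₂ (inj₂ (inj₂ (inj₁ e)))) not = ⊥-elim (not (2 ∷ 2 ∷ []) _ refl e)
    three-or-six (inj₂ (inj₂ (inj₂ (inj₂ (inj₁ e))))) not = inj₂ e
    three-or-six (inj₂ (inj₂ (inj₂ (inj₂ (inj₂ e))))) not = ⊥-elim (not (2 ∷ 2 ∷ 3 ∷ []) _ refl e)
    three-or-four : ∀ {h} → Divisor h → NoPrefix (2 ∷ 3 ∷ 2 ∷ []) h → h ≡ 3 ⊎ h ≡ 4
    three-or-four (inj₁ e) not = ⊥-elim (not [] _ refl e)
    three-or-four (inj₂ (inj₁ e)) not = ⊥-elim (not (2 ∷ []) _ refl e)
    three-or-four (inj₂ (inj₂ (inj₁ e))) not = inj₁ e
    three-or-four (inj₂ (inj₂ (inj₂ (inj₁ e)))) not = inj₂ e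
    three-or-four (inj₂ (inj₂ (inj₂ (inj₂ (inj₁ e))))) not = ⊥-elim (not (2 ∷ 3 ∷ []) _ refl e)
    three-or-four (inj₂ (inj₂ (inj₂ (inj₂ (inj₂ e))))) not = ⊥-elim (not (2 ∷ 3 ∷ 2 ∷ []) _ refl e)
    two-or-four : ∀ {h} → Divisor h → NoPrefix (3 ∷ 2 ∷ 2 ∷ []) h → h ≡ 2 ⊎ h ≡ 4
    two-or-four (inj₁ e) not = ⊥-elim (not [] _ refl e)
    two-or-four (inj₂ (inj₁ e)) not = inj₁ e
    two-or-four (inj₂ (inj₂ (inj₁ e))) not = ⊥-elim (not (3 ∷ []) _ refl e)
    two-or-four (inj₂ (inj₂ (inj₂ (inj₁ e)))) not = inj₂ e
    two-or-four (inj₂ (inj₂ (inj₂ (inj₂ (inj₁ e))))) not = ⊥-elim (not (3 ∷ 2 ∷ []) _ refl e)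
    two-or-four (inj₂ (inj₂ (inj₂ (inj₂ (inj₂ e))))) not = ⊥-elim (not (3 ∷ 2 ∷ 2 ∷ []) _ refl e)
    clash : ∀ {i₁ j₁ k₁ i₂ j₂ k₂ i₃ j₃ k₃} (C₁ : Critical i₁ j₁ k₁) (C₂ : Critical i₂ j₂ k₂) (C₃ : Critical i₃ j₃ k₃) →
      Critical.h C₁ ≡ 3 ⊎ Critical.h C₁ ≡ 6 → Critical.h C₂ ≡ 3 ⊎ Critical.h C₂ ≡ 4 →
      Critical.h C₃ ≡ 2 ⊎ Critical.h C₃ ≡ 4 → ⊥
    clash C₁ C₂ C₃ (inj₁ e₁) _ (inj₁ e₃) = three-two C₁ C₃ e₁ e₃
    clash C₁ C₂ C₃ (inj₁ e₁) _ (inj₂ e₃) = coprime-conflict C₁ C₃ (cong₂ _*_ e₁ e₃)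
      λ {x} a b 1≤x → lcm-bound 3 4 (subst (_∣ x) e₁ a) (subst (_∣ x) e₃ b) 1≤x
    clash C₁ C₂ C₃ (inj₂ e₁) _ (inj₂ e₃) = six-four C₁ C₃ e₁ e₃
    clash C₁ C₂ C₃ (inj₂ e₁) (inj₁ e₂) (inj₁ e₃) = three-two C₂ C₃ e₂ e₃
    clash C₁ C₂ C₃ (inj₂ e₁) (inj₂ e₂) (inj₁ e₃) = six-four C₁ C₂ e₁ e₂
    choose : Dominates ps₁ ⊎ ∃₂ (Violation ps₁) → Dominates ps₂ ⊎ ∃₂ (Violation ps₂) →
      Dominates ps₃ ⊎ ∃₂ (Violation ps₃) → ∃ λ ps → IsPrimeTowerType 12 ps × Dominates ps
    choose (inj₁ dom) _ _ = ps₁ , (prime-2 All.∷ prime-2 All.∷ prime-3 All.∷ All.[] , refl) , dom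
    choose _ (inj₁ dom) _ = ps₂ , (prime-2 All.∷ prime-3 All.∷ prime-2 All.∷ All.[] , refl) , dom
    choose _ _ (inj₁ dom) = ps₃ , (prime-3 All.∷ prime-2 All.∷ prime-2 All.∷ All.[] , refl) , dom
    choose (inj₂ (_ , _ , v₁)) (inj₂ (_ , _ , v₂)) (inj₂ (_ , _ , v₃)) = ⊥-elim
      (violation⇒critical ps₁ refl v₁ λ (C₁ , not₁) →
       violation⇒critical ps₂ refl v₂ λ (C₂ , not₂) →
       violation⇒critical ps₃ refl v₃ λ (C₃ , not₃) →
       clash C₁ C₂ C₃ (three-or-six (divisors-12 _ (order-∣ (Critical.stabilizedBy C₁))) not₁)
                      (three-or-four (divisors-12 _ (order-∣ (Critical.stabilizedBy C₂))) not₂)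
                      (two-or-four (divisors-12 _ (order-∣ (Critical.stabilizedBy C₃))) not₃))

module _ {c ℓ p : Level} {geometry : Geometry c ℓ p} where
  open Geometry geometry
  open Subspaces geometry
  open Products geometry

  -- The last step of the chain that builds `⊤ₛ` supplies the hyperplane.
  frame : ∀ {m} → Dim ⊤ₛ (suc m) → Frame geometry (suc m)
  frame D@(extend W y DW y∉W (⊤⊆ , _)) = record
    { dim-⊤ = D
    ; hyperplane = W
    ; proper = y , y∉W
    ; spanning = λ u {z} z∉W → ⊕-⊆ W y (W ⊕ z) (⊕-inˡ W z) (⊕-exchange W (⊤⊆ tt) z∉W) (⊤⊆ tt)
    }

  flag-dominates : ∀ {n} → GoodDegree n → Dim ⊤ₛ n → (F : Fin n → Sub) → (∀ i → Dim (F i) (suc (toℕ i))) →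
    (∀ i j → toℕ i ≤ toℕ j → F i ⊆ F j) → (∀ i → ε ∈ F i) → (T : Fin n → Fin n → Fin n) →
    (∀ i j → F i · F j ⊆ F (T i j)) →
    ∃ λ ps → IsPrimeTowerType n ps × (∀ i j → towerType ps (toℕ i) (toℕ j) ≤ toℕ (T i j))
  flag-dominates {zero} _ (empty none) = ⊥-elim (none {ε} tt)
  flag-dominates {suc m} (inj₁ (q , k , pq , _ , n≡)) D F dim-F mono ε∈F T prod =
    Domination.prime-power (frame D) F dim-F mono ε∈F T prod {k = k} pq n≡
  flag-dominates {suc m} (inj₂ (inj₁ (q , r , pq , pr , q≢r , n≡))) D F dim-F mono ε∈F T prod =
    Domination.prime-pair (frame D) F dim-F mono ε∈F T prod pq pr q≢r n≡
  flag-dominates {suc m} (inj₂ (inj₂ refl)) D F dim-F mono ε∈F T prod =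
    Domination12.twelve (frame D) F dim-F mono ε∈F T prod

module _ {n : ℕ} where

  chain-mono : ∀ {a b} {A : Set a} (F : Fin n → A → Set b) →
    (∀ i j → toℕ j ≡ suc (toℕ i) → ∀ x → F i x → F j x) → ∀ i j → toℕ i ≤ toℕ j → ∀ {x} → F i x → F j x
  chain-mono F step i j i≤j {x} = go (toℕ j ∸ toℕ i) j (sym (m∸n+n≡m i≤j))
    where
    go : ∀ t j → toℕ j ≡ t + toℕ i → F i x → F j x
    go zero    j eq Fx = subst (λ k → F k x) (toℕ-injective (sym eq)) Fx
    go (suc t) j eq Fx = step k j (trans eq (cong suc (sym k≡))) x (go t k k≡ Fx)
      where
      k<n : t + toℕ i < n
      k<n = ≤-trans (≤-reflexive (sym eq)) (<⇒≤ (toℕ<n j))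
      k = fromℕ< k<n
      k≡ : toℕ k ≡ t + toℕ i
      k≡ = toℕ-fromℕ< k<n

  least-index : Fin n → ∃ λ (i : Fin n) → toℕ i ≡ 0
  least-index i = fromℕ< 0<n , toℕ-fromℕ< 0<n
    where
    0<n : 0 < n
    0<n = ≤-trans (s≤s z≤n) (toℕ<n i)

-- Groups and field extensions

module GroupCase {c ℓ : Level} (p : Level) (G : AbelianGroup c ℓ) where
  private module G = AbelianGroup G

  geometry : Geometry c ℓ p
  geometry = record
    { points = G
    ; Line = λ x y z → Lift (c ⊔ ℓ ⊔ p) (z G.≈ x ⊎ z G.≈ y)
    ; line-≈ = λ e → lift (inj₁ e)
    ; line-sym = λ { (lift (inj₁ e)) → lift (inj₂ e) ; (lift (inj₂ e)) → lift (inj₁ e) }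
    ; line-exchange = λ { (lift (inj₁ e)) k → k (inj₁ (lift (inj₁ e))) ; (lift (inj₂ e)) k → k (inj₂ (lift (inj₂ (G.sym e)))) }
    ; line-point-sym = λ { (lift (inj₁ e)) → lift (inj₁ (G.sym e)) ; (lift (inj₂ e)) → lift (inj₁ (G.sym e)) }
    ; line-point-closed = λ { l m (lift (inj₁ e)) → lift (inj₁ (G.trans e (only l))) ; l m (lift (inj₂ e)) → lift (inj₁ (G.trans e (only m))) }
    ; line-veblen = λ
        { (lift (inj₁ e)) _ (lift (inj₁ f)) k → k (inj₁ (lift (inj₁ (G.trans f e))))
        ; (lift (inj₂ e)) _ (lift (inj₁ f)) k → k (inj₂ (inj₁ (lift (inj₁ (G.trans f e)))))
        ; _ (lift (inj₁ e)) (lift (inj₂ f)) k → k (inj₁ (lift (inj₂ (G.trans f e))))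
        ; _ (lift (inj₂ e)) (lift (inj₂ f)) k → k (inj₂ (inj₁ (lift (inj₂ (G.trans f e))))) }
    ; line-∙ = λ { w (lift (inj₁ e)) → lift (inj₁ (G.∙-congˡ e)) ; w (lift (inj₂ e)) → lift (inj₂ (G.∙-congˡ e)) }
    }
    where
    only : ∀ {x y} → Lift (c ⊔ ℓ ⊔ p) (y G.≈ x ⊎ y G.≈ x) → y G.≈ x
    only (lift (inj₁ e)) = e
    only (lift (inj₂ e)) = e

  open Subspaces geometry
  open Products geometry

  subset : (P : G.Carrier → Set p) → Respects≈ G._≈_ P → Sub
  subset P resp = record
    { mem    = λ z → Lift (c ⊔ ℓ) (¬ ¬ P z)
    ; stable = λ h → lift λ k → h λ h′ → lower h′ k
    ; closed = λ { (lift a) _ (lift (inj₁ e)) → lift (λ k → a (k ∘ resp (G.sym e)))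
                 ; _ (lift b) (lift (inj₂ e)) → lift (λ k → b (k ∘ resp (G.sym e))) }
    }

  range : ∀ {d} → (Fin d → G.Carrier) → Sub
  range f = record
    { mem    = λ z → Lift (c ⊔ p) (¬ ¬ ∃ λ a → z G.≈ f a)
    ; stable = λ h → lift λ k → h λ h′ → lower h′ k
    ; closed = λ { (lift a) _ (lift (inj₁ e)) → lift (λ k → a λ (i , e′) → k (i , G.trans e e′))
                 ; _ (lift b) (lift (inj₂ e)) → lift (λ k → b λ (i , e′) → k (i , G.trans e e′)) }
    }

  dim-range : ∀ d (f : Fin d → G.Carrier) → (∀ a b → f a G.≈ f b → a ≡ b) → Dim (range f) d
  dim-range zero f inj = empty λ (lift h) → h λ { (() , _) }
  dim-range (suc d) f inj = extend tail (f fzero) (dim-range d (f ∘ fsuc) λ a b e → fsuc-inj (inj (fsuc a) (fsuc b) e))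
      (λ (lift h) → h λ (a , e) → fzero≢ (inj fzero (fsuc a) e))
      ( (λ {z} (lift h) → stable (tail ⊕ f fzero) λ k → h λ
          { (fzero , e)  → k (∈-resp (tail ⊕ f fzero) (G.sym e) (⊕-inʳ tail (f fzero)))
          ; (fsuc a , e) → k (⊕-inˡ tail (f fzero) (lift λ c → c (a , e))) })
      , ⊕-⊆ tail (f fzero) (range f) (λ (lift h) → lift λ k → h λ (a , e) → k (fsuc a , e)) (lift λ k → k (fzero , G.refl)))
    where
    tail : Sub
    tail = range (f ∘ fsuc)
    fsuc-inj : ∀ {a b : Fin d} → fsuc a ≡ fsuc b → a ≡ b
    fsuc-inj refl = refl
    fzero≢ : ∀ {a : Fin d} → fzero ≢ fsuc a
    fzero≢ ()

  dim-subset : ∀ {P d} (resp : Respects≈ G._≈_ P) → HasSize G._≈_ P d → Dim (subset P resp) d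
  dim-subset {P} {d} resp (f , Pf , inj , surj) = dim-≐
    ( (λ (lift h) → lift λ k → h λ (a , e) → k (resp (G.sym e) (Pf a)))
    , (λ (lift h) → lift λ k → h λ Pz → k (surj _ Pz))) (dim-range d f inj)

  dominates : ∀ {n} → GoodDegree n → (F : Fin n → G.Carrier → Set p) → IsGroupFlag G n F →
    (T : Fin n → Fin n → Fin n) → IsGroupFlagTypeOf G n F T →
    ∃ λ ps → IsPrimeTowerType n ps × (∀ i j → towerType ps (toℕ i) (toℕ j) ≤ toℕ (T i j))
  dominates good F (size , resp , sizes , step , first , _) T typ =
    flag-dominates good (dim-≐ ((λ _ → tt) , (λ _ → lift λ k → k tt)) (dim-subset (λ _ _ → tt) size))
      Fs (λ i → dim-subset (resp i) (sizes i))
      (λ i j i≤j (lift h) → lift λ k → h λ Fx → k (chain-mono F step i j i≤j Fx))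
      (λ i → let (o , o≡0) = least-index i in
         lift λ k → k (chain-mono F step o i (≤-trans (≤-reflexive o≡0) z≤n) (proj₂ (first o o≡0 _) G.refl)))
      T (λ i j → ·-⊆ (Fs i) (Fs j) (Fs (T i j)) λ (lift a) (lift b) → lift λ k → a λ x → b λ y → k (proj₁ (typ i j) _ _ x y))
    where
    Fs : Fin _ → Sub
    Fs i = subset (F i) (resp i)

module FieldCase {c ℓ p : Level} (L : Field c ℓ) (K : Field.Carrier L → Set p) (K-subfield : IsSubfield L K) where
  private module L = Field L
  open L using (Carrier; 0#; 1#)

  private
    K0 = proj₁ (proj₂ K-subfield)
    K1 = proj₁ (proj₂ (proj₂ K-subfield))
    K+ = proj₁ (proj₂ (proj₂ (proj₂ K-subfield)))
    K- = proj₁ (proj₂ (proj₂ (proj₂ (proj₂ K-subfield))))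
    K* = proj₁ (proj₂ (proj₂ (proj₂ (proj₂ (proj₂ K-subfield)))))
    K-inv = proj₂ (proj₂ (proj₂ (proj₂ (proj₂ (proj₂ K-subfield)))))

    Nonzero : Set (c ⊔ ℓ)
    Nonzero = Σ Carrier λ x → ¬ x L.≈ 0#

    1≉0 : ¬ 1# L.≈ 0#
    1≉0 e = L.0≉1 (L.sym e)

    *-swap : ∀ w k x → w L.* (k L.* x) L.≈ k L.* (w L.* x)
    *-swap w k x = L.trans (L.sym (L.*-assoc w k x)) (L.trans (L.*-congʳ (L.*-comm w k)) (L.*-assoc k w x))

    *-nonzero : ∀ {x y} → ¬ x L.≈ 0# → ¬ y L.≈ 0# → ¬ x L.* y L.≈ 0#
    *-nonzero {x} {y} x≉0 y≉0 xy≈0 = let (x′ , xx′≈1) = L.inverse x x≉0 in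
      y≉0 (L.trans (L.sym (L.*-identityˡ y)) (L.trans (L.*-congʳ (L.sym xx′≈1))
        (L.trans (L.trans (L.*-assoc x x′ y) (*-swap x x′ y))
          (L.trans (L.*-congˡ xy≈0) (L.zeroʳ x′)))))

    inverse-nonzero : ∀ {x x′} → x L.* x′ L.≈ 1# → ¬ x′ L.≈ 0#
    inverse-nonzero {x} xx′≈1 x′≈0 = 1≉0 (L.trans (L.sym xx′≈1) (L.trans (L.*-congˡ x′≈0) (L.zeroʳ x)))

    inverse-cong : ∀ {x y x′ y′} → x L.≈ y → x L.* x′ L.≈ 1# → y L.* y′ L.≈ 1# → x′ L.≈ y′
    inverse-cong {x} {y} {x′} {y′} e xx′ yy′ = L.trans (L.sym (L.*-identityˡ x′)) (L.trans (L.*-congʳ (L.sym yy′))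
      (L.trans (L.trans (L.*-assoc y y′ x′) (L.trans (L.*-congˡ (L.*-comm y′ x′)) (L.sym (L.*-assoc y x′ y′))))
        (L.trans (L.*-congʳ (L.trans (L.*-congʳ (L.sym e)) xx′)) (L.*-identityˡ y′))))

    nonzeroGroup : AbelianGroup (c ⊔ ℓ) ℓ
    nonzeroGroup = record
      { Carrier = Nonzero
      ; _≈_ = λ x y → proj₁ x L.≈ proj₁ y
      ; _∙_ = λ (x , x≉0) (y , y≉0) → x L.* y , *-nonzero x≉0 y≉0
      ; ε = 1# , 1≉0
      ; _⁻¹ = λ (x , x≉0) → let (x′ , e) = L.inverse x x≉0 in x′ , inverse-nonzero e
      ; isAbelianGroup = record
        { isGroup = record
          { isMonoid = record
            { isSemigroup = record
              { isMagma = record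
                { isEquivalence = record { refl = L.refl ; sym = L.sym ; trans = L.trans }
                ; ∙-cong = L.*-cong }
              ; assoc = λ x y z → L.*-assoc _ _ _ }
            ; identity = (λ x → L.*-identityˡ _) , (λ x → L.*-identityʳ _) }
          ; inverse = (λ (x , x≉0) → L.trans (L.*-comm _ _) (proj₂ (L.inverse x x≉0))) , (λ (x , x≉0) → proj₂ (L.inverse x x≉0))
          ; ⁻¹-cong = λ {(x , x≉0)} {(y , y≉0)} e → inverse-cong e (proj₂ (L.inverse x x≉0)) (proj₂ (L.inverse y y≉0)) }
        ; comm = λ x y → L.*-comm _ _ } }

    Comb : Carrier → Carrier → Carrier → Set (c ⊔ ℓ ⊔ p)
    Comb x y z = ∃₂ λ k l → K k × K l × z L.≈ k L.* x L.+ l L.* y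

    scale : ∀ k a b x y → k L.* (a L.* x L.+ b L.* y) L.≈ (k L.* a) L.* x L.+ (k L.* b) L.* y
    scale k a b x y = L.trans (L.distribˡ k _ _) (L.+-cong (L.sym (L.*-assoc k a x)) (L.sym (L.*-assoc k b y)))

    +-interchange : ∀ u v w z → (u L.+ v) L.+ (w L.+ z) L.≈ (u L.+ w) L.+ (v L.+ z)
    +-interchange u v w z = L.trans (L.+-assoc u v _) (L.trans (L.+-congˡ (L.trans (L.sym (L.+-assoc v w z))
      (L.trans (L.+-congʳ (L.+-comm v w)) (L.+-assoc w v z)))) (L.sym (L.+-assoc u w _)))

    gather : ∀ k l a b x₁ y₁ a′ b′ x₂ y₂ →
      k L.* (a L.* x₁ L.+ b L.* y₁) L.+ l L.* (a′ L.* x₂ L.+ b′ L.* y₂) L.≈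
      ((k L.* a) L.* x₁ L.+ (l L.* a′) L.* x₂) L.+ ((k L.* b) L.* y₁ L.+ (l L.* b′) L.* y₂)
    gather k l a b x₁ y₁ a′ b′ x₂ y₂ = L.trans (L.+-cong (scale k a b x₁ y₁) (scale l a′ b′ x₂ y₂)) (+-interchange _ _ _ _)

    one-zero : ∀ x y → x L.≈ 1# L.* x L.+ 0# L.* y
    one-zero x y = L.sym (L.trans (L.+-cong (L.*-identityˡ x) (L.zeroˡ y)) (L.+-identityʳ x))

    drop-zero : ∀ k x {w} → w L.≈ 0# → k L.* x L.+ w L.≈ k L.* x L.+ 0# L.* x
    drop-zero k x w≈0 = L.+-congˡ (L.trans w≈0 (L.sym (L.zeroˡ x)))

    comb-exchange : ∀ {x y z} → Comb x y z → ¬ ¬ (Comb x x z ⊎ Comb x z y)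
    comb-exchange {x} {y} {z} (k , l , Kk , Kl , e) c = decide (l L.≈ 0#) λ where
        (yes l≈0) → c (inj₁ (k , 0# , Kk , K0 , L.trans e (drop-zero k x (L.trans (L.*-congʳ l≈0) (L.zeroˡ y)))))
        (no l≉0) → let (l′ , Kl′ , ll′≈1) = K-inv l Kl l≉0 in
          c (inj₂ (L.- (k L.* l′) , l′ , K- _ (K* k l′ Kk Kl′) , Kl′ , L.sym (solve-for k l l′ x y z e ll′≈1)))
      where
      solve-for : ∀ k l l′ x y z → z L.≈ k L.* x L.+ l L.* y → l L.* l′ L.≈ 1# →
        (L.- (k L.* l′)) L.* x L.+ l′ L.* z L.≈ y
      solve-for k l l′ x y z e ll′≈1 =
        L.trans (L.+-congˡ (L.trans (L.*-congˡ e)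
          (L.trans (scale l′ k l x y) (L.+-cong (L.*-congʳ (L.*-comm l′ k)) (L.*-congʳ (L.*-comm l′ l))))))
        (L.trans (L.sym (L.+-assoc _ _ _)) (L.trans (L.+-cong
            (L.trans (L.sym (L.distribʳ x _ _)) (L.trans (L.*-congʳ (L.-‿inverseˡ _)) (L.zeroˡ x)))
            (L.trans (L.*-congʳ ll′≈1) (L.*-identityˡ y)))
          (L.+-identityˡ y)))

    comb-point-sym : ∀ {x z} → ¬ z L.≈ 0# → Comb x x z → Comb z z x
    comb-point-sym {x} {z} z≉0 (k , l , Kk , Kl , e) =
      let (m , Km , klm≈1) = K-inv (k L.+ l) (K+ k l Kk Kl) λ kl≈0 →
            z≉0 (L.trans e (L.trans (L.sym (L.distribʳ x k l)) (L.trans (L.*-congʳ kl≈0) (L.zeroˡ x))))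
      in m , 0# , Km , K0 , L.sym (L.trans (L.trans (L.+-congˡ (L.zeroˡ z)) (L.+-identityʳ _)) (L.trans (L.*-congˡ e)
           (L.trans (L.trans (L.*-congˡ (L.sym (L.distribʳ x k l))) (L.trans (L.sym (L.*-assoc m _ x)) (L.*-congʳ (L.*-comm m _))))
             (L.trans (L.*-congʳ klm≈1) (L.*-identityˡ x)))))

    comb-point-closed : ∀ {x y z w} → Comb x x y → Comb x x z → Comb y z w → Comb x x w
    comb-point-closed {x} (a , b , Ka , Kb , e) (a′ , b′ , Ka′ , Kb′ , e′) (k , l , Kk , Kl , f) =
        k L.* a L.+ l L.* a′ , k L.* b L.+ l L.* b′
      , K+ _ _ (K* _ _ Kk Ka) (K* _ _ Kl Ka′) , K+ _ _ (K* _ _ Kk Kb) (K* _ _ Kl Kb′)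
      , L.trans f (L.trans (L.+-cong (L.*-congˡ e) (L.*-congˡ e′))
          (L.trans (gather k l a b x x a′ b′ x x) (L.sym (L.+-cong (L.distribʳ x _ _) (L.distribʳ x _ _)))))

    comb-veblen : ∀ {x₁ y₁ z₁ x₂ y₂ z₂ z} → Comb x₁ y₁ z₁ → Comb x₂ y₂ z₂ → Comb z₁ z₂ z →
      ∃₂ λ x y → Comb x₁ x₂ x × Comb y₁ y₂ y × z L.≈ x L.+ y
    comb-veblen {x₁} {y₁} {z₁} {x₂} {y₂} {z₂} (a , b , Ka , Kb , e) (a′ , b′ , Ka′ , Kb′ , e′) (k , l , Kk , Kl , f) =
        _ , _
      , (k L.* a , l L.* a′ , K* _ _ Kk Ka , K* _ _ Kl Ka′ , L.refl)
      , (k L.* b , l L.* b′ , K* _ _ Kk Kb , K* _ _ Kl Kb′ , L.refl)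
      , L.trans f (L.trans (L.+-cong (L.*-congˡ e) (L.*-congˡ e′))
          (gather k l a b x₁ y₁ a′ b′ x₂ y₂))

    comb-resp : ∀ {x y z z′} → z′ L.≈ z → Comb x y z → Comb x y z′
    comb-resp e (k , l , Kk , Kl , f) = k , l , Kk , Kl , L.trans e f

  geometry : Geometry (c ⊔ ℓ) ℓ p
  geometry = record
    { points = nonzeroGroup
    ; Line = λ (x , _) (y , _) (z , _) → Comb x y z
    ; line-≈ = λ {(x , _)} {(y , _)} e → 1# , 0# , K1 , K0 , L.trans e (one-zero x y)
    ; line-sym = λ (k , l , Kk , Kl , e) → l , k , Kl , Kk , L.trans e (L.+-comm _ _)
    ; line-exchange = comb-exchange
    ; line-point-sym = λ {_} {(_ , z≉0)} → comb-point-sym z≉0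
    ; line-point-closed = comb-point-closed
    ; line-veblen = λ m₁ m₂ m c →
        let (x , y , mx , my , e) = comb-veblen m₁ m₂ m
        in decide (x L.≈ 0#) λ where
          (yes x≈0) → c (inj₂ (inj₁ (comb-resp (L.trans e (L.trans (L.+-congʳ x≈0) (L.+-identityˡ y))) my)))
          (no x≉0) → decide (y L.≈ 0#) λ where
            (yes y≈0) → c (inj₁ (comb-resp (L.trans e (L.trans (L.+-congˡ y≈0) (L.+-identityʳ x))) mx))
            (no y≉0) → c (inj₂ (inj₂ ((x , x≉0) , (y , y≉0) , mx , my
              , 1# , 1# , K1 , K1 , L.trans e (L.sym (L.+-cong (L.*-identityˡ x) (L.*-identityˡ y))))))
    ; line-∙ = λ (w , _) {(x , _)} {(y , _)} (k , l , Kk , Kl , e) → k , l , Kk , Kl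
        , L.trans (L.*-congˡ e) (L.trans (L.distribˡ w _ _) (L.+-cong (*-swap w k x) (*-swap w l y)))
    }

  open Subspaces geometry
  open Products geometry

  subspace : (V : Carrier → Set p) → IsSubspace L K V → Sub
  subspace V (resp , V0 , V+ , V*) = record
    { mem    = λ (z , _) → Lift (c ⊔ ℓ) (¬ ¬ V z)
    ; stable = λ h → lift λ k → h λ h′ → lower h′ k
    ; closed = λ (lift a) (lift b) (k , l , Kk , Kl , e) → lift λ c → a λ Vx → b λ Vy →
        c (resp (L.sym e) (V+ _ _ (V* k _ Kk Vx) (V* l _ Kl Vy)))
    }

  private
    sum-cong : ∀ d {f g : Fin d → Carrier} → (∀ a → f a L.≈ g a) → sumL L d f L.≈ sumL L d g
    sum-cong zero e = L.refl
    sum-cong (suc d) e = L.+-cong (e fzero) (sum-cong d (e ∘ fsuc))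

    sum-comb : ∀ d k l (f g : Fin d → Carrier) →
      k L.* sumL L d f L.+ l L.* sumL L d g L.≈ sumL L d (λ a → k L.* f a L.+ l L.* g a)
    sum-comb zero k l f g = L.trans (L.+-cong (L.zeroʳ k) (L.zeroʳ l)) (L.+-identityˡ 0#)
    sum-comb (suc d) k l f g = L.trans
      (L.trans (L.+-cong (L.distribˡ k _ _) (L.distribˡ l _ _)) (+-interchange _ _ _ _))
      (L.+-congˡ (sum-comb d k l (f ∘ fsuc) (g ∘ fsuc)))

    sum-zero : ∀ d (b : Fin d → Carrier) → sumL L d (λ a → 0# L.* b a) L.≈ 0#
    sum-zero zero b = L.refl
    sum-zero (suc d) b = L.trans (L.+-cong (L.zeroˡ _) (sum-zero d (b ∘ fsuc))) (L.+-identityˡ 0#)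

    Spans : ∀ d → (Fin d → Carrier) → Carrier → Set (c ⊔ ℓ ⊔ p)
    Spans d b z = Σ (Fin d → Carrier) λ co → (∀ a → K (co a)) × z L.≈ sumL L d (λ a → co a L.* b a)

    cons : ∀ {d} → Carrier → (Fin d → Carrier) → Fin (suc d) → Carrier
    cons x f fzero    = x
    cons x f (fsuc a) = f a

    cons-K : ∀ {d x} {f : Fin d → Carrier} → K x → (∀ a → K (f a)) → ∀ a → K (cons x f a)
    cons-K Kx Kf fzero    = Kx
    cons-K Kx Kf (fsuc a) = Kf a

    Independent : ∀ d → (Fin d → Carrier) → Set (c ⊔ ℓ ⊔ p)
    Independent d b = (co : Fin d → Carrier) → (∀ a → K (co a)) → sumL L d (λ a → co a L.* b a) L.≈ 0# → ∀ a → co a L.≈ 0#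

  span : ∀ d → (Fin d → Carrier) → Sub
  span d b = record
    { mem    = λ (z , _) → ¬ ¬ Spans d b z
    ; stable = λ h k → h λ h′ → h′ k
    ; closed = λ h h′ (k , l , Kk , Kl , e) c → h λ (f , Kf , ef) → h′ λ (g , Kg , eg) →
        c ( (λ a → k L.* f a L.+ l L.* g a) , (λ a → K+ _ _ (K* _ _ Kk (Kf a)) (K* _ _ Kl (Kg a)))
          , L.trans e (L.trans (L.+-cong (L.*-congˡ ef) (L.*-congˡ eg)) (L.trans (sum-comb d k l _ _)
              (sum-cong d λ a → L.trans (L.+-cong (L.sym (L.*-assoc k _ _)) (L.sym (L.*-assoc l _ _))) (L.sym (L.distribʳ (b a) _ _))))))
    }

  dim-span : ∀ d b → Independent d b → Dim (span d b) d
  dim-span zero b ind = empty λ {(_ , z≉0)} h → h λ (_ , _ , e) → z≉0 e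
  dim-span (suc d) b ind = extend tail b₀ (dim-span d (b ∘ fsuc) ind-tail) b₀∉
      ( (λ {(z , z≉0)} h → stable (tail ⊕ b₀) {z , z≉0} λ k → h λ (co , Kco , e) →
          let w = sumL L d (λ a → co (fsuc a) L.* b (fsuc a)) in decide (w L.≈ 0#) λ where
            (yes w≈0) → k (closed (tail ⊕ b₀) {b₀} {b₀} {z , z≉0} (⊕-inʳ tail b₀) (⊕-inʳ tail b₀)
              (co fzero , 0# , Kco fzero , K0 , L.trans e (drop-zero _ _ w≈0)))
            (no w≉0) → k (closed (tail ⊕ b₀) {b₀} {w , w≉0} {z , z≉0} (⊕-inʳ tail b₀)
              (⊕-inˡ tail b₀ {w , w≉0} λ c → c (co ∘ fsuc , Kco ∘ fsuc , L.refl))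
              (co fzero , 1# , Kco fzero , K1 , L.trans e (L.+-congˡ (L.sym (L.*-identityˡ w))))))
      , ⊕-⊆ tail b₀ (span (suc d) b)
          (λ h c → h λ (co , Kco , e) → c (cons 0# co , cons-K K0 Kco
             , L.trans e (L.sym (L.trans (L.+-congʳ (L.zeroˡ _)) (L.+-identityˡ _)))))
          (λ c → c (cons 1# (λ _ → 0#) , cons-K K1 (λ _ → K0)
             , L.sym (L.trans (L.+-cong (L.*-identityˡ _) (sum-zero d _)) (L.+-identityʳ _)))))
    where
    tail : Sub
    tail = span d (b ∘ fsuc)
    ind-tail : Independent d (b ∘ fsuc)
    ind-tail co Kco e a = ind (cons 0# co) (cons-K K0 Kco) (L.trans (L.+-cong (L.zeroˡ _) e) (L.+-identityˡ 0#)) (fsuc a)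
    b₀≉0 : ¬ b fzero L.≈ 0#
    b₀≉0 e = 1≉0 (ind (cons 1# (λ _ → 0#)) (cons-K K1 (λ _ → K0))
      (L.trans (L.+-cong (L.trans (L.*-identityˡ _) e) (sum-zero d _)) (L.+-identityˡ 0#)) fzero)
    b₀ : Nonzero
    b₀ = b fzero , b₀≉0
    b₀∉ : b₀ ∉ tail
    -- Moving b₀ to the other side gives a relation with coefficient -1 at b₀, and independence
    -- would force -1 ≈ 0.
    b₀∉ h = h λ (co , Kco , e) → 1≉0 (L.trans (L.sym (L.+-identityʳ 1#)) (L.trans
      (L.+-congˡ (L.sym (ind (cons (L.- 1#) co) (cons-K (K- 1# K1) Kco)
        (L.trans (L.+-congˡ (L.trans (L.sym e) (L.sym (L.*-identityˡ _))))
          (L.trans (L.sym (L.distribʳ _ _ _)) (L.trans (L.*-congʳ (L.-‿inverseˡ 1#)) (L.zeroˡ _)))) fzero)))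
      (L.-‿inverseʳ 1#)))

  private
    sum-in : ∀ {V} → IsSubspace L K V → ∀ d (co b : Fin d → Carrier) → (∀ a → K (co a)) → (∀ a → V (b a)) →
      V (sumL L d (λ a → co a L.* b a))
    sum-in (_ , V0 , _ , _) zero co b Kco Vb = V0
    sum-in sub@(_ , _ , V+ , V*) (suc d) co b Kco Vb =
      V+ _ _ (V* _ _ (Kco fzero) (Vb fzero)) (sum-in sub d (co ∘ fsuc) (b ∘ fsuc) (Kco ∘ fsuc) (Vb ∘ fsuc))

  dim-subspace : ∀ {V d} (sub : IsSubspace L K V) → HasDim L K V d → Dim (subspace V sub) d
  dim-subspace {V} {d} sub (b , Vb , ind , gen) =
    dim-≐ {span d b} {subspace V sub} ((λ {z} m → span⊆ {z} m) , (λ {z} m → ⊆span {z} m)) (dim-span d b ind)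
    where
    span⊆ : span d b ⊆ subspace V sub
    span⊆ h = lift λ k → h λ (co , Kco , e) → k (proj₁ sub (L.sym e) (sum-in sub d co b Kco Vb))
    ⊆span : subspace V sub ⊆ span d b
    ⊆span {z , _} (lift h) k = h λ Vz → k (gen z Vz)

  dominates : ∀ {n} → GoodDegree n → (F : Fin n → Carrier → Set p) → IsFieldFlag L K n F →
    (T : Fin n → Fin n → Fin n) → IsFieldFlagTypeOf L K n F T →
    ∃ λ ps → IsPrimeTowerType n ps × (∀ i j → towerType ps (toℕ i) (toℕ j) ≤ toℕ (T i j))
  dominates good F (_ , whole , sub , dims , step , first , _) T typ =
    flag-dominates good (dim-≐ ((λ _ → tt) , (λ _ → lift λ k → k tt)) (dim-subspace {V = λ _ → ⊤} (_ , _ , _ , _) whole))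
      Fs (λ i → dim-subspace (sub i) (dims i))
      (λ i j i≤j (lift h) → lift λ k → h λ Fx → k (chain-mono F step i j i≤j Fx))
      (λ i → let (o , o≡0) = least-index i in
         lift λ k → k (chain-mono F step o i (≤-trans (≤-reflexive o≡0) z≤n) (proj₂ (first o o≡0 _) K1)))
      T (λ i j → ·-⊆ (Fs i) (Fs j) (Fs (T i j)) λ (lift a) (lift b) → lift λ k → a λ x → b λ y →
        k (proj₁ (sub (T i j)) (L.trans (L.+-identityʳ _) (L.*-identityˡ _))
             -- A one-term sum with coefficient 1 extracts the single product; `·-⊆` restores the
             -- span.
             (proj₁ (typ i j) 1 (λ _ → 1#) (λ _ → _) (λ _ → _) (λ _ → K1) (λ _ → x) (λ _ → y))))
    where
    Fs : Fin _ → Sub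
    Fs i = subspace (F i) (sub i)

theorem5p1 : ∀ {c ℓ p : Level} (n : ℕ) → GoodDegree n →
    (T : Fin n → Fin n → Fin n) → IsFlagType n T → Realizable c ℓ p n T →
    ∃ λ (ps : List ℕ) → IsPrimeTowerType n ps ×
    (∀ i j → towerType ps (toℕ i) (toℕ j) ≤ toℕ (T i j))
theorem5p1 {p = p} n good T _ (inj₁ (G , F , flag , typ)) = GroupCase.dominates p G good F flag T typ
theorem5p1 n good T _ (inj₂ (L , K , F , flag , typ)) = FieldCase.dominates L K (proj₁ flag) good F flag T typ
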